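{- Let $G$ be a plane DAG. Then $G$ admits an upward-planar L-drawing (respecting its embedding) if and only if $G$ can be augmented (by adding vertices and edges, with the embedding of $G$ preserved) to a plane $st$-graph that admits an upward-planar L-drawing, i.e., to a plane $st$-graph that admits a bitonic $st$-ordering.
   Context: A DAG is a connected directed acyclic graph. A plane DAG is a DAG with a fixed planar embedding (counter-clockwise cyclic order of edges around each vertex) and a fixed unbounded face. In an L-drawing of a digraph, vertices are points and each edge $e$ is drawn as a polyline consisting of a vertical segment incident to the tail of $e$ and a horizontal segment incident to the head of $e$. An L-drawing is planar if distinct edges may overlap but do not cross; it is upward if, for every edge, the lowest endpoint of its vertical segment is its tail. A planar $st$-graph is a planar DAG with a single source $s$, a single sink $t$, and an edge $(s,t)$; a plane $st$-graph is a planar $st$-graph with a planar embedding in which $(s,t)$ is on the outer face. An $st$-ordering is an injective numbering $\pi$ of the vertices with $\pi(u)<\pi(v)$ for every edge $(u,v)$. For a vertex $v$ of a plane $st$-graph let $S(v)=\langle v_1,\dots,v_k\rangle$ be the successors of $v$ from left to right in an upward-planar drawing respecting the embedding; the $st$-ordering is bitonic if for every $v$ there is $h$ with $\pi(v_1)<\dots<\pi(v_h)$ and $\pi(v_h)>\dots>\pi(v_k)$. -}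

module Defs where

open import Data.Nat using (ℕ; zero; suc; _+_; _≤_) renaming (_<_ to _<ℕ_)
open import Data.Integer using (ℤ; -_) renaming (_<_ to _<ℤ_; _≤_ to _≤ℤ_)
open import Data.Integer.Properties using (_<?_)
open import Data.Fin using (Fin)
open import Data.Bool using (Bool; true; false; not; if_then_else_)
open import Data.Product using (Σ; _×_; _,_; proj₁; proj₂)
open import Data.Sum using (_⊎_)
open import Data.List using (List; []; _∷_; _++_; [_]; map)
open import Data.List.Relation.Unary.Linked using (Linked)
open import Data.List.Relation.Unary.All using (All)
open import Data.List.Relation.Unary.Unique.Propositional using (Unique)
open import Data.List.Membership.Propositional using (_∈_)
open import Relation.Nullary using (¬_; does)
open import Relation.Binary.PropositionalEquality using (_≡_; _≢_)
open import Function using (_∘_)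
open import Function.Definitions using (Injective)

iter : {A : Set} → (A → A) → ℕ → A → A
iter f zero    a = a
iter f (suc k) a = f (iter f k a)

InOrbit : {A : Set} → (A → A) → A → A → Set
InOrbit f a b = Σ ℕ (λ k → iter f k a ≡ b)

-- Combinatorial maps (rotation systems) of digraphs.
-- Edges are Fin m, each with a tail and a head.  A dart is an edge
-- together with an end: (e , false) is the end of e at its tail,
-- (e , true) the end of e at its head.

Dart : ℕ → Set
Dart m = Fin m × Bool

flipD : {m : ℕ} → Dart m → Dart m
flipD (e , b) = (e , not b)

dartEnd : {n m : ℕ} → (Fin m → Fin n) → (Fin m → Fin n) → Dart m → Fin n
dartEnd tl hd (e , false) = tl e
dartEnd tl hd (e , true)  = hd e

-- A digraph with a fixed embedding:
--   rot d  = the dart following d in COUNTER-CLOCKWISE order around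
--            the vertex of d (a permutation, one cycle per vertex);
--   outer  = a dart identifying the outer (unbounded) face, see faceNext.
record EmbeddedDigraph : Set where
  field
    n      : ℕ
    m      : ℕ
    tl     : Fin m → Fin n
    hd     : Fin m → Fin n
    rot    : Dart m → Dart m
    rot⁻¹  : Dart m → Dart m
    outer  : Dart m

  dartVertex : Dart m → Fin n
  dartVertex = dartEnd tl hd

  -- face permutation: faces of the embedding are the orbits of faceNext.
  -- The angle at a vertex from dart d counter-clockwise to rot d belongs
  -- to the face (faceNext-orbit) containing rot d.
  faceNext : Dart m → Dart m
  faceNext = rot ∘ flipD

  SameFace : Dart m → Dart m → Set
  SameFace = InOrbit faceNext

  field
    rot-inv₁ : ∀ d → rot (rot⁻¹ d) ≡ d
    rot-inv₂ : ∀ d → rot⁻¹ (rot d) ≡ d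
    rot-at   : ∀ d → dartVertex (rot d) ≡ dartVertex d
    rot-cyc  : ∀ d d' → dartVertex d ≡ dartVertex d' → InOrbit rot d d'

module _ (G : EmbeddedDigraph) where
  open EmbeddedDigraph G

  Simple : Set
  Simple = ∀ e e' → tl e ≡ tl e' → hd e ≡ hd e' → e ≡ e'

  data UWalk : Fin n → Fin n → Set where
    here : ∀ {v} → UWalk v v
    fwd  : ∀ {w} e → UWalk (hd e) w → UWalk (tl e) w
    bwd  : ∀ {w} e → UWalk (tl e) w → UWalk (hd e) w

  Connected : Set
  Connected = ∀ u v → UWalk u v

  data DPath : Fin n → Fin n → Set where
    edge : ∀ e → DPath (tl e) (hd e)
    cons : ∀ {w} e → DPath (hd e) w → DPath (tl e) w

  Acyclic : Set
  Acyclic = ∀ v → ¬ DPath v v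

  HasFaceCount : ℕ → Set
  HasFaceCount F =
    Σ (Dart m → Fin F) λ c →
      (∀ i → Σ (Dart m) λ d → c d ≡ i) ×
      (∀ d d' → (c d ≡ c d' → SameFace d d') × (SameFace d d' → c d ≡ c d'))

  -- the rotation system is a planar embedding (genus 0, Euler's formula
  -- for connected graphs)
  PlanarEmbedding : Set
  PlanarEmbedding = Σ ℕ λ F → HasFaceCount F × (n + F ≡ m + 2)

  IsPlaneDAG : Set
  IsPlaneDAG = Simple × Connected × Acyclic × PlanarEmbedding

  NoIn : Fin n → Set
  NoIn v = ∀ e → hd e ≢ v

  NoOut : Fin n → Set
  NoOut v = ∀ e → tl e ≢ v

  IsPlaneSTGraph : Set
  IsPlaneSTGraph =
    IsPlaneDAG ×
    Σ (Fin n) λ s → Σ (Fin n) λ t → Σ (Fin m) λ e →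
      tl e ≡ s × hd e ≡ t ×
      (∀ v → (NoIn v → v ≡ s) × (v ≡ s → NoIn v)) ×
      (∀ v → (NoOut v → v ≡ t) × (t ≡ v → NoOut v)) ×
      (SameFace outer (e , false) ⊎ SameFace outer (e , true))

  -- Upward-planar L-drawings.
  -- Vertices get points with pairwise distinct x- and y-coordinates
  -- (integers; only the relative order of coordinates matters).  Edge e
  -- is drawn as the vertical segment from (x(tl e), y(tl e)) to
  -- (x(tl e), y(hd e)) followed by the horizontal segment from
  -- (x(tl e), y(hd e)) to (x(hd e), y(hd e)).

  module Drawing (x y : Fin n → ℤ) where

    StrictlyBetween : ℤ → ℤ → ℤ → Set
    StrictlyBetween a b c = (a <ℤ c × c <ℤ b) ⊎ (b <ℤ c × c <ℤ a)

    -- the vertical segment of e and the horizontal segment of f cross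
    -- (meet in a point interior to both segments); since coordinates are
    -- distinct, all other common points of two edges are shared endpoints
    -- or overlaps of segments of edges with a common tail / common head,
    -- which are allowed
    Cross : Fin m → Fin m → Set
    Cross e f = StrictlyBetween (y (tl e)) (y (hd e)) (y (hd f))
              × StrictlyBetween (x (tl f)) (x (hd f)) (x (tl e))

    -- position of a dart in the counter-clockwise order around its vertex
    -- in an upward L-drawing (lexicographic key, starting after "south"):
    --  0: incoming edge arriving from the right, by increasing x of tail
    --  1: outgoing edge bending right, by increasing y of head
    --  2: outgoing edge bending left, by decreasing y of head
    --  3: incoming edge arriving from the left, by increasing x of tail
    group : Dart m → ℕ
    group (e , true)  = if does (x (hd e) <? x (tl e)) then 0 else 3
    group (e , false) = if does (x (tl e) <? x (hd e)) then 1 else 2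

    second : Dart m → ℤ
    second (e , true)  = x (tl e)
    second (e , false) = if does (x (tl e) <? x (hd e)) then y (hd e) else - y (hd e)

    KeyLt : Dart m → Dart m → Set
    KeyLt d d' = group d <ℕ group d' ⊎ (group d ≡ group d' × second d <ℤ second d')

    KeyLe : Dart m → Dart m → Set
    KeyLe d d' = KeyLt d d' ⊎ d ≡ d'

    CcwNext : Dart m → Dart m → Set
    CcwNext d d' =
      dartVertex d' ≡ dartVertex d ×
      ( (KeyLt d d' ×
          (∀ d'' → dartVertex d'' ≡ dartVertex d → ¬ (KeyLt d d'' × KeyLt d'' d')))
      ⊎ ((∀ d'' → dartVertex d'' ≡ dartVertex d → KeyLe d' d'') ×
         (∀ d'' → dartVertex d'' ≡ dartVertex d → KeyLe d'' d)) )

    -- the angle from d counter-clockwise to d' (at a topmost vertex, which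
    -- has only incoming edges) contains the upward direction
    NorthIn : Dart m → Dart m → Set
    NorthIn d d' = (group d ≤ 1 × 2 ≤ group d')
                 ⊎ (KeyLe d' d × (group d ≤ 1 ⊎ 2 ≤ group d'))

    record IsUpwardPlanarLDrawing : Set where
      field
        x-inj    : Injective _≡_ _≡_ x
        y-inj    : Injective _≡_ _≡_ y
        upward   : ∀ e → y (tl e) <ℤ y (hd e)
        noCross  : ∀ e f → ¬ Cross e f
        respRot  : ∀ d → CcwNext d (rot d)
        -- ... and the outer face: the region above the topmost vertex
        -- belongs to the outer face
        respOuter : ∀ v → (∀ w → y w ≤ℤ y v) → ∀ d → dartVertex d ≡ v →
                    NorthIn d (rot d) → SameFace outer (rot d)

  UpwardPlanarLDrawable : Set
  UpwardPlanarLDrawable =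
    Σ (Fin n → ℤ) λ x → Σ (Fin n → ℤ) λ y → Drawing.IsUpwardPlanarLDrawing x y

  IsOutDart : Fin n → Dart m → Set
  IsOutDart v d = Σ (Fin m) λ e → d ≡ (e , false) × tl e ≡ v

  -- L lists the outgoing darts of v from left to right (in an upward
  -- drawing respecting the embedding): consecutive in clockwise order,
  -- each exactly once, and the angle left of the leftmost one is bounded
  -- by an incoming edge or (for the source) is the outer face
  SuccList : Fin n → List (Dart m) → Set
  SuccList v L =
    All (IsOutDart v) L × Unique L ×
    (∀ e → tl e ≡ v → (e , false) ∈ L) ×
    Linked (λ a b → rot b ≡ a) L ×
    (∀ d₁ rest → L ≡ d₁ ∷ rest →
       proj₂ (rot d₁) ≡ true ⊎ SameFace outer (rot d₁))

  data Bitonic : List ℕ → Set where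
    empty : Bitonic []
    peak  : ∀ ys p zs → Linked _<ℕ_ (ys ++ [ p ]) →
            Linked (λ a b → b <ℕ a) (p ∷ zs) → Bitonic (ys ++ p ∷ zs)

  HasBitonicSTOrdering : Set
  HasBitonicSTOrdering =
    Σ (Fin n → ℕ) λ π →
      Injective _≡_ _≡_ π ×
      (∀ e → π (tl e) <ℕ π (hd e)) ×
      (∀ v → Σ (List (Dart m)) λ L →
         SuccList v L × Bitonic (map (π ∘ hd ∘ proj₁) L))

module _ (G H : EmbeddedDigraph) where
  private
    module G = EmbeddedDigraph G
    module H = EmbeddedDigraph H

  Augments : Set
  Augments =
    Σ (Fin G.n → Fin H.n) λ fv → Injective _≡_ _≡_ fv ×
    Σ (Fin G.m → Fin H.m) λ fe → Injective _≡_ _≡_ fe ×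
    (∀ e → H.tl (fe e) ≡ fv (G.tl e)) ×
    (∀ e → H.hd (fe e) ≡ fv (G.hd e)) ×
    let fd : Dart G.m → Dart H.m
        fd = λ d → (fe (proj₁ d) , proj₂ d)
        InImg : Dart H.m → Set
        InImg d' = Σ (Dart G.m) λ d → fd d ≡ d'
        FirstG : Dart H.m → Dart G.m → Set
        FirstG x q = Σ ℕ λ k → iter H.rot k x ≡ fd q ×
                       (∀ j → j <ℕ k → ¬ InImg (iter H.rot j x))
    in
    (∀ d → Σ ℕ λ k → 1 ≤ k × iter H.rot k (fd d) ≡ fd (G.rot d) ×
             (∀ j → 1 ≤ j → j <ℕ k → ¬ InImg (iter H.rot j (fd d)))) ×
    -- outer face: label every angle of H (dart x, standing for the angle
    -- ending at x) by the face of G containing it; the labelling is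
    -- forced at vertices of G, constant along faces of H and across new
    -- edges; the outer face of H lies in the outer face of G
    (Σ (Dart H.m → Dart G.m) λ lab →
       (∀ x v → H.dartVertex x ≡ fv v → FirstG x (lab x)) ×
       (∀ x → G.SameFace (lab x) (lab (H.faceNext x))) ×
       (∀ x → ¬ (Σ (Fin G.m) λ e → fe e ≡ proj₁ x) →
              G.SameFace (lab x) (lab (flipD x))) ×
       G.SameFace G.outer (lab H.outer))

{-# OPTIONS --safe #-}
-- An L-drawing of G is completed inside its own drawing: with a lowest source s on the far left and a
-- highest sink t on the far right, the edge (s , t) is a left and upper border, every sink of G is
-- joined to the first horizontal segment above it and every source to the first vertical segment to
-- its left.  The result is a plane st-graph H because, sweeping the drawing upwards, every face is
-- found to have exactly one source switch (an angle between two outgoing edges), which is Euler's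
-- formula for st-graphs; the new edges lie in the faces of G since, merging the faces of H across
-- them, at least as many classes remain as G has faces.  The heads of the edges leaving a vertex are
-- bitonic in y.
-- Conversely, Euler's formula leaves one source switch per face of a plane st-graph, so that at each
-- level of an st-ordering the incoming edges of the next vertex are consecutive in the left-to-right
-- list of edges crossing the level; bitonicity then allows to place it next to the tail of the first one.
-- A drawing of H restricts to G: above the top vertex of G all edges of H are new, so climbing them
-- stays in one face of G.
module Submission where

open import Defs
open import Data.Nat using (ℕ; zero; suc; z≤n; s≤s; _+_; _*_; _∸_; _≤_; _<_; s≤s⁻¹)
open import Data.Nat.Properties using (≤-refl; ≤-trans; ≤-reflexive; <-trans; <-≤-trans; ≤-<-trans; <⇒≤; <-irrefl; <-cmp; m≤n⇒m<n∨m≡n; ≤-antisym; <⇒≱; ≮⇒≥; n<1+n; m≤n+m)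
open import Data.Integer using (ℤ; +_) renaming (_<_ to _<ℤ_; _≤_ to _≤ℤ_)
open import Data.Fin using (Fin; zero; suc; toℕ; punchIn; punchOut; _↑ˡ_; _↑ʳ_; splitAt; join)
open import Data.Fin.Properties using (any?; injective⇒≤; pigeonhole)
open import Data.Bool using (Bool; true; false; not; if_then_else_)
open import Data.Bool.Properties using (¬-not; not-¬)
open import Data.Product using (Σ; ∃; _×_; _,_; proj₁; proj₂)
open import Data.Sum using (_⊎_; inj₁; inj₂) renaming (map to ⊎-map)
open import Data.Sum.Properties using (inj₁-injective)
open import Data.Empty using (⊥; ⊥-elim)
open import Data.Unit using (⊤; tt)
open import Data.List using (List; []; _∷_; _++_; [_]; map; length; lookup; filter; allFin; tabulate)
open import Data.List.Properties using (map-∘; length-map; length-tabulate; length-++; ++-assoc; ++-identityʳ)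
open import Data.List.Relation.Unary.Linked using (Linked; []; [-]; _∷_)
open import Data.List.Relation.Unary.All using (All; []; _∷_)
open import Data.List.Relation.Unary.Any using (here; there; index)
open import Data.List.Relation.Unary.AllPairs using (AllPairs; []; _∷_)
open import Data.List.Relation.Unary.Unique.Propositional using (Unique)
open import Data.List.Membership.Propositional using (_∈_)
open import Data.List.Membership.Propositional.Properties using (∈-lookup; ∈-allFin; ∈-map⁺; ∈-map⁻; ∈-filter⁺; ∈-filter⁻; ∈-++⁺ˡ; ∈-++⁺ʳ; ∈-++⁻; ∈-∃++)
open import Relation.Nullary using (¬_; Dec; yes; no; does; contradiction)
open import Relation.Nullary.Decidable using (_×-dec_; _⊎-dec_; ¬?; map′)
open import Relation.Binary.PropositionalEquality using (_≡_; _≢_; refl; sym; trans; cong; cong₂; subst; subst₂)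
open import Relation.Binary.PropositionalEquality.Properties using (subst-subst-sym)
open import Relation.Binary.Construct.Closure.ReflexiveTransitive using (Star; ε; _◅_; _◅◅_)
open import Relation.Binary.Definitions using (tri<; tri≈; tri>)
open import Function using (_∘_; id)
open import Function.Definitions using (Injective)
open import Function.Bundles using (_⇔_; mk⇔)
import Data.Nat.Properties as ℕ
import Data.Integer as ℤ
import Data.Integer.Properties as ℤₚ
import Data.Fin.Properties as Fin
import Data.List.Relation.Unary.Linked as Linked
import Data.List.Relation.Unary.Linked.Properties as Linkedₚ
import Data.List.Relation.Unary.All as All
import Data.List.Relation.Unary.All.Properties as Allₚ
import Data.List.Relation.Unary.Any as Any
import Data.List.Relation.Unary.AllPairs as AllPairs
import Data.List.Relation.Unary.Unique.Propositional.Properties as Unique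
import Data.List.Relation.Unary.AllPairs.Properties as AllPairsₚ
import Data.Bool.Properties as Bool

-- Faces are only orbits of `faceNext`, so no region of the plane can be pointed at, and counting
-- takes the place of topology. An edge either is the counter-clockwise end of a source switch or
-- comes right after an incoming edge. Every vertex other than `s` and `t` has an edge of the second
-- kind, and every face boundary, followed downwards, ends at a switch of that face; `n + F ≡ m + 2`
-- makes both bounds tight. When an st-ordering is drawn, a vertex goes to the right of the tail of
-- its first incoming edge, unless the right neighbour of this edge at that tail has not ended yet,
-- which forces it to the left. Both neighbours would have to end higher for the two demands to
-- clash, and that is a valley, which bitonicity excludes. The labelling in `Augments` says that
-- faces of `G` are unions of faces of `H`. Merging across a new edge loses at most one class. By
-- Euler's formulas for `G` and `H` the count is exact once two new edges are set against the two
-- new vertices.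

-- Iterates, orbits and counting on finite sets

iter-+ : {A : Set} (f : A → A) (j k : ℕ) (a : A) → iter f (j + k) a ≡ iter f j (iter f k a)
iter-+ f zero    k a = refl
iter-+ f (suc j) k a = cong f (iter-+ f j k a)

iter-suc : {A : Set} (f : A → A) (k : ℕ) (a : A) → iter f k (f a) ≡ f (iter f k a)
iter-suc f zero    a = refl
iter-suc f (suc k) a = cong f (iter-suc f k a)

iter-injective : {A : Set} (f : A → A) → (∀ {a b} → f a ≡ f b → a ≡ b) →
  ∀ k {a b} → iter f k a ≡ iter f k b → a ≡ b
iter-injective f inj zero    eq = eq
iter-injective f inj (suc k) eq = iter-injective f inj k (inj eq)

iter-multiple : {A : Set} (f : A → A) (k : ℕ) (a : A) → iter f k a ≡ a → ∀ j → iter f (j * k) a ≡ a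
iter-multiple f k a eq zero    = refl
iter-multiple f k a eq (suc j) =
  trans (iter-+ f k (j * k) a) (trans (cong (iter f k) (iter-multiple f k a eq j)) eq)

least : {P : ℕ → Set} → (∀ k → Dec (P k)) → ∀ k → P k →
  Σ ℕ λ j → j ≤ k × P j × (∀ i → i < j → ¬ P i)
least {P} P? k pk with P? 0
... | yes p0 = 0 , z≤n , p0 , λ _ ()
least {P} P? zero    pk | no ¬p0 = contradiction pk ¬p0
least {P} P? (suc k) pk | no ¬p0 with least (λ i → P? (suc i)) k pk
... | j , j≤k , pj , min =
  suc j , s≤s j≤k , pj , λ { zero _ → ¬p0 ; (suc i) (s≤s i<j) → min i i<j }

module FinitePermutation {A : Set} {N : ℕ} (code : A → Fin N)
  (code-inj : ∀ {a b} → code a ≡ code b → a ≡ b)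
  (f : A → A) (f-inj : ∀ {a b} → f a ≡ f b → a ≡ b) where

  period : ∀ a → Σ ℕ λ k → iter f (suc k) a ≡ a
  period a with pigeonhole (n<1+n N) (λ i → code (iter f (toℕ i) a))
  ... | i , j , i<j , eq = J ∸ suc I , iter-injective f f-inj I (trans (sym (iter-+ f I (suc (J ∸ suc I)) a))
      (trans (cong (λ k → iter f k a) arith) (sym (code-inj eq))))
    where
    I = toℕ i
    J = toℕ j
    arith : I + suc (J ∸ suc I) ≡ J
    arith = trans (ℕ.+-suc I (J ∸ suc I)) (ℕ.m+[n∸m]≡n i<j)

  -- With period `suc p`, a walk of `k` steps is completed to a multiple of the period by `k * p`
  -- more.
  orbit-sym : ∀ {a b} → InOrbit f a b → InOrbit f b a
  orbit-sym {a} {b} (k , refl) with period a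
  ... | p , eq = k * p , trans (sym (iter-+ f (k * p) k a))
    (trans (cong (λ z → iter f z a) (trans (ℕ.+-comm (k * p) k) (sym (ℕ.*-suc k p)))) (iter-multiple f (suc p) a eq k))

orbit-refl : {A : Set} {f : A → A} {a : A} → InOrbit f a a
orbit-refl = 0 , refl

orbit-trans : {A : Set} {f : A → A} {a b c : A} → InOrbit f a b → InOrbit f b c → InOrbit f a c
orbit-trans {f = f} {a} (j , refl) (k , refl) = k + j , iter-+ f k j a

orbit-const : {A B : Set} {f : A → A} (c : A → B) → (∀ a → c (f a) ≡ c a) →
  ∀ {a b} → InOrbit f a b → c b ≡ c a
orbit-const {f = f} c inv {a} (k , refl) = go k
  where
  go : ∀ k → c (iter f k a) ≡ c a
  go zero    = refl
  go (suc k) = trans (inv (iter f k a)) (go k)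

injective⇒surjective : ∀ {n} (f : Fin n → Fin n) → Injective _≡_ _≡_ f → ∀ y → ∃ λ x → f x ≡ y
injective⇒surjective {suc n} f inj y with any? (λ x → f x Fin.≟ y)
... | yes p = p
... | no ¬p = contradiction (injective⇒≤ {f = g} g-inj) (ℕ.<⇒≱ (n<1+n n))
  where
  y≢f : ∀ x → y ≢ f x
  y≢f x eq = ¬p (x , sym eq)
  g : Fin (suc n) → Fin n
  g x = punchOut (y≢f x)
  g-inj : Injective _≡_ _≡_ g
  g-inj eq = inj (Fin.punchOut-injective (y≢f _) (y≢f _) eq)

-- A section is injective, so the two sizes agree and the section is onto; hence every element is
-- the chosen preimage of its image.
surjective⇒injective : ∀ {m n} (f : Fin m → Fin n) → m ≤ n → (∀ y → ∃ λ x → f x ≡ y) →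
  ∀ {a b} → f a ≡ f b → a ≡ b
surjective⇒injective {m} {n} f m≤n surj {a} {b} eq = go (≤-antisym (injective⇒≤ section-injective) m≤n)
  where
  section : Fin n → Fin m
  section y = proj₁ (surj y)
  section-injective : Injective _≡_ _≡_ section
  section-injective {y} {z} e = trans (sym (proj₂ (surj y))) (trans (cong f e) (proj₂ (surj z)))
  go : n ≡ m → a ≡ b
  go refl with injective⇒surjective section section-injective a | injective⇒surjective section section-injective b
  ... | a' , refl | b' , refl = cong section (trans (sym (proj₂ (surj a'))) (trans eq (proj₂ (surj b'))))

module _ {A : Set} where

  lookup-injective : {xs : List A} → Unique xs → ∀ {i j} → lookup xs i ≡ lookup xs j → i ≡ j
  lookup-injective (_ ∷ _) {zero}  {zero}  eq = refl
  lookup-injective {x ∷ xs} (p ∷ _) {zero}  {suc j} eq = contradiction eq (All.lookup p (∈-lookup j))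
  lookup-injective {x ∷ xs} (p ∷ _) {suc i} {zero}  eq = contradiction (sym eq) (All.lookup p (∈-lookup i))
  lookup-injective (_ ∷ u) {suc i} {suc j} eq = cong suc (lookup-injective u eq)

  lookup-index : {xs : List A} {x : A} (p : x ∈ xs) → lookup xs (index p) ≡ x
  lookup-index (here refl) = refl
  lookup-index (there p)   = lookup-index p

length-complete : ∀ {n} {xs : List (Fin n)} → Unique xs → (∀ v → v ∈ xs) → length xs ≡ n
length-complete {n} {xs} uniq all = ≤-antisym (injective⇒≤ {f = lookup xs} (lookup-injective uniq))
  (injective⇒≤ {f = λ v → index (all v)}
    (λ {v} {w} eq → trans (sym (lookup-index (all v))) (trans (cong (lookup xs) eq) (lookup-index (all w)))))

length-filter-¬ : {A : Set} {P : A → Set} (P? : ∀ a → Dec (P a)) (xs : List A) →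
  length (filter P? xs) + length (filter (λ a → ¬? (P? a)) xs) ≡ length xs
length-filter-¬ P? [] = refl
length-filter-¬ P? (x ∷ xs) with P? x
... | yes _ = cong suc (length-filter-¬ P? xs)
... | no  _ = trans (ℕ.+-suc _ _) (cong suc (length-filter-¬ P? xs))

module Minimum {A : Set} (P : A → Set) (P? : ∀ a → Dec (P a)) (_≼_ : A → A → Set)
  (≼-refl : ∀ {a} → a ≼ a) (≼-trans : ∀ {a b c} → a ≼ b → b ≼ c → a ≼ c)
  (≼-total : ∀ a b → P a → P b → a ≼ b ⊎ b ≼ a) where

  minimum-∷ : ∀ xs a → P a → ∃ λ b → P b × b ≼ a × (∀ {c} → c ∈ xs → P c → b ≼ c)
  minimum-∷ []       a pa = a , pa , ≼-refl , λ ()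
  minimum-∷ (x ∷ xs) a pa with P? x
  ... | no ¬px with minimum-∷ xs a pa
  ...   | b , pb , b≼a , min = b , pb , b≼a , λ { (here refl) pc → contradiction pc ¬px ; (there c∈) pc → min c∈ pc }
  minimum-∷ (x ∷ xs) a pa | yes px with ≼-total a x pa px
  ... | inj₁ a≼x with minimum-∷ xs a pa
  ...   | b , pb , b≼a , min = b , pb , b≼a , λ { (here refl) pc → ≼-trans b≼a a≼x ; (there c∈) pc → min c∈ pc }
  minimum-∷ (x ∷ xs) a pa | yes px | inj₂ x≼a with minimum-∷ xs x px
  ...   | b , pb , b≼x , min = b , pb , ≼-trans b≼x x≼a , λ { (here refl) pc → b≼x ; (there c∈) pc → min c∈ pc }

  minimum : ∀ xs → (∀ c → c ∈ xs) → ∃ P → ∃ λ b → P b × (∀ c → P c → b ≼ c)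
  minimum xs all (a , pa) with minimum-∷ xs a pa
  ... | b , pb , _ , min = b , pb , λ c pc → min (all c) pc

argmin : {A : Set} (xs : List A) → (∀ c → c ∈ xs) → {P : A → Set} → (∀ a → Dec (P a)) → (f : A → ℤ) →
  ∃ P → ∃ λ b → P b × (∀ c → P c → f b ≤ℤ f c)
argmin xs all {P} P? f ex = Minimum.minimum P P? (λ a b → f a ≤ℤ f b) ℤₚ.≤-refl ℤₚ.≤-trans
  (λ a b _ _ → ℤₚ.≤-total (f a) (f b)) xs all ex

argmax : {A : Set} (xs : List A) → (∀ c → c ∈ xs) → {P : A → Set} → (∀ a → Dec (P a)) → (f : A → ℤ) →
  ∃ P → ∃ λ b → P b × (∀ c → P c → f c ≤ℤ f b)
argmax xs all {P} P? f ex = Minimum.minimum P P? (λ a b → f b ≤ℤ f a) ℤₚ.≤-refl (λ p q → ℤₚ.≤-trans q p)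
  (λ a b _ _ → ℤₚ.≤-total (f b) (f a)) xs all ex

-- Darts and the permutations on them

code : ∀ {m} → Dart m → Fin (m + m)
code {m} (e , false) = e ↑ˡ m
code {m} (e , true)  = m ↑ʳ e

code-injective : ∀ {m} {d d' : Dart m} → code d ≡ code d' → d ≡ d'
code-injective {m} {e , false} {e' , false} eq = cong (_, false) (Fin.↑ˡ-injective m e e' eq)
code-injective {m} {e , true}  {e' , true}  eq = cong (_, true) (Fin.↑ʳ-injective m e e' eq)
code-injective {m} {e , false} {e' , true}  eq
  with trans (sym (Fin.splitAt-↑ˡ m e m)) (trans (cong (splitAt m) eq) (Fin.splitAt-↑ʳ m m e'))
... | ()
code-injective {m} {e , true}  {e' , false} eq
  with trans (sym (Fin.splitAt-↑ʳ m m e)) (trans (cong (splitAt m) eq) (Fin.splitAt-↑ˡ m e' m))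
... | ()

flipD-involutive : ∀ {m} (d : Dart m) → flipD (flipD d) ≡ d
flipD-involutive (e , true)  = refl
flipD-involutive (e , false) = refl

_≟D_ : ∀ {m} (d d' : Dart m) → Dec (d ≡ d')
d ≟D d' = map′ code-injective (cong code) (code d Fin.≟ code d')

darts : ∀ m → List (Dart m)
darts m = map (_, false) (allFin m) ++ map (_, true) (allFin m)

∈-darts : ∀ {m} (d : Dart m) → d ∈ darts m
∈-darts (e , false) = ∈-++⁺ˡ (∈-map⁺ (_, false) (∈-allFin e))
∈-darts (e , true)  = ∈-++⁺ʳ (map (_, false) (allFin _)) (∈-map⁺ (_, true) (∈-allFin e))

anyDart? : ∀ {m} {P : Dart m → Set} → (∀ d → Dec (P d)) → Dec (∃ P)
anyDart? {P = P} P? with any? (λ e → P? (e , false)) | any? (λ e → P? (e , true))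
... | yes (e , p) | _           = yes ((e , false) , p)
... | no _        | yes (e , p) = yes ((e , true) , p)
... | no ¬f       | no ¬t       = no λ { ((e , false) , p) → ¬f (e , p) ; ((e , true) , p) → ¬t (e , p) }

module Orbits (G : EmbeddedDigraph) where
  open EmbeddedDigraph G

  rot-injective : ∀ {d d'} → rot d ≡ rot d' → d ≡ d'
  rot-injective {d} {d'} eq = trans (sym (rot-inv₂ d)) (trans (cong rot⁻¹ eq) (rot-inv₂ d'))

  faceNext-injective : ∀ {d d'} → faceNext d ≡ faceNext d' → d ≡ d'
  faceNext-injective {d} {d'} eq =
    trans (sym (flipD-involutive d)) (trans (cong flipD (rot-injective eq)) (flipD-involutive d'))

  module Rot  = FinitePermutation code code-injective rot rot-injective
  module Face = FinitePermutation code code-injective faceNext faceNext-injective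

  rot-orbit-at : ∀ k d → dartVertex (iter rot k d) ≡ dartVertex d
  rot-orbit-at zero    d = refl
  rot-orbit-at (suc k) d = trans (rot-at (iter rot k d)) (rot-orbit-at k d)

-- Heights in a drawing become natural ranks, so that induction along upward edges is available; the
-- least value is subtracted.
normalise : ∀ {n} (f : Fin n → ℤ) → Σ (Fin n → ℕ) λ g → ∀ {a b} → f a <ℤ f b → g a < g b
normalise {zero}  f = (λ ()) , λ { {()} }
normalise {suc n} f with argmin (allFin (suc n)) ∈-allFin {λ _ → ⊤} (λ _ → yes _) f (zero , _)

... | lo , _ , min = g , mono
  where
  g : Fin (suc n) → ℕ
  g a = ℤ.∣ f a ℤ.- f lo ∣
  g-eq : ∀ a → + g a ≡ f a ℤ.- f lo
  g-eq a = ℤₚ.0≤i⇒+∣i∣≡i (ℤₚ.i≤j⇒0≤j-i (min a _))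
  mono : ∀ {a b} → f a <ℤ f b → g a < g b
  mono {a} {b} lt = ℤₚ.drop‿+<+ (ℤₚ.≤-<-trans (ℤₚ.≤-reflexive (g-eq a))
    (ℤₚ.<-≤-trans (ℤₚ.+-monoˡ-< (ℤ.- f lo) lt) (ℤₚ.≤-reflexive (sym (g-eq b)))))

-- Cyclic orders

module Cyclic {A V : Set} (cls : A → V) (_≺_ : A → A → Set)
  (≺-trans : ∀ {a b c} → a ≺ b → b ≺ c → a ≺ c)
  (≺-irrefl : ∀ {a} → ¬ (a ≺ a))
  (≺-compare : ∀ a b → cls a ≡ cls b → a ≺ b ⊎ a ≡ b ⊎ b ≺ a) where

  _≼_ : A → A → Set
  a ≼ b = a ≺ b ⊎ a ≡ b

  ≺-≼-trans : ∀ {a b c} → a ≺ b → b ≼ c → a ≺ c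
  ≺-≼-trans p (inj₁ q)    = ≺-trans p q
  ≺-≼-trans p (inj₂ refl) = p

  ≼-≺-trans : ∀ {a b c} → a ≼ b → b ≺ c → a ≺ c
  ≼-≺-trans (inj₁ p)    q = ≺-trans p q
  ≼-≺-trans (inj₂ refl) q = q

  ≼-trans : ∀ {a b c} → a ≼ b → b ≼ c → a ≼ c
  ≼-trans p (inj₁ q)    = inj₁ (≼-≺-trans p q)
  ≼-trans p (inj₂ refl) = p

  ≺⇒⋡ : ∀ {a b} → a ≺ b → ¬ (b ≼ a)
  ≺⇒⋡ p q = ≺-irrefl (≺-≼-trans p q)

  ≺-or-≽ : ∀ a b → cls a ≡ cls b → a ≺ b ⊎ b ≼ a
  ≺-or-≽ a b eq with ≺-compare a b eq
  ... | inj₁ a≺b         = inj₁ a≺b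
  ... | inj₂ (inj₁ refl) = inj₂ (inj₂ refl)
  ... | inj₂ (inj₂ b≺a)  = inj₂ (inj₁ b≺a)

  -- The open arc from `a` to `b`. The second disjunct is the arc that runs over the end of the
  -- linear order; for `a ≡ b` it is the whole class without `a`.
  Between : A → A → A → Set
  Between a x b = (a ≺ x × x ≺ b) ⊎ (b ≼ a × (a ≺ x ⊎ x ≺ b))

  Next : A → A → Set
  Next a b = cls b ≡ cls a ×
    ((a ≺ b × (∀ x → cls x ≡ cls a → ¬ (a ≺ x × x ≺ b)))
    ⊎ ((∀ x → cls x ≡ cls a → b ≼ x) × (∀ x → cls x ≡ cls a → x ≼ a)))

  Next⇒¬Between : ∀ {a b} → Next a b → ∀ x → cls x ≡ cls a → ¬ Between a x b
  Next⇒¬Between (_ , inj₁ (_ , none)) x xa (inj₁ p) = none x xa p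
  Next⇒¬Between (_ , inj₁ (a≺b , _)) x xa (inj₂ (b≼a , _)) = ≺⇒⋡ a≺b b≼a
  Next⇒¬Between (_ , inj₂ (_ , max)) x xa (inj₁ (a≺x , _)) = ≺⇒⋡ a≺x (max x xa)
  Next⇒¬Between (_ , inj₂ (_ , max)) x xa (inj₂ (_ , inj₁ a≺x)) = ≺⇒⋡ a≺x (max x xa)
  Next⇒¬Between (_ , inj₂ (min , _)) x xa (inj₂ (_ , inj₂ x≺b)) = ≺⇒⋡ x≺b (min x xa)

  ¬Between⇒Next : ∀ {a b} → cls b ≡ cls a → (∀ x → cls x ≡ cls a → ¬ Between a x b) → Next a b
  ¬Between⇒Next {a} {b} ba none with ≺-or-≽ a b (sym ba)
  ... | inj₁ a≺b = ba , inj₁ (a≺b , λ x xa p → none x xa (inj₁ p))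
  ... | inj₂ b≼a = ba , inj₂ (min , max)
    where
    min : ∀ x → cls x ≡ cls a → b ≼ x
    min x xa with ≺-or-≽ x b (trans xa (sym ba))
    ... | inj₁ x≺b = contradiction (inj₂ (b≼a , inj₂ x≺b)) (none x xa)
    ... | inj₂ b≼x = b≼x
    max : ∀ x → cls x ≡ cls a → x ≼ a
    max x xa with ≺-or-≽ a x (sym xa)
    ... | inj₁ a≺x = contradiction (inj₂ (b≼a , inj₁ a≺x)) (none x xa)
    ... | inj₂ x≼a = x≼a

  -- The point `b` need not lie on the arc: if it lies outside, the arc from `a` to `b` already
  -- contains the one from `a` to `c`. An arc can thus be cut at an iterate of unknown position.
  Between-split : ∀ {a x c} b → cls x ≡ cls b → cls a ≡ cls b → cls c ≡ cls b →
    Between a x c → Between a x b ⊎ x ≡ b ⊎ Between b x c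
  Between-split {a} {x} {c} b xb ab cb bet with ≺-compare x b xb
  ... | inj₂ (inj₁ x≡b) = inj₂ (inj₁ x≡b)
  Between-split b xb ab cb (inj₁ (a≺x , _)) | inj₁ x≺b = inj₁ (inj₁ (a≺x , x≺b))
  Between-split b xb ab cb (inj₂ (_ , inj₁ a≺x)) | inj₁ x≺b = inj₁ (inj₁ (a≺x , x≺b))
  Between-split {a} b xb ab cb (inj₂ (c≼a , inj₂ x≺c)) | inj₁ x≺b with ≺-or-≽ a b ab
  ... | inj₁ a≺b = inj₂ (inj₂ (inj₂ (inj₁ (≼-≺-trans c≼a a≺b) , inj₂ x≺c)))
  ... | inj₂ b≼a = inj₁ (inj₂ (b≼a , inj₂ x≺b))
  Between-split b xb ab cb (inj₁ (_ , x≺c)) | inj₂ (inj₂ b≺x) = inj₂ (inj₂ (inj₁ (b≺x , x≺c)))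
  Between-split b xb ab cb (inj₂ (_ , inj₂ x≺c)) | inj₂ (inj₂ b≺x) = inj₂ (inj₂ (inj₁ (b≺x , x≺c)))
  Between-split {c = c} b xb ab cb (inj₂ (c≼a , inj₁ a≺x)) | inj₂ (inj₂ b≺x) with ≺-or-≽ b c (sym cb)
  ... | inj₁ b≺c = inj₁ (inj₂ (inj₁ (≺-≼-trans b≺c c≼a) , inj₁ a≺x))
  ... | inj₂ c≼b = inj₂ (inj₂ (inj₂ (c≼b , inj₁ b≺x)))

  Between-self : ∀ {a x} → cls a ≡ cls x → a ≢ x → Between a x a
  Between-self {a} {x} ax a≢x with ≺-compare a x ax
  ... | inj₁ a≺x        = inj₂ (inj₂ refl , inj₁ a≺x)
  ... | inj₂ (inj₁ a≡x) = contradiction a≡x a≢x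
  ... | inj₂ (inj₂ x≺a) = inj₂ (inj₂ refl , inj₂ x≺a)

  Between-apart : ∀ {a b c} → cls a ≡ cls b → cls c ≡ cls b → b ≢ c → Between a b c ⊎ Between a c b
  Between-apart {a} {b} {c} ab cb b≢c with ≺-compare b c (sym cb)
  ... | inj₂ (inj₁ b≡c) = contradiction b≡c b≢c
  ... | inj₁ b≺c with ≺-or-≽ a b ab
  ...   | inj₁ a≺b = inj₁ (inj₁ (a≺b , b≺c))
  ...   | inj₂ b≼a with ≺-or-≽ a c (trans ab (sym cb))
  ...     | inj₁ a≺c = inj₂ (inj₂ (b≼a , inj₁ a≺c))
  ...     | inj₂ c≼a = inj₁ (inj₂ (c≼a , inj₂ b≺c))
  Between-apart {a} {b} {c} ab cb b≢c | inj₂ (inj₂ c≺b) with ≺-or-≽ a c (trans ab (sym cb))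
  ...   | inj₁ a≺c = inj₂ (inj₁ (a≺c , c≺b))
  ...   | inj₂ c≼a with ≺-or-≽ a b ab
  ...     | inj₁ a≺b = inj₁ (inj₂ (c≼a , inj₁ a≺b))
  ...     | inj₂ b≼a = inj₂ (inj₂ (b≼a , inj₂ c≺b))

  Between-rotate : ∀ {a b c} → cls a ≡ cls b → cls c ≡ cls b → a ≢ b → Between a b c ⊎ Between b a c
  Between-rotate {a} {b} {c} ab cb a≢b with ≺-compare a b ab
  ... | inj₂ (inj₁ a≡b) = contradiction a≡b a≢b
  ... | inj₁ a≺b with ≺-or-≽ b c (sym cb)
  ...   | inj₁ b≺c = inj₁ (inj₁ (a≺b , b≺c))
  ...   | inj₂ c≼b with ≺-or-≽ a c (trans ab (sym cb))
  ...     | inj₁ a≺c = inj₂ (inj₂ (c≼b , inj₂ a≺c))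
  ...     | inj₂ c≼a = inj₁ (inj₂ (c≼a , inj₁ a≺b))
  Between-rotate {a} {b} {c} ab cb a≢b | inj₂ (inj₂ b≺a) with ≺-or-≽ a c (trans ab (sym cb))
  ...   | inj₁ a≺c = inj₂ (inj₁ (b≺a , a≺c))
  ...   | inj₂ c≼a with ≺-or-≽ b c (sym cb)
  ...     | inj₁ b≺c = inj₁ (inj₂ (c≼a , inj₂ b≺c))
  ...     | inj₂ c≼b = inj₂ (inj₂ (c≼b , inj₁ b≺a))

  module _ (≟A : ∀ (a b : A) → Dec (a ≡ b)) where

    Next-unique : ∀ {a b c} → Next a b → Next a c → b ≡ c
    Next-unique {a} {b} {c} ab ac with ≟A b c
    ... | yes b≡c = b≡c
    ... | no b≢c with Between-apart {a} {b} {c} (sym (proj₁ ab)) (trans (proj₁ ac) (sym (proj₁ ab))) b≢c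
    ...   | inj₁ bet = contradiction bet (Next⇒¬Between ac b (proj₁ ab))
    ...   | inj₂ bet = contradiction bet (Next⇒¬Between ab c (proj₁ ac))

    Next-injective : ∀ {a b c} → Next a c → Next b c → a ≡ b
    Next-injective {a} {b} {c} ac bc with ≟A a b
    ... | yes a≡b = a≡b
    ... | no a≢b with Between-rotate {a} {b} {c} (trans (sym (proj₁ ac)) (proj₁ bc)) (proj₁ bc) a≢b
    ...   | inj₁ bet = contradiction bet (Next⇒¬Between ac b (trans (sym (proj₁ bc)) (proj₁ ac)))
    ...   | inj₂ bet = contradiction bet (Next⇒¬Between bc a (trans (sym (proj₁ ac)) (proj₁ bc)))

  module _ (f : A → A) (f-next : ∀ a → Next a (f a)) where

    iter-cls : ∀ k a → cls (iter f k a) ≡ cls a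
    iter-cls zero    a = refl
    iter-cls (suc k) a = trans (proj₁ (f-next (iter f k a))) (iter-cls k a)

    -- The gap after each iterate is empty, so cutting the arc at the iterates leaves room for
    -- nothing else. The bound is strict: `x` is met before the end of the arc.
    Between-iter : ∀ k {a x} → cls x ≡ cls a → Between a x (iter f (suc k) a) →
      Σ ℕ λ j → j < k × iter f (suc j) a ≡ x
    Between-iter zero    {a} {x} xa bet = contradiction bet (Next⇒¬Between (f-next a) x xa)
    Between-iter (suc k) {a} {x} xa bet with Between-split (iter f (suc k) a)
      (trans xa (sym (iter-cls (suc k) a))) (sym (iter-cls (suc k) a)) (proj₁ (f-next (iter f (suc k) a))) bet
    ... | inj₁ bet' with Between-iter k xa bet'
    ...   | j , j<k , eq = j , ℕ.m<n⇒m<1+n j<k , eq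
    Between-iter (suc k) xa bet | inj₂ (inj₁ x≡) = k , n<1+n k , sym x≡
    Between-iter (suc k) {a} {x} xa bet | inj₂ (inj₂ bet') =
      contradiction bet' (Next⇒¬Between (f-next _) x (trans xa (sym (iter-cls (suc k) a))))

  module _ (≟A : ∀ (a b : A) → Dec (a ≡ b)) (f : A → A) (f-cls : ∀ a → cls (f a) ≡ cls a)
    (top : A) (f-cyc : ∀ x → cls x ≡ cls top → InOrbit f (f top) x)
    (ascend : ∀ a → cls a ≡ cls top → a ≢ top → a ≺ f a) where

    private
      from : ℕ → A
      from k = iter f k (f top)

      from-cls : ∀ k → cls (from k) ≡ cls top
      from-cls zero    = f-cls top
      from-cls (suc k) = trans (f-cls (from k)) (from-cls k)

      avoiding : ∀ k → Σ ℕ λ j → from j ≡ from k × (∀ i → i < j → from i ≢ top)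
      avoiding zero = 0 , refl , λ _ ()
      avoiding (suc k) with avoiding k
      ... | j , eq , av with ≟A (from j) top
      -- After `top` the orbit is back at `f top`, which is `from 0`.
      ...   | yes j≡top = 0 , cong f (trans (sym j≡top) eq) , λ _ ()
      ...   | no  j≢top = suc j , cong f eq , λ i i<sj → av' i (m≤n⇒m<n∨m≡n (s≤s⁻¹ i<sj))
        where
        av' : ∀ i → i < j ⊎ i ≡ j → from i ≢ top
        av' i (inj₁ i<j)  = av i i<j
        av' i (inj₂ refl) = j≢top

      rising : ∀ {i j} → i ≤ j → (∀ l → l < j → from l ≢ top) → from i ≼ from j
      rising {i} {zero}  z≤n av = inj₂ refl
      rising {i} {suc j} i≤sj av with m≤n⇒m<n∨m≡n i≤sj
      ... | inj₂ refl = inj₂ refl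
      ... | inj₁ i<sj = inj₁ (≼-≺-trans (rising (s≤s⁻¹ i<sj) (λ l l<j → av l (ℕ.m<n⇒m<1+n l<j)))
                                       (ascend (from j) (from-cls j) (av j (n<1+n j))))

    -- From `f top` to the first visit of `top` the iterates rise, and they exhaust the class; the
    -- step from `top` closes the circle. So a rotation is checked by comparing each dart only with
    -- its image.
    oneDescent⇒Next : ∀ a → cls a ≡ cls top → Next a (f a)
    oneDescent⇒Next a at = ¬Between⇒Next (f-cls a) none
      where
      position : ∀ x → cls x ≡ cls top → Σ ℕ λ j → from j ≡ x × (∀ i → i < j → from i ≢ top)
      position x xt with f-cyc x xt
      ... | k , eq with avoiding k
      ... | j , eq' , av = j , trans eq' eq , av
      none : ∀ x → cls x ≡ cls a → ¬ Between a x (f a)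
      none x xa with position a at | position x (trans xa at)
      ... | p , refl , avp | q , refl , avq with ≟A (from p) top
      ...   | yes p≡top = λ
        { (inj₁ (a≺x , _))        → ≺⇒⋡ a≺x x≼a
        ; (inj₂ (_ , inj₁ a≺x))   → ≺⇒⋡ a≺x x≼a
        ; (inj₂ (_ , inj₂ x≺fa))  → ≺⇒⋡ x≺fa (subst (λ z → f z ≼ from q) (sym p≡top) (rising z≤n avq)) }
        where
        x≼a : from q ≼ from p
        x≼a with ℕ.<-≤-connex p q
        ... | inj₁ p<q = contradiction p≡top (avq p p<q)
        ... | inj₂ q≤p = rising q≤p avp
      ...   | no p≢top with ℕ.<-≤-connex p q
      ...     | inj₁ p<q = λ
        { (inj₁ (_ , x≺fa))       → ≺⇒⋡ x≺fa (rising p<q avq)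
        ; (inj₂ (fa≼a , _))       → ≺⇒⋡ (ascend (from p) at p≢top) fa≼a }
      ...     | inj₂ q≤p = λ
        { (inj₁ (a≺x , _))        → ≺⇒⋡ a≺x (rising q≤p avp)
        ; (inj₂ (fa≼a , _))       → ≺⇒⋡ (ascend (from p) at p≢top) fa≼a }

  module FiniteSuccessor (xs : List A) (complete : ∀ a → a ∈ xs)
    (≟V : ∀ (v w : V) → Dec (v ≡ w)) (≟A : ∀ (a b : A) → Dec (a ≡ b)) where

    above? : ∀ a b → Dec (cls b ≡ cls a × a ≺ b)
    above? a b with ≟V (cls b) (cls a)
    ... | no b≁a = no (λ p → b≁a (proj₁ p))
    ... | yes ba with ≺-or-≽ a b (sym ba)
    ...   | inj₁ a≺b = yes (ba , a≺b)
    ...   | inj₂ b≼a = no (λ p → ≺⇒⋡ (proj₂ p) b≼a)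

    private
      module Least (a : A) (P : A → Set) (P? : ∀ b → Dec (P b)) (P⇒cls : ∀ {b} → P b → cls b ≡ cls a) =
        Minimum P P? _≼_ (inj₂ refl) ≼-trans
          (λ b c pb pc → ⊎-map inj₁ id (≺-or-≽ b c (trans (P⇒cls pb) (sym (P⇒cls pc)))))

    successor : ∀ a → Σ A (Next a)
    successor a with Any.any? (above? a) xs
    ... | yes ex with Least.minimum a (λ b → cls b ≡ cls a × a ≺ b) (above? a) proj₁ xs complete (Any.satisfied ex)
    ...   | b , (ba , a≺b) , min = b , ba , inj₁ (a≺b , λ x xa p → ≺⇒⋡ (proj₂ p) (min x (xa , proj₁ p)))
    successor a | no none
      with Least.minimum a (λ b → cls b ≡ cls a) (λ b → ≟V (cls b) (cls a)) id xs complete (a , refl)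
    ... | b , ba , min = b , ba , inj₂ (min , max)
      where
      max : ∀ x → cls x ≡ cls a → x ≼ a
      max x xa with ≺-or-≽ a x (sym xa)
      ... | inj₁ a≺x = contradiction (Any.map (λ { refl → xa , a≺x }) (complete x)) none
      ... | inj₂ x≼a = x≼a

    next : A → A
    next a = proj₁ (successor a)

    next-Next : ∀ a → Next a (next a)
    next-Next a = proj₂ (successor a)

    next-injective : ∀ {a b} → next a ≡ next b → a ≡ b
    next-injective {a} {b} eq = Next-injective ≟A (next-Next a) (subst (Next b) (sym eq) (next-Next b))

-- The rotation at a vertex of an L-drawing

record Layout {n m : ℕ} (tl hd : Fin m → Fin n) : Set where
  field
    x y    : Fin n → ℤ
    x-inj  : Injective _≡_ _≡_ x
    y-inj  : Injective _≡_ _≡_ y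
    upward : ∀ e → y (tl e) <ℤ y (hd e)
    simple : ∀ e e' → tl e ≡ tl e' → hd e ≡ hd e' → e ≡ e'

-- The order on darts is set up for bare endpoint maps, without a rotation, because the rotation of
-- the completed graph is itself defined from this order.
module Keys {n m : ℕ} (tl hd : Fin m → Fin n) (L : Layout tl hd) where
  open Layout L

  at : Dart m → Fin n
  at = dartEnd tl hd

  group : Dart m → ℕ
  group (e , true)  = if does (x (hd e) ℤₚ.<? x (tl e)) then 0 else 3
  group (e , false) = if does (x (tl e) ℤₚ.<? x (hd e)) then 1 else 2

  second : Dart m → ℤ
  second (e , true)  = x (tl e)
  second (e , false) = if does (x (tl e) ℤₚ.<? x (hd e)) then y (hd e) else ℤ.- y (hd e)

  data _≺_ (d d' : Dart m) : Set where
    lower : group d < group d' → d ≺ d'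
    level : group d ≡ group d' → second d <ℤ second d' → d ≺ d'

  tl≢hd : ∀ e → tl e ≢ hd e
  tl≢hd e eq = ℤₚ.<-irrefl (cong y eq) (upward e)

  x-apart : ∀ {u v} → u ≢ v → x u <ℤ x v ⊎ x v <ℤ x u
  x-apart {u} {v} u≢v with ℤₚ.<-cmp (x u) (x v)
  ... | tri< lt _ _ = inj₁ lt
  ... | tri≈ _ eq _ = contradiction (x-inj eq) u≢v
  ... | tri> _ _ gt = inj₂ gt

  bend : ∀ e → x (tl e) <ℤ x (hd e) ⊎ x (hd e) <ℤ x (tl e)
  bend e = x-apart (tl≢hd e)

  in-from-right : ∀ {e} → x (hd e) <ℤ x (tl e) → group (e , true) ≡ 0
  in-from-right {e} lt with x (hd e) ℤₚ.<? x (tl e)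
  ... | yes _ = refl
  ... | no ¬p = contradiction lt ¬p

  in-from-left : ∀ {e} → x (tl e) <ℤ x (hd e) → group (e , true) ≡ 3
  in-from-left {e} lt with x (hd e) ℤₚ.<? x (tl e)
  ... | yes p = contradiction p (ℤₚ.<-asym lt)
  ... | no _  = refl

  out-to-right : ∀ {e} → x (tl e) <ℤ x (hd e) → group (e , false) ≡ 1 × second (e , false) ≡ y (hd e)
  out-to-right {e} lt with x (tl e) ℤₚ.<? x (hd e)
  ... | yes _ = refl , refl
  ... | no ¬p = contradiction lt ¬p

  out-to-left : ∀ {e} → x (hd e) <ℤ x (tl e) → group (e , false) ≡ 2 × second (e , false) ≡ ℤ.- y (hd e)
  out-to-left {e} lt with x (tl e) ℤₚ.<? x (hd e)
  ... | yes p = contradiction p (ℤₚ.<-asym lt)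
  ... | no _  = refl , refl

  ≺-trans : ∀ {a b c} → a ≺ b → b ≺ c → a ≺ c
  ≺-trans         (lower p)    (lower q)     = lower (<-trans p q)
  ≺-trans {a = a} (lower p)    (level eq _)  = lower (subst (group a <_) eq p)
  ≺-trans {c = c} (level eq _) (lower q)     = lower (subst (_< group c) (sym eq) q)
  ≺-trans         (level eq p) (level eq' q) = level (trans eq eq') (ℤₚ.<-trans p q)

  ≺-irrefl : ∀ {a} → ¬ (a ≺ a)
  ≺-irrefl (lower p)   = <-irrefl refl p
  ≺-irrefl (level _ p) = ℤₚ.<-irrefl refl p

  private
    out-lemma : ∀ e e' → tl e ≡ tl e' → group (e , false) ≡ group (e' , false) →
      second (e , false) ≡ second (e' , false) → (e , false) ≡ (e' , false)
    out-lemma e e' t g s with bend e | bend e'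
    ... | inj₁ r | inj₁ r' = cong (_, false) (simple e e' t
      (y-inj (trans (sym (proj₂ (out-to-right r))) (trans s (proj₂ (out-to-right r'))))))
    ... | inj₁ r | inj₂ l' with trans (sym (proj₁ (out-to-right r))) (trans g (proj₁ (out-to-left l')))
    ...   | ()
    out-lemma e e' t g s | inj₂ l | inj₁ r' with trans (sym (proj₁ (out-to-left l))) (trans g (proj₁ (out-to-right r')))
    ... | ()
    out-lemma e e' t g s | inj₂ l | inj₂ l' = cong (_, false) (simple e e' t
      (y-inj (ℤₚ.neg-injective (trans (sym (proj₂ (out-to-left l))) (trans s (proj₂ (out-to-left l')))))))

    mixed : ∀ e e' → group (e , true) ≢ group (e' , false)
    mixed e e' g with bend e | bend e'
    ... | inj₁ l | inj₁ r' with trans (sym (in-from-left l)) (trans g (proj₁ (out-to-right r')))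
    ...   | ()
    mixed e e' g | inj₁ l | inj₂ l' with trans (sym (in-from-left l)) (trans g (proj₁ (out-to-left l')))
    ...   | ()
    mixed e e' g | inj₂ r | inj₁ r' with trans (sym (in-from-right r)) (trans g (proj₁ (out-to-right r')))
    ...   | ()
    mixed e e' g | inj₂ r | inj₂ l' with trans (sym (in-from-right r)) (trans g (proj₁ (out-to-left l')))
    ...   | ()

  -- Since coordinates are distinct, equal second components give equal far ends, and simplicity
  -- gives equal edges; incoming and outgoing darts never share a group.
  key-injective : ∀ d d' → at d ≡ at d' → group d ≡ group d' → second d ≡ second d' → d ≡ d'
  key-injective (e , true)  (e' , true)  a g s = cong (_, true) (simple e e' (x-inj s) a)
  key-injective (e , true)  (e' , false) a g s = contradiction g (mixed e e')
  key-injective (e , false) (e' , true)  a g s = contradiction (sym g) (mixed e' e)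
  key-injective (e , false) (e' , false) a g s = out-lemma e e' a g s

  ≺-compare : ∀ d d' → at d ≡ at d' → d ≺ d' ⊎ d ≡ d' ⊎ d' ≺ d
  ≺-compare d d' a with <-cmp (group d) (group d')
  ... | tri< lt _ _ = inj₁ (lower lt)
  ... | tri> _ _ gt = inj₂ (inj₂ (lower gt))
  ... | tri≈ _ g _ with ℤₚ.<-cmp (second d) (second d')
  ...   | tri< lt _ _ = inj₁ (level g lt)
  ...   | tri≈ _ s _  = inj₂ (inj₁ (key-injective d d' a g s))
  ...   | tri> _ _ gt = inj₂ (inj₂ (level (sym g) gt))

  open Cyclic at _≺_ ≺-trans ≺-irrefl ≺-compare public

  group-in : ∀ e → group (e , true) ≡ 0 ⊎ group (e , true) ≡ 3
  group-in e with bend e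
  ... | inj₁ l = inj₂ (in-from-left l)
  ... | inj₂ r = inj₁ (in-from-right r)

  group-out : ∀ e → group (e , false) ≡ 1 ⊎ group (e , false) ≡ 2
  group-out e with bend e
  ... | inj₁ r = inj₁ (proj₁ (out-to-right r))
  ... | inj₂ l = inj₂ (proj₁ (out-to-left l))

  by-group : ∀ {d d' g g'} → group d ≡ g → group d' ≡ g' → g < g' → d ≺ d'
  by-group refl refl lt = lower lt

  by-second : ∀ {d d' g s s'} → group d ≡ g → group d' ≡ g → second d ≡ s → second d' ≡ s' → s <ℤ s' → d ≺ d'
  by-second refl eq refl refl lt = level (sym eq) lt

  in-below-out : ∀ {e e'} → x (hd e) <ℤ x (tl e) → (e , true) ≺ (e' , false)
  in-below-out {e} {e'} r with group-out e'
  ... | inj₁ g = by-group {e , true} (in-from-right r) g (s≤s z≤n)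
  ... | inj₂ g = by-group {e , true} (in-from-right r) g (s≤s z≤n)

  out-below-in : ∀ {e e'} → x (tl e) <ℤ x (hd e) → (e' , false) ≺ (e , true)
  out-below-in {e} {e'} l with group-out e'
  ... | inj₁ g = by-group {e' , false} g (in-from-left l) (s≤s (s≤s z≤n))
  ... | inj₂ g = by-group {e' , false} g (in-from-left l) (s≤s (s≤s (s≤s z≤n)))

  -- Shaped like `Between`, with the upward direction, which separates the groups 0 and 1 from 2 and
  -- 3, in the place of the middle point.
  North : Dart m → Dart m → Set
  North d d' = (group d ≤ 1 × 2 ≤ group d') ⊎ (d' ≼ d × (group d ≤ 1 ⊎ 2 ≤ group d'))

  North-split : ∀ {a c} b → at a ≡ at b → at c ≡ at b → North a c → North a b ⊎ North b c
  North-split {a} {c} b ab cb nc with ℕ.≤-<-connex (group b) 1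
  North-split b ab cb (inj₁ (a≤1 , 2≤c)) | inj₁ b≤1 = inj₂ (inj₁ (b≤1 , 2≤c))
  North-split b ab cb (inj₁ (a≤1 , 2≤c)) | inj₂ 2≤b = inj₁ (inj₁ (a≤1 , 2≤b))
  North-split {c = c} b ab cb (inj₂ (c≼a , inj₁ a≤1)) | inj₁ b≤1 with ≺-or-≽ b c (sym cb)
  ... | inj₂ c≼b = inj₂ (inj₂ (c≼b , inj₁ b≤1))
  ... | inj₁ b≺c = inj₁ (inj₂ (inj₁ (≺-≼-trans b≺c c≼a) , inj₁ a≤1))
  North-split b ab cb (inj₂ (c≼a , inj₁ a≤1)) | inj₂ 2≤b = inj₁ (inj₁ (a≤1 , 2≤b))
  North-split b ab cb (inj₂ (c≼a , inj₂ 2≤c)) | inj₁ b≤1 = inj₂ (inj₁ (b≤1 , 2≤c))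
  North-split {c = c} b ab cb (inj₂ (c≼a , inj₂ 2≤c)) | inj₂ 2≤b with ≺-or-≽ b c (sym cb)
  ... | inj₂ c≼b = inj₂ (inj₂ (c≼b , inj₂ 2≤c))
  ... | inj₁ b≺c = inj₁ (inj₂ (inj₁ (≺-≼-trans b≺c c≼a) , inj₂ 2≤b))

  North-self : ∀ d → North d d
  North-self d with ℕ.≤-<-connex (group d) 1
  ... | inj₁ le = inj₂ (inj₂ refl , inj₁ le)
  ... | inj₂ ge = inj₂ (inj₂ refl , inj₂ ge)

  module _ (f : Dart m → Dart m) (f-next : ∀ d → Next d (f d)) where

    -- Cutting a sector at its darts leaves the upward direction in one of the angles. The sector
    -- may be a full turn, by `North-self`.
    North-iter : ∀ k {a} → North a (iter f (suc k) a) →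
      Σ ℕ λ j → j ≤ k × North (iter f j a) (iter f (suc j) a)
    North-iter zero    nc = 0 , z≤n , nc
    North-iter (suc k) {a} nc with North-split (iter f (suc k) a) (sym (iter-cls f f-next (suc k) a))
                                               (proj₁ (f-next (iter f (suc k) a))) nc
    ... | inj₂ nc' = suc k , ≤-refl , nc'
    ... | inj₁ nc' with North-iter k nc'
    ...   | j , j≤k , nj = j , ℕ.m≤n⇒m≤1+n j≤k , nj

  -- Outgoing darts have group 1 or 2, between the incoming groups 0 and 3, so a northern sector
  -- bounded by incoming darts contains all of them.
  North-Between-out : ∀ {d d' e} → North (d , true) (d' , true) → Between (d , true) (e , false) (d' , true)
  North-Between-out {d} {d'} {e} nc with bend d | bend d'
  North-Between-out (inj₁ (d≤1 , 2≤d')) | inj₁ l | _ = contradiction (subst (_≤ 1) (in-from-left l) d≤1) λ { (s≤s ()) }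
  North-Between-out (inj₁ (d≤1 , 2≤d')) | inj₂ r | inj₂ r' = contradiction (subst (2 ≤_) (in-from-right r') 2≤d') λ ()
  North-Between-out {d} {d'} {e} (inj₁ (d≤1 , 2≤d')) | inj₂ r | inj₁ l' = inj₁ (in-below-out {d} {e} r , out-below-in {d'} {e} l')
  North-Between-out (inj₂ (d'≼d , inj₁ d≤1)) | inj₁ l | _ = contradiction (subst (_≤ 1) (in-from-left l) d≤1) λ { (s≤s ()) }
  North-Between-out {d} {d'} {e} (inj₂ (d'≼d , inj₁ d≤1)) | inj₂ r | _ = inj₂ (d'≼d , inj₁ (in-below-out {d} {e} r))
  North-Between-out {d} {d'} {e} (inj₂ (d'≼d , inj₂ 2≤d')) | _ | inj₂ r' = contradiction (subst (2 ≤_) (in-from-right r') 2≤d') λ ()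
  North-Between-out {d} {d'} {e} (inj₂ (d'≼d , inj₂ 2≤d')) | _ | inj₁ l' = inj₂ (d'≼d , inj₂ (out-below-in {d'} {e} l'))

module GraphKeys (G : EmbeddedDigraph) (L : Layout (EmbeddedDigraph.tl G) (EmbeddedDigraph.hd G)) where
  open EmbeddedDigraph G
  open Layout L
  open Keys tl hd L public
  private module D = Drawing G x y

  group≡ : ∀ d → D.group d ≡ group d
  group≡ (e , true)  = refl
  group≡ (e , false) = refl

  second≡ : ∀ d → D.second d ≡ second d
  second≡ (e , true)  = refl
  second≡ (e , false) = refl

  KeyLt⇒≺ : ∀ {d d'} → D.KeyLt d d' → d ≺ d'
  KeyLt⇒≺ {d} {d'} (inj₁ lt) = lower (subst₂ _<_ (group≡ d) (group≡ d') lt)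
  KeyLt⇒≺ {d} {d'} (inj₂ (eq , lt)) =
    level (trans (sym (group≡ d)) (trans eq (group≡ d'))) (subst₂ _<ℤ_ (second≡ d) (second≡ d') lt)

  ≺⇒KeyLt : ∀ {d d'} → d ≺ d' → D.KeyLt d d'
  ≺⇒KeyLt {d} {d'} (lower lt) = inj₁ (subst₂ _<_ (sym (group≡ d)) (sym (group≡ d')) lt)
  ≺⇒KeyLt {d} {d'} (level eq lt) =
    inj₂ (trans (group≡ d) (trans eq (sym (group≡ d'))) , subst₂ _<ℤ_ (sym (second≡ d)) (sym (second≡ d')) lt)

  KeyLe⇒≼ : ∀ {d d'} → D.KeyLe d d' → d ≼ d'
  KeyLe⇒≼ {d} {d'} = ⊎-map (KeyLt⇒≺ {d} {d'}) id

  ≼⇒KeyLe : ∀ {d d'} → d ≼ d' → D.KeyLe d d'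
  ≼⇒KeyLe {d} {d'} = ⊎-map (≺⇒KeyLt {d} {d'}) id

  CcwNext⇒Next : ∀ {d d'} → D.CcwNext d d' → Next d d'
  CcwNext⇒Next {d} {d'} (a , inj₁ (lt , none)) = a , inj₁ (KeyLt⇒≺ {d} {d'} lt ,
    λ z za p → none z za (≺⇒KeyLt {d} {z} (proj₁ p) , ≺⇒KeyLt {z} {d'} (proj₂ p)))
  CcwNext⇒Next {d} {d'} (a , inj₂ (min , max)) = a , inj₂ ((λ z za → KeyLe⇒≼ {d'} {z} (min z za)) , (λ z za → KeyLe⇒≼ {z} {d} (max z za)))

  Next⇒CcwNext : ∀ {d d'} → Next d d' → D.CcwNext d d'
  Next⇒CcwNext {d} {d'} (a , inj₁ (lt , none)) = a , inj₁ (≺⇒KeyLt {d} {d'} lt ,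
    λ z za p → none z za (KeyLt⇒≺ {d} {z} (proj₁ p) , KeyLt⇒≺ {z} {d'} (proj₂ p)))
  Next⇒CcwNext {d} {d'} (a , inj₂ (min , max)) = a , inj₂ ((λ z za → ≼⇒KeyLe {d'} {z} (min z za)) , (λ z za → ≼⇒KeyLe {z} {d} (max z za)))

  NorthIn⇒North : ∀ {d d'} → D.NorthIn d d' → North d d'
  NorthIn⇒North {d} {d'} = ⊎-map (λ p → low (proj₁ p) , high (proj₂ p))
    (λ p → KeyLe⇒≼ {d'} {d} (proj₁ p) , ⊎-map low high (proj₂ p))
    where
    low  = subst (_≤ 1) (group≡ d)
    high = subst (2 ≤_) (group≡ d')

  North⇒NorthIn : ∀ {d d'} → North d d' → D.NorthIn d d'
  North⇒NorthIn {d} {d'} = ⊎-map (λ p → low (proj₁ p) , high (proj₂ p))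
    (λ p → ≼⇒KeyLe {d'} {d} (proj₁ p) , ⊎-map low high (proj₂ p))
    where
    low  = subst (_≤ 1) (sym (group≡ d))
    high = subst (2 ≤_) (sym (group≡ d'))

-- Restriction of drawings

record SubDigraph (G H : EmbeddedDigraph) : Set where
  private
    module G = EmbeddedDigraph G
    module H = EmbeddedDigraph H
  field
    fv           : Fin G.n → Fin H.n
    fv-injective : Injective _≡_ _≡_ fv
    fe           : Fin G.m → Fin H.m
    fe-injective : Injective _≡_ _≡_ fe
    tl-fe        : ∀ e → H.tl (fe e) ≡ fv (G.tl e)
    hd-fe        : ∀ e → H.hd (fe e) ≡ fv (G.hd e)

module Embedding (G H : EmbeddedDigraph) (S : SubDigraph G H) (simpleG : Simple G)
  (LH : Layout (EmbeddedDigraph.tl H) (EmbeddedDigraph.hd H)) where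

  private
    module G = EmbeddedDigraph G
    module H = EmbeddedDigraph H
  open SubDigraph S
  open Layout LH renaming (x to xH; y to yH)

  fd : Dart G.m → Dart H.m
  fd d = fe (proj₁ d) , proj₂ d

  InImg : Dart H.m → Set
  InImg d' = Σ (Dart G.m) λ d → fd d ≡ d'

  FirstG : Dart H.m → Dart G.m → Set
  FirstG z q = Σ ℕ λ k → iter H.rot k z ≡ fd q × (∀ j → j < k → ¬ InImg (iter H.rot j z))

  x y : Fin G.n → ℤ
  x v = xH (fv v)
  y v = yH (fv v)

  upwardG : ∀ e → y (G.tl e) <ℤ y (G.hd e)
  upwardG e = subst₂ (λ a b → yH a <ℤ yH b) (tl-fe e) (hd-fe e) (upward (fe e))

  layoutG : Layout G.tl G.hd
  layoutG = record
    { x = x ; y = y ; x-inj = λ p → fv-injective (x-inj p) ; y-inj = λ p → fv-injective (y-inj p)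
    ; upward = upwardG ; simple = simpleG }

  module KG = GraphKeys G layoutG
  module KH = GraphKeys H LH

  group-fd : ∀ d → KH.group (fd d) ≡ KG.group d
  group-fd (e , true)  rewrite tl-fe e | hd-fe e = refl
  group-fd (e , false) rewrite tl-fe e | hd-fe e = refl

  second-fd : ∀ d → KH.second (fd d) ≡ KG.second d
  second-fd (e , true)  rewrite tl-fe e = refl
  second-fd (e , false) rewrite tl-fe e | hd-fe e = refl

  at-fd : ∀ d → H.dartVertex (fd d) ≡ fv (G.dartVertex d)
  at-fd (e , true)  = hd-fe e
  at-fd (e , false) = tl-fe e

  fd-injective : ∀ {d d'} → fd d ≡ fd d' → d ≡ d'
  fd-injective {e , b} {e' , b'} eq = cong₂ _,_ (fe-injective (cong proj₁ eq)) (cong proj₂ eq)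

  ≺-fd : ∀ {d d'} → d KG.≺ d' → fd d KH.≺ fd d'
  ≺-fd {d} {d'} (KG.lower lt)    = KH.lower (subst₂ _<_ (sym (group-fd d)) (sym (group-fd d')) lt)
  ≺-fd {d} {d'} (KG.level eq lt) = KH.level (trans (group-fd d) (trans eq (sym (group-fd d'))))
    (subst₂ _<ℤ_ (sym (second-fd d)) (sym (second-fd d')) lt)

  ≼-fd : ∀ {d d'} → d KG.≼ d' → fd d KH.≼ fd d'
  ≼-fd = ⊎-map ≺-fd (cong fd)

  Between-fd : ∀ {a z b} → KG.Between a z b → KH.Between (fd a) (fd z) (fd b)
  Between-fd = ⊎-map (λ p → ≺-fd (proj₁ p) , ≺-fd (proj₂ p)) (λ p → ≼-fd (proj₁ p) , ⊎-map ≺-fd ≺-fd (proj₂ p))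

  North-fd : ∀ {a b} → KG.North a b → KH.North (fd a) (fd b)
  North-fd {a} {b} = ⊎-map (λ p → low (proj₁ p) , high (proj₂ p)) (λ p → ≼-fd (proj₁ p) , ⊎-map low high (proj₂ p))
    where
    low  = subst (_≤ 1) (sym (group-fd a))
    high = subst (2 ≤_) (sym (group-fd b))

  FirstG-unique : ∀ {z q q'} → FirstG z q → FirstG z q' → q ≡ q'
  FirstG-unique {z} {q} {q'} (k , eq , none) (k' , eq' , none') with <-cmp k k'
  ... | tri< lt _ _   = contradiction (q , sym eq) (none' k lt)
  ... | tri≈ _ refl _ = fd-injective (trans (sym eq) eq')
  ... | tri> _ _ gt   = contradiction (q' , sym eq') (none k' gt)

  module _ (rotH-Next : ∀ d → KH.Next d (H.rot d)) where

    -- A dart of `G` strictly between `d` and `q` would be met by the rotation of `H` before the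
    -- first return.
    first-return⇒Next : ∀ {d q} k → G.dartVertex q ≡ G.dartVertex d → iter H.rot (suc k) (fd d) ≡ fd q →
      (∀ j → 1 ≤ j → j < suc k → ¬ InImg (iter H.rot j (fd d))) → KG.Next d q
    first-return⇒Next {d} k qd eq none = KG.¬Between⇒Next qd λ z za bet →
      hit (KH.Between-iter H.rot rotH-Next k (trans (at-fd z) (trans (cong fv za) (sym (at-fd d))))
        (subst (KH.Between (fd d) (fd z)) (sym eq) (Between-fd bet)))
      where
      hit : ∀ {z} → ¬ (Σ ℕ λ j → j < k × iter H.rot (suc j) (fd d) ≡ fd z)
      hit {z} (j , j<k , eq') = none (suc j) (s≤s z≤n) (s≤s j<k) (z , sym eq')

  module Apex (v : Fin G.n) (v-top : ∀ w → y w ≤ℤ y v) where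

    incoming : ∀ d → G.dartVertex d ≡ v → d ≡ (proj₁ d , true)
    incoming (e , true)  _    = refl
    incoming (e , false) refl = contradiction (v-top (G.hd e)) (ℤₚ.<⇒≱ (upwardG e))

    -- At its highest vertex all edges of `G` come in, so each outgoing edge of `H` there is caught
    -- in the northern angle of `G`.
    North⇒Between : ∀ {a b e} → G.dartVertex a ≡ v → G.dartVertex b ≡ v → KG.North a b →
      KH.Between (fd a) (e , false) (fd b)
    North⇒Between {a} {b} {e} av bv north = subst₂ (λ a b → KH.Between a (e , false) b) (sym in₁) (sym in₂)
      (KH.North-Between-out (subst₂ KH.North in₁ in₂ (North-fd north)))
      where
      in₁ = cong fd (incoming a av)
      in₂ = cong fd (incoming b bv)

module Restrict (G H : EmbeddedDigraph) (simpleG : Simple G) (stH : IsPlaneSTGraph H) (aug : Augments G H)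
  (xH yH : Fin (EmbeddedDigraph.n H) → ℤ) (drawing : Drawing.IsUpwardPlanarLDrawing H xH yH) where

  private
    module G = EmbeddedDigraph G
    module H = EmbeddedDigraph H
    module GO = Orbits G
    module HO = Orbits H
  open Drawing.IsUpwardPlanarLDrawing drawing

  subDigraph : SubDigraph G H
  subDigraph = record
    { fv = proj₁ aug ; fv-injective = proj₁ (proj₂ aug)
    ; fe = proj₁ (proj₂ (proj₂ aug)) ; fe-injective = proj₁ (proj₂ (proj₂ (proj₂ aug)))
    ; tl-fe = proj₁ (proj₂ (proj₂ (proj₂ (proj₂ aug))))
    ; hd-fe = proj₁ (proj₂ (proj₂ (proj₂ (proj₂ (proj₂ aug))))) }

  layoutH : Layout H.tl H.hd
  layoutH = record { x = xH ; y = yH ; x-inj = x-inj ; y-inj = y-inj ; upward = upward ; simple = proj₁ (proj₁ stH) }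

  open SubDigraph subDigraph
  open Embedding G H subDigraph simpleG layoutH

  first-return : ∀ d → Σ ℕ λ k → 1 ≤ k × iter H.rot k (fd d) ≡ fd (G.rot d) ×
    (∀ j → 1 ≤ j → j < k → ¬ InImg (iter H.rot j (fd d)))
  first-return = proj₁ (proj₂ (proj₂ (proj₂ (proj₂ (proj₂ (proj₂ aug))))))

  lab : Dart H.m → Dart G.m
  lab = proj₁ (proj₂ (proj₂ (proj₂ (proj₂ (proj₂ (proj₂ (proj₂ aug)))))))

  private
    labels = proj₂ (proj₂ (proj₂ (proj₂ (proj₂ (proj₂ (proj₂ (proj₂ aug)))))))

  lab-first : ∀ z v → H.dartVertex z ≡ fv v → FirstG z (lab z)
  lab-first = proj₁ labels

  lab-face : ∀ z → G.SameFace (lab z) (lab (H.faceNext z))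
  lab-face = proj₁ (proj₂ labels)

  lab-new : ∀ z → ¬ (Σ (Fin G.m) λ e → fe e ≡ proj₁ z) → G.SameFace (lab z) (lab (flipD z))
  lab-new = proj₁ (proj₂ (proj₂ labels))

  lab-outer : G.SameFace G.outer (lab H.outer)
  lab-outer = proj₂ (proj₂ (proj₂ labels))

  rotH-Next : ∀ d → KH.Next d (H.rot d)
  rotH-Next d = KH.CcwNext⇒Next (respRot d)

  rotG-Next : ∀ d → KG.Next d (G.rot d)
  rotG-Next d with first-return d
  ... | suc k , _ , eq , none = first-return⇒Next rotH-Next k (G.rot-at d) eq none

  noCrossG : ∀ e f → ¬ Drawing.Cross G x y e f
  noCrossG e f c = noCross (fe e) (fe f) (lift c)
    where
    lift : Drawing.Cross G x y e f → Drawing.Cross H xH yH (fe e) (fe f)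
    lift c rewrite tl-fe e | hd-fe e | tl-fe f | hd-fe f = c

  -- The first dart of `G` met from any of these positions is `G.rot d`, and `FirstG` determines the
  -- label.
  lab-between : ∀ d j → suc j ≤ proj₁ (first-return d) → lab (iter H.rot (suc j) (fd d)) ≡ G.rot d
  lab-between d j sj≤k with first-return d
  ... | k , _ , eq , none = FirstG-unique (lab-first z (G.dartVertex d) (trans (HO.rot-orbit-at (suc j) (fd d)) (at-fd d)))
    (k ∸ suc j , trans (sym (iter-+ H.rot (k ∸ suc j) (suc j) (fd d)))
      (trans (cong (λ i → iter H.rot i (fd d)) (ℕ.m∸n+n≡m sj≤k)) eq) ,
     λ i i< im → none (i + suc j) (≤-trans (s≤s z≤n) (m≤n+m (suc j) i))
       (subst (i + suc j <_) (ℕ.m∸n+n≡m sj≤k) (ℕ.+-monoˡ-< (suc j) i<))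
       (subst InImg (sym (iter-+ H.rot i (suc j) (fd d))) im))
    where z = iter H.rot (suc j) (fd d)

  infix 4 _~_
  _~_ : Dart G.m → Dart G.m → Set
  _~_ = G.SameFace

  lab-SameFace : ∀ {z z'} → H.SameFace z z' → lab z ~ lab z'
  lab-SameFace {z} (k , refl) = go k
    where
    go : ∀ k → lab z ~ lab (iter H.faceNext k z)
    go zero    = orbit-refl
    go (suc k) = orbit-trans (go k) (lab-face (iter H.faceNext k z))

  -- All edges at a vertex outside `G` are new, and a rotation step there is the crossing of a new
  -- edge followed by a face step.
  lab-vertex : ∀ {w} → (∀ v → w ≢ fv v) → ∀ z z' → H.dartVertex z ≡ w → H.dartVertex z' ≡ w → lab z ~ lab z'
  lab-vertex {w} out z z' zw z'w with H.rot-cyc z z' (trans zw (sym z'w))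
  ... | k , refl = go k
    where
    new : ∀ d → H.dartVertex d ≡ w → ¬ (Σ (Fin G.m) λ e → fe e ≡ proj₁ d)
    new (_ , b) dw (e , refl) = out _ (trans (sym dw) (at-fd (e , b)))
    step : ∀ d → H.dartVertex d ≡ w → lab d ~ lab (H.rot d)
    step d dw = orbit-trans (lab-new d (new d dw))
      (subst (λ u → lab (flipD d) ~ lab (H.rot u)) (flipD-involutive d) (lab-face (flipD d)))
    go : ∀ k → lab z ~ lab (iter H.rot k z)
    go zero    = orbit-refl
    go (suc k) = orbit-trans (go k) (step (iter H.rot k z) (trans (HO.rot-orbit-at k z) zw))

  t : Fin H.n
  t = proj₁ (proj₂ (proj₂ stH))

  private
    e₀ = proj₁ (proj₂ (proj₂ (proj₂ stH)))
    hd-e₀ : H.hd e₀ ≡ t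
    hd-e₀ = proj₁ (proj₂ (proj₂ (proj₂ (proj₂ (proj₂ stH)))))
    sinks = proj₁ (proj₂ (proj₂ (proj₂ (proj₂ (proj₂ (proj₂ (proj₂ stH)))))))

  out-edge : ∀ w → w ≢ t → ∃ λ e → H.tl e ≡ w
  out-edge w w≢t with any? (λ e → H.tl e Fin.≟ w)
  ... | yes p = p
  ... | no ¬p = contradiction (proj₁ (sinks w) (λ e eq → ¬p (e , eq))) w≢t

  t-top : ∀ w → yH w ≤ℤ yH t
  t-top with argmax (allFin H.n) ∈-allFin {λ _ → ⊤} (λ _ → yes tt) yH (t , tt)
  ... | u , _ , max with u Fin.≟ t
  ...   | yes refl = λ w → max w tt
  ...   | no u≢t with out-edge u u≢t
  ...     | e , refl = contradiction (max (H.hd e) tt) (ℤₚ.<⇒≱ (upward e))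

  -- The dart `H.outer` may sit anywhere; this ties its label to a dart at `t`. A full turn at `t`
  -- contains the upward direction, so one of the angles there does, and `respOuter` applies to it.
  north-at-t : Σ (Dart H.m) λ d → H.dartVertex d ≡ t × G.outer ~ lab d
  north-at-t with HO.Rot.period (e₀ , true)
  ... | p , eq with KH.North-iter H.rot rotH-Next p (subst (KH.North (e₀ , true)) (sym eq) (KH.North-self (e₀ , true)))
  ... | j , _ , north = H.rot a , trans (H.rot-at a) a-at ,
        orbit-trans lab-outer (lab-SameFace (respOuter t t-top a a-at (KH.North⇒NorthIn north)))
    where
    a = iter H.rot j (e₀ , true)
    a-at : H.dartVertex a ≡ t
    a-at = trans (HO.rot-orbit-at j (e₀ , true)) hd-e₀

  module Top (v : Fin G.n) (v-top : ∀ w → y w ≤ℤ y v) where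

    above-outside : ∀ {w} → yH (fv v) <ℤ yH w → ∀ u → w ≢ fv u
    above-outside lt u refl = ℤₚ.<⇒≱ lt (v-top u)

    private
      depth = proj₁ (normalise (λ w → ℤ.- yH w))
      depth-< : ∀ e → depth (H.hd e) < depth (H.tl e)
      depth-< e = proj₂ (normalise (λ w → ℤ.- yH w)) (ℤₚ.neg-mono-< (upward e))

    climb : ∀ k w → depth w < k → yH (fv v) <ℤ yH w → ∀ z → H.dartVertex z ≡ w → G.outer ~ lab z
    climb (suc k) w w<k v<w z zw with w Fin.≟ t
    ... | yes refl = orbit-trans (proj₂ (proj₂ north-at-t))
      (lab-vertex (above-outside v<w) (proj₁ north-at-t) z (proj₁ (proj₂ north-at-t)) zw)
    ... | no w≢t with out-edge w w≢t
    ...   | e , refl = orbit-trans (climb k (H.hd e) (<-≤-trans (depth-< e) (s≤s⁻¹ w<k)) (ℤₚ.<-trans v<w (upward e)) (e , true) refl)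
      (orbit-trans (lab-new (e , true) new) (lab-vertex (above-outside v<w) (e , false) z refl zw))
      where
      new : ¬ (Σ (Fin G.m) λ e' → fe e' ≡ e)
      new (e' , refl) = above-outside v<w _ (tl-fe e')

    outer-north : ∀ d → G.dartVertex d ≡ v → KG.North d (G.rot d) → G.outer ~ G.rot d
    outer-north d dv north with fv v Fin.≟ t | first-return d in eqr
    -- If the top of `G` is `t` itself, the northern angle of `G` is cut into angles of `H`, and the
    -- one that still contains the upward direction is outer in `H`.
    ... | yes fv≡t | suc k , _ , eq , _ with KH.North-iter H.rot rotH-Next k
                    (subst (KH.North (fd d)) (sym eq) (North-fd north))
    ...   | j , j≤k , nj = subst (G.outer ~_) (lab-between d j (subst (λ r → suc j ≤ proj₁ r) (sym eqr) (s≤s j≤k)))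
        (orbit-trans lab-outer (lab-SameFace (respOuter t t-top a a-at (KH.North⇒NorthIn nj))))
      where
      a = iter H.rot j (fd d)
      a-at : H.dartVertex a ≡ t
      a-at = trans (HO.rot-orbit-at j (fd d)) (trans (at-fd d) (trans (cong fv dv) fv≡t))
    -- Otherwise some edge of `H` leaves through the northern angle; its lower dart has the label
    -- `G.rot d`, and its upper end lies above all of `G`.
    outer-north d dv north | no fv≢t | suc k , _ , eq , _ with out-edge (fv v) fv≢t
    ... | e , te with KH.Between-iter H.rot rotH-Next k {fd d} {e , false} (trans te (trans (cong fv (sym dv)) (sym (at-fd d))))
                        (subst (KH.Between (fd d) (e , false)) (sym eq) (Apex.North⇒Between v v-top dv (trans (G.rot-at d) dv) north))
    ...   | j , j<k , eq' = orbit-trans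
        (climb (suc (depth (H.hd e))) (H.hd e) (n<1+n _) (subst (λ u → yH u <ℤ yH (H.hd e)) te (upward e)) (e , true) refl)
        (subst (lab (e , true) ~_) (trans (cong lab (sym eq')) (lab-between d j (subst (λ r → suc j ≤ proj₁ r) (sym eqr) (ℕ.m<n⇒m<1+n j<k))))
          (lab-new (e , true) new))
      where
      new : ¬ (Σ (Fin G.m) λ e' → fe e' ≡ e)
      new (e' , refl) = ℤₚ.<⇒≱ (upwardG e') (subst (λ u → y (G.hd e') ≤ℤ y u)
        (fv-injective (trans (sym te) (tl-fe e'))) (v-top (G.hd e')))

  restricted : UpwardPlanarLDrawable G
  restricted = x , y , record
    { x-inj = λ p → fv-injective (x-inj p) ; y-inj = λ p → fv-injective (y-inj p)
    ; upward = upwardG ; noCross = noCrossG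
    ; respRot = λ d → KG.Next⇒CcwNext (rotG-Next d)
    ; respOuter = λ v v-top d dv north → Top.outer-north v v-top d dv (KG.NorthIn⇒North north) }

-- Source switches

sum-injective⇒surjective : ∀ {a b c d} (f : Fin a ⊎ Fin b → Fin c ⊎ Fin d) → a + b ≡ c + d →
  (∀ {p q} → f p ≡ f q → p ≡ q) → ∀ z → ∃ λ p → f p ≡ z
sum-injective⇒surjective {a} {b} {c} {d} f size inj z = splitAt a i , join-injective (trans (sym (lookupᵍ i)) eq)
  where
  join-injective : ∀ {p q} → join c d p ≡ join c d q → p ≡ q
  join-injective {p} {q} e = trans (sym (Fin.splitAt-join c d p)) (trans (cong (splitAt c) e) (Fin.splitAt-join c d q))
  g : Fin (a + b) → Fin (a + b)
  g i = subst Fin (sym size) (join c d (f (splitAt a i)))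
  splitAt-injective : ∀ {i j} → splitAt a {b} i ≡ splitAt a j → i ≡ j
  splitAt-injective {i} {j} e = trans (sym (Fin.join-splitAt a b i)) (trans (cong (join a b) e) (Fin.join-splitAt a b j))
  g-inj : Injective _≡_ _≡_ g
  g-inj e = splitAt-injective (inj (join-injective (subst-injective (sym size) e)))
    where
    subst-injective : ∀ {k l : ℕ} (q : k ≡ l) {u v : Fin k} → subst Fin q u ≡ subst Fin q v → u ≡ v
    subst-injective refl e = e
  preimage = injective⇒surjective g g-inj (subst Fin (sym size) (join c d z))
  i = proj₁ preimage
  eq : subst Fin size (g i) ≡ join c d z
  eq = trans (cong (subst Fin size) (proj₂ preimage)) (subst-subst-sym size)
  lookupᵍ : ∀ i → subst Fin size (g i) ≡ join c d (f (splitAt a i))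
  lookupᵍ i = subst-subst-sym size

Star-linear : {A : Set} {R : A → A → Set} → (∀ {a b c} → R a b → R a c → b ≡ c) →
  ∀ {a b c} → Star R a b → Star R a c → Star R b c ⊎ Star R c b
Star-linear det ε        ac       = inj₁ ac
Star-linear det (r ◅ rs) ε        = inj₂ (r ◅ rs)
Star-linear det (r ◅ rs) (q ◅ qs) with det r q
... | refl = Star-linear det rs qs

-- A source switch of a face is an angle between two outgoing edges; it is recorded
-- by the edge at its counter-clockwise end.
module Switches (G : EmbeddedDigraph) (rank : Fin (EmbeddedDigraph.n G) → ℕ)
  (rank-< : ∀ e → rank (EmbeddedDigraph.tl G e) < rank (EmbeddedDigraph.hd G e)) where
  open EmbeddedDigraph G
  open Orbits G

  -- Reaches d σ: following the boundary of the face of d downwards leads to the source switch σ.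
  data Reaches : Dart m → Fin m → Set where
    -- The angle ending at `(e , false)` is to the right of `e`, the one ending at `(e , true)` to
    -- its left. The first two constructors follow a right side, the last two a left side.
    switch : ∀ {e e'} → rot (e' , false) ≡ (e , false) → Reaches (e , false) e
    back   : ∀ {e e' σ} → rot (e' , true) ≡ (e , false) → Reaches (e' , false) σ → Reaches (e , false) σ
    turn   : ∀ {e σ} → rot (e , false) ≡ (σ , false) → Reaches (e , true) σ
    down   : ∀ {e e' σ} → rot (e , false) ≡ (e' , true) → Reaches (e' , true) σ → Reaches (e , true) σ

  rot⇒same-vertex : ∀ {d d'} → rot d ≡ d' → dartVertex d' ≡ dartVertex d
  rot⇒same-vertex {d} refl = rot-at d

  private
    reaches-below : ∀ k e b → rank (tl e) < k → ∃ (Reaches (e , b))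
    reaches-below (suc k) e false lt with rot⁻¹ (e , false) in eq
    ... | e' , false = e , switch (trans (cong rot (sym eq)) (rot-inv₁ _))
    ... | e' , true with reaches-below k e' false (<-≤-trans (subst (rank (tl e') <_) (cong rank hd≡) (rank-< e')) (s≤s⁻¹ lt))
      where
      hd≡ : hd e' ≡ tl e
      hd≡ = sym (rot⇒same-vertex {e' , true} {e , false} (trans (cong rot (sym eq)) (rot-inv₁ _)))
    ...   | σ , r = σ , back (trans (cong rot (sym eq)) (rot-inv₁ _)) r
    reaches-below (suc k) e true lt with rot (e , false) in eq
    ... | σ , false = σ , turn eq
    ... | e' , true with reaches-below k e' true
            (<-≤-trans (subst (rank (tl e') <_) (cong rank (rot⇒same-vertex {e , false} {e' , true} eq)) (rank-< e')) (s≤s⁻¹ lt))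
    ...   | σ , r = σ , down eq r

  reaches : ∀ d → ∃ (Reaches d)
  reaches (e , b) = reaches-below (suc (rank (tl e))) e b (n<1+n _)

  ends-differ : ∀ {d} {e e' : Fin m} → d ≡ (e , true) → d ≡ (e' , false) → ⊥
  ends-differ refl ()

  preceding-ends-differ : ∀ {e e' d} → rot (e , true) ≡ d → rot (e' , false) ≡ d → ⊥
  preceding-ends-differ p q = ends-differ refl (rot-injective (trans p (sym q)))

  same-edge : ∀ {e e' : Fin m} {b : Bool} {d : Dart m} → d ≡ (e , b) → d ≡ (e' , b) → e ≡ e'
  same-edge refl refl = refl

  Reaches-unique : ∀ {d σ σ'} → Reaches d σ → Reaches d σ' → σ ≡ σ'
  Reaches-unique (switch p) (switch q) = refl
  Reaches-unique (switch p) (back q r) = ⊥-elim (preceding-ends-differ q p)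
  Reaches-unique (back p r) (switch q) = ⊥-elim (preceding-ends-differ p q)
  Reaches-unique (back p r) (back q r') with rot-injective (trans p (sym q))
  ... | refl = Reaches-unique r r'
  Reaches-unique (turn p) (turn q)   = same-edge p q
  Reaches-unique (turn p) (down q r) = ⊥-elim (ends-differ q p)
  Reaches-unique (down p r) (turn q) = ⊥-elim (ends-differ p q)
  Reaches-unique (down p r) (down q r') with same-edge p q
  ... | refl = Reaches-unique r r'

  -- A Boolean equation, hence decidable: the switches are to be filtered and counted.
  IsSwitch : Fin m → Set
  IsSwitch e = proj₂ (rot⁻¹ (e , false)) ≡ false

  follows-out⇒IsSwitch : ∀ {e e'} → rot (e' , false) ≡ (e , false) → IsSwitch e
  follows-out⇒IsSwitch {e} {e'} p = cong proj₂ (trans (cong rot⁻¹ (sym p)) (rot-inv₂ (e' , false)))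

  IsSwitch⇒follows-out : ∀ {e} → IsSwitch e → ∃ λ e' → rot (e' , false) ≡ (e , false)
  IsSwitch⇒follows-out {e} sw with rot⁻¹ (e , false) in eq
  IsSwitch⇒follows-out refl | e' , false = e' , trans (cong rot (sym eq)) (rot-inv₁ _)

  ¬IsSwitch⇒follows-in : ∀ {e} → ¬ IsSwitch e → ∃ λ e' → rot (e' , true) ≡ (e , false)
  ¬IsSwitch⇒follows-in {e} ¬sw with rot⁻¹ (e , false) in eq
  ... | e' , true  = e' , trans (cong rot (sym eq)) (rot-inv₁ _)
  ... | e' , false = contradiction refl ¬sw

  Reaches⇒IsSwitch : ∀ {d σ} → Reaches d σ → IsSwitch σ
  Reaches⇒IsSwitch (switch p) = follows-out⇒IsSwitch p
  Reaches⇒IsSwitch (back _ r) = Reaches⇒IsSwitch r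
  Reaches⇒IsSwitch (turn p)   = follows-out⇒IsSwitch p
  Reaches⇒IsSwitch (down _ r) = Reaches⇒IsSwitch r

  Reaches⇒SameFace : ∀ {d σ} → Reaches d σ → SameFace (σ , false) d
  Reaches⇒SameFace (switch _) = orbit-refl
  Reaches⇒SameFace (back p r) = orbit-trans (Reaches⇒SameFace r) (1 , p)
  Reaches⇒SameFace (turn p)   = Face.orbit-sym (1 , p)
  Reaches⇒SameFace (down p r) = orbit-trans (Reaches⇒SameFace r) (Face.orbit-sym (1 , p))

  -- One step up the boundary of a face to the right of both edges; `Upwardsˡ` is the step for a
  -- face to their left. Both are deterministic, so the edges above a common switch on one side form
  -- a single path.
  Upwards : (e e' : Fin m) → Set
  Upwards e e' = rot (e , true) ≡ (e' , false)

  Upwardsˡ : (e e' : Fin m) → Set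
  Upwardsˡ e e' = rot (e' , false) ≡ (e , true)

  right-chain : ∀ {e σ} → Reaches (e , false) σ → Star Upwards σ e
  right-chain (switch _) = ε
  right-chain (back p r) = right-chain r ◅◅ (p ◅ ε)

  left-chain : ∀ {e σ} → Reaches (e , true) σ → ∃ λ f → rot (f , false) ≡ (σ , false) × Star Upwardsˡ f e
  left-chain {e} (turn p) = e , p , ε
  left-chain (down p r) with left-chain r
  ... | f , q , fe = f , q , fe ◅◅ (p ◅ ε)

  chain-rank : {R : Fin m → Fin m → Set} → (∀ {a b} → R a b → hd a ≡ tl b) →
    ∀ {a b} → Star R a b → a ≡ b ⊎ rank (hd a) ≤ rank (tl b)
  chain-rank adj ε = inj₁ refl
  chain-rank adj (r ◅ rs) with chain-rank adj rs
  ... | inj₁ refl = inj₂ (≤-reflexive (cong rank (adj r)))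
  ... | inj₂ le   = inj₂ (≤-trans (≤-reflexive (cong rank (adj r))) (≤-trans (<⇒≤ (rank-< _)) le))

  -- The edges crossing the level just below height `k`: those ending at height `k` still count,
  -- those starting there do not yet.
  Alive : ℕ → Fin m → Set
  Alive k e = rank (tl e) < k × k ≤ rank (hd e)

  -- A chain is a directed path: of two different edges on it, one ends no higher than the other
  -- starts, so they do not cross the same level.
  alive-chain-unique : {R : Fin m → Fin m → Set} → (∀ {a b} → R a b → hd a ≡ tl b) →
    (∀ {a b c} → R a b → R a c → b ≡ c) →
    ∀ {k a b c} → Star R a b → Star R a c → Alive k b → Alive k c → b ≡ c
  alive-chain-unique adj det ab ac (tb , hb) (tc , hc) with Star-linear det ab ac
  ... | inj₁ bc with chain-rank adj bc
  ...   | inj₁ eq = eq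
  ...   | inj₂ le = contradiction (≤-trans hb le) (<⇒≱ tc)
  alive-chain-unique adj det ab ac (tb , hb) (tc , hc) | inj₂ cb with chain-rank adj cb
  ...   | inj₁ eq = sym eq
  ...   | inj₂ le = contradiction (≤-trans hc le) (<⇒≱ tb)

  Reaches-right-unique : ∀ {k e e' σ} → Reaches (e , false) σ → Reaches (e' , false) σ →
    Alive k e → Alive k e' → e ≡ e'
  Reaches-right-unique r r' = alive-chain-unique
    (λ {a} {b} p → sym (rot⇒same-vertex {a , true} {b , false} p)) same-edge (right-chain r) (right-chain r')

  Reaches-left-unique : ∀ {k e e' σ} → Reaches (e , true) σ → Reaches (e' , true) σ →
    Alive k e → Alive k e' → e ≡ e'
  Reaches-left-unique r r' with left-chain r | left-chain r'
  ... | f , p , c | f' , p' , c' with rot-injective (trans p (sym p'))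
  ... | refl = alive-chain-unique (λ {a} {b} q → rot⇒same-vertex {b , false} {a , true} q)
    (λ p q → cong proj₁ (rot-injective (trans p (sym q)))) c c'

  -- Somewhere the rotation has to change ends. With `b` true this yields an outgoing edge right
  -- after an incoming one, with `b` false an incoming edge right after an outgoing one.
  transition : ∀ b k {d} → proj₂ d ≡ b → proj₂ (iter rot k d) ≡ not b →
    Σ (Fin m) λ i → Σ (Fin m) λ o → rot (i , b) ≡ (o , not b) × dartVertex (o , not b) ≡ dartVertex d
  transition b zero    refl eq = contradiction eq (not-¬ refl)
  transition b (suc k) {d} start end with iter rot k d in eq
  ... | e , c with c Bool.≟ b
  ...   | no c≢b = transition b k start (trans (cong proj₂ eq) (¬-not c≢b))
  ...   | yes refl with rot (e , c) in eq'
  transition b (suc k) {d} start refl | e , c | yes refl | o , _ =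
    e , o , eq' , trans (rot⇒same-vertex {e , c} eq') (trans (cong dartVertex (sym eq)) (rot-orbit-at k d))

  module Euler (F : ℕ) (face : Dart m → Fin F) (face-surj : ∀ i → Σ (Dart m) λ d → face d ≡ i)
    (face-SameFace : ∀ {d d'} → SameFace d d' → face d ≡ face d') (euler : n + F ≡ m + 2)
    (s t : Fin n) (in-edge : ∀ v → v ≢ s → ∃ λ e → hd e ≡ v) (out-edge : ∀ v → v ≢ t → ∃ λ e → tl e ≡ v) where

    -- By Euler's formula there are as many faces as edges that are not the rightmost outgoing
    -- edge of an inner vertex, and every face has a source switch; so it has only one.
    private
      rightmost : ∀ v → v ≢ s → v ≢ t → Σ (Fin m) λ o → (∃ λ i → rot (i , true) ≡ (o , false)) × tl o ≡ v
      rightmost v v≢s v≢t with in-edge v v≢s | out-edge v v≢t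
      ... | i , iv | o , ov with rot-cyc (i , true) (o , false) (trans iv (sym ov))
      ... | k , eq with transition true k {i , true} refl (cong proj₂ eq)
      ... | i' , o' , p , q = o' , (i' , p) , trans q iv

      -- The two elements of `Fin 2` serve `s` and `t`, for which no outgoing edge after an incoming
      -- one is available; they are the constant of Euler's formula. `owner` is a left inverse, so
      -- `choice` is injective and, the sizes being equal, onto.
      choice : Fin n ⊎ Fin F → Fin m ⊎ Fin 2
      choice (inj₂ i) = inj₁ (proj₁ (reaches (proj₁ (face-surj i))))
      choice (inj₁ v) with v Fin.≟ s | v Fin.≟ t
      ... | yes _  | _      = inj₂ zero
      ... | no _   | yes _  = inj₂ (suc zero)
      ... | no v≢s | no v≢t = inj₁ (proj₁ (rightmost v v≢s v≢t))

      face-switch : ∀ i → face (proj₁ (reaches (proj₁ (face-surj i))) , false) ≡ i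
      face-switch i = trans (face-SameFace (Reaches⇒SameFace (proj₂ (reaches (proj₁ (face-surj i)))))) (proj₂ (face-surj i))

      owner : Fin m ⊎ Fin 2 → Fin n ⊎ Fin F
      owner (inj₂ zero)       = inj₁ s
      owner (inj₂ (suc zero)) = inj₁ t
      owner (inj₁ e) with proj₂ (rot⁻¹ (e , false))
      ... | false = inj₂ (face (e , false))
      ... | true  = inj₁ (tl e)

      owner-rightmost : ∀ {i o} → rot (i , true) ≡ (o , false) → owner (inj₁ o) ≡ inj₁ (tl o)
      owner-rightmost {i} {o} r with proj₂ (rot⁻¹ (o , false)) | cong proj₂ (trans (cong rot⁻¹ (sym r)) (rot-inv₂ (i , true)))
      ... | _ | refl = refl

      owner-switch : ∀ {e} → IsSwitch e → owner (inj₁ e) ≡ inj₂ (face (e , false))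
      owner-switch {e} sw with proj₂ (rot⁻¹ (e , false)) | sw
      ... | _ | refl = refl

      owner-choice : ∀ p → owner (choice p) ≡ p
      owner-choice (inj₂ i) = trans (owner-switch (Reaches⇒IsSwitch (proj₂ (reaches (proj₁ (face-surj i)))))) (cong inj₂ (face-switch i))
      owner-choice (inj₁ v) with v Fin.≟ s | v Fin.≟ t
      ... | yes v≡s | _       = cong inj₁ (sym v≡s)
      ... | no _    | yes v≡t = cong inj₁ (sym v≡t)
      ... | no v≢s  | no v≢t = trans (owner-rightmost (proj₂ (proj₁ (proj₂ r)))) (cong inj₁ (proj₂ (proj₂ r)))
        where r = rightmost v v≢s v≢t

      choice-owner : ∀ z → choice (owner z) ≡ z
      choice-owner z with sum-injective⇒surjective choice euler
        (λ {p} {q} eq → trans (sym (owner-choice p)) (trans (cong owner eq) (owner-choice q))) z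
      ... | p , refl = cong choice (owner-choice p)

    switch-unique : ∀ {e e'} → IsSwitch e → IsSwitch e' → face (e , false) ≡ face (e' , false) → e ≡ e'
    switch-unique {e} {e'} sw sw' eq = inj₁-injective (trans (sym (choice-owner (inj₁ e))) (trans (cong choice
      (trans (owner-switch sw) (trans (cong inj₂ eq) (sym (owner-switch sw'))))) (choice-owner (inj₁ e'))))

    private
      common-switch : ∀ {d d'} → face d ≡ face d' → ∃ λ σ → Reaches d σ × Reaches d' σ
      common-switch {d} {d'} eq with reaches d | reaches d'
      ... | σ , r | σ' , r' = σ , r , subst (Reaches d') (sym (switch-unique (Reaches⇒IsSwitch r) (Reaches⇒IsSwitch r')
        (trans (face-SameFace (Reaches⇒SameFace r)) (trans eq (sym (face-SameFace (Reaches⇒SameFace r'))))))) r'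

    -- All edges with a given face on their right lie above its one switch, hence on one path, which
    -- meets each level at most once. So the next edge of a cut is identified by the face in front
    -- of it.
    alive-right-unique : ∀ {k e e'} → face (e , false) ≡ face (e' , false) → Alive k e → Alive k e' → e ≡ e'
    alive-right-unique eq with common-switch eq
    ... | _ , r , r' = Reaches-right-unique r r'

    alive-left-unique : ∀ {k e e'} → face (e , true) ≡ face (e' , true) → Alive k e → Alive k e' → e ≡ e'
    alive-left-unique eq with common-switch eq
    ... | _ , r , r' = Reaches-left-unique r r'

-- Drawings from bitonic st-orderings

-- Room for one more coordinate is made by doubling all the others.
module Insertion {n : ℕ} (x : Fin n → ℤ) (p v : Fin n) where

  private
    2* : ℤ → ℤ
    2* a = a ℤ.+ a

    2*-< : ∀ {a b} → a <ℤ b → 2* a <ℤ 2* b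
    2*-< lt = ℤₚ.+-mono-< lt lt

    2*-≤ : ∀ {a b} → a ≤ℤ b → 2* a ≤ℤ 2* b
    2*-≤ le = ℤₚ.+-mono-≤ le le

    place : ℤ → Fin n → ℤ
    place c u with u Fin.≟ v
    ... | yes _ = c
    ... | no _  = 2* (x u)

    place-new : ∀ c → place c v ≡ c
    place-new c with v Fin.≟ v
    ... | yes _  = refl
    ... | no v≢v = contradiction refl v≢v

    place-old : ∀ c {u} → u ≢ v → place c u ≡ 2* (x u)
    place-old c {u} u≢v with u Fin.≟ v
    ... | yes u≡v = contradiction u≡v u≢v
    ... | no _    = refl

  Keeps : (Fin n → ℤ) → Set
  Keeps x' = ∀ {u w} → u ≢ v → w ≢ v → (x u <ℤ x w → x' u <ℤ x' w) × (x u ≤ℤ x w → x' u ≤ℤ x' w)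

  private
    keeps : ∀ c → Keeps (place c)
    keeps c u≢v w≢v = (λ lt → subst₂ _<ℤ_ (sym (place-old c u≢v)) (sym (place-old c w≢v)) (2*-< lt)) ,
                      (λ le → subst₂ _≤ℤ_ (sym (place-old c u≢v)) (sym (place-old c w≢v)) (2*-≤ le))

  insert-right : Σ (Fin n → ℤ) λ x' → Keeps x' × (∀ {u} → u ≢ v →
    (x u ≤ℤ x p → x' u <ℤ x' v) × (x p <ℤ x u → x' v <ℤ x' u))
  insert-right = place c , keeps c , λ {u} u≢v →
    (λ le → subst₂ _<ℤ_ (sym (place-old c u≢v)) (sym (place-new c)) (ℤₚ.suc[i]≤j⇒i<j (ℤₚ.suc-mono (2*-≤ le)))) ,
    (λ lt → subst₂ _<ℤ_ (sym (place-new c)) (sym (place-old c u≢v)) (ℤₚ.≤-<-trans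
      (subst (_≤ℤ x u ℤ.+ x p) (ℤₚ.+-assoc (+ 1) (x p) (x p)) (ℤₚ.+-monoˡ-≤ (x p) (ℤₚ.i<j⇒suc[i]≤j lt))) (ℤₚ.+-monoʳ-< (x u) lt)))
    where c = ℤ.suc (2* (x p))

  insert-left : Σ (Fin n → ℤ) λ x' → Keeps x' × (∀ {u} → u ≢ v →
    (x u <ℤ x p → x' u <ℤ x' v) × (x p ≤ℤ x u → x' v <ℤ x' u))
  insert-left = place c , keeps c , λ {u} u≢v →
    (λ lt → subst₂ _<ℤ_ (sym (place-old c u≢v)) (sym (place-new c)) (ℤₚ.<-≤-trans (ℤₚ.+-monoʳ-< (x u) lt)
      (subst (x u ℤ.+ x p ≤ℤ_) (ℤₚ.pred-+ (x p) (x p)) (ℤₚ.+-monoˡ-≤ (x p) (ℤₚ.i<j⇒i≤pred[j] lt))))) ,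
    (λ le → subst₂ _<ℤ_ (sym (place-new c)) (sym (place-old c u≢v)) (ℤₚ.i≤pred[j]⇒i<j (ℤₚ.pred-mono (2*-≤ le))))
    where c = ℤ.pred (2* (x p))

module _ {A : Set} {R : A → A → Set} where

  Linked-++ : ∀ {xs ys} → Linked R xs → Linked R ys → (∀ {a b} → a ∈ xs → b ∈ ys → R a b) → Linked R (xs ++ ys)
  Linked-++ []       lys cross = lys
  Linked-++ {ys = []}    [-] lys cross = [-]
  Linked-++ {ys = _ ∷ _} [-] lys cross = cross (here refl) (here refl) ∷ lys
  Linked-++ (r ∷ lxs) lys cross = r ∷ Linked-++ lxs lys (λ p → cross (there p))

  Linked-++ˡ : ∀ xs {ys} → Linked R (xs ++ ys) → Linked R xs
  Linked-++ˡ []           l       = []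
  Linked-++ˡ (x ∷ [])     l       = [-]
  Linked-++ˡ (x ∷ y ∷ xs) (r ∷ l) = r ∷ Linked-++ˡ (y ∷ xs) l

  Linked-++ʳ : ∀ xs {ys} → Linked R (xs ++ ys) → Linked R ys
  Linked-++ʳ []       l = l
  Linked-++ʳ (x ∷ [])     [-]     = []
  Linked-++ʳ (x ∷ [])     (_ ∷ l) = l
  Linked-++ʳ (x ∷ y ∷ xs) (_ ∷ l) = Linked-++ʳ (y ∷ xs) l

  AllPairs-++⁻ : ∀ xs {ys} → AllPairs R (xs ++ ys) →
    AllPairs R xs × AllPairs R ys × (∀ {a b} → a ∈ xs → b ∈ ys → R a b)
  AllPairs-++⁻ []       ps       = [] , ps , λ ()
  AllPairs-++⁻ (x ∷ xs) (p ∷ ps) with AllPairs-++⁻ xs ps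
  ... | l , r , cross = Allₚ.++⁻ˡ xs p ∷ l , r ,
    λ { (here refl) b∈ → All.lookup (Allₚ.++⁻ʳ xs p) b∈ ; (there a∈) b∈ → cross a∈ b∈ }

  AllPairs-∷ : ∀ {x xs} → AllPairs R (x ∷ xs) → ∀ {a} → a ∈ xs → R x a
  AllPairs-∷ (p ∷ _) a∈ = All.lookup p a∈

  Linked-predecessor : ∀ {xs b} → Linked R xs → b ∈ xs →
    (∃ λ rest → xs ≡ b ∷ rest) ⊎ (∃ λ as → ∃ λ a → ∃ λ bs → xs ≡ as ++ a ∷ b ∷ bs × R a b)
  Linked-predecessor l (here refl) = inj₁ (_ , refl)
  Linked-predecessor {x ∷ _} (r ∷ l) (there p) with Linked-predecessor l p
  ... | inj₁ (rest , refl) = inj₂ ([] , _ , rest , refl , r)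
  ... | inj₂ (as , a , bs , eq , q) = inj₂ (x ∷ as , a , bs , cong (x ∷_) eq , q)

  Linked-before : ∀ as {b bs} → Linked R (as ++ b ∷ bs) →
    as ≡ [] ⊎ (∃ λ as' → ∃ λ a → as ≡ as' ++ [ a ] × R a b)
  Linked-before []            l       = inj₁ refl
  Linked-before (a ∷ [])      (r ∷ l) = inj₂ ([] , a , refl , r)
  Linked-before (a ∷ a' ∷ as) (_ ∷ l) with Linked-before (a' ∷ as) l
  ... | inj₂ (as' , z , eq , r) = inj₂ (a ∷ as' , z , cong (a ∷_) eq , r)

Bitonic-tail : ∀ {G k ks} → Bitonic G (k ∷ ks) → Bitonic G ks
Bitonic-tail {G} bi = go bi refl
  where
  go : ∀ {l k ks} → Bitonic G l → l ≡ k ∷ ks → Bitonic G ks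
  go (peak []       p []       up down)       refl = empty
  go (peak []       p (z ∷ zs) up (_ ∷ down)) refl = peak [] z zs [-] down
  go (peak (y ∷ ys) p zs       up down)       refl = peak ys p zs (Linked.tail up) down

Bitonic-no-valley : {G : EmbeddedDigraph} {A : Set} (f : A → ℕ) → ∀ as {a b c bs} →
  Bitonic G (map f (as ++ a ∷ b ∷ c ∷ bs)) → f b < f a → f b < f c → ⊥
Bitonic-no-valley f (_ ∷ as) bi ba bc = Bitonic-no-valley f as (Bitonic-tail bi) ba bc
Bitonic-no-valley {G} f [] bi ba bc = go bi refl ba bc
  where
  go : ∀ {l a b c bs} → Bitonic G l → l ≡ a ∷ b ∷ c ∷ bs → b < a → b < c → ⊥
  go (peak [] p (_ ∷ _ ∷ _) _ (_ ∷ cb ∷ _)) refl ba bc = <⇒≱ bc (<⇒≤ cb)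
  go (peak (_ ∷ []) p (_ ∷ _) (ab ∷ _) _) refl ba bc = <⇒≱ ba (<⇒≤ ab)
  go (peak (_ ∷ _ ∷ []) p _ (ab ∷ _) _) refl ba bc = <⇒≱ ba (<⇒≤ ab)
  go (peak (_ ∷ _ ∷ _ ∷ _) p _ (ab ∷ _) _) refl ba bc = <⇒≱ ba (<⇒≤ ab)

Unique-replace : {A : Set} (as ms ls : List A) {bs : List A} → Unique (as ++ ms ++ bs) → Unique ls →
  (∀ {a} → a ∈ ls → ¬ (a ∈ as) × ¬ (a ∈ bs)) → Unique (as ++ ls ++ bs)
Unique-replace as ms ls {bs} u ul fresh with AllPairs-++⁻ as u
... | ua , umb , cross with AllPairs-++⁻ ms umb
... | _ , ub , _ = Unique.++⁺ ua (Unique.++⁺ ul ub λ { (p , q) → proj₂ (fresh p) q }) disjoint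
  where
  disjoint : ∀ {a} → ¬ (a ∈ as × a ∈ ls ++ bs)
  disjoint (p , q) with ∈-++⁻ ls q
  ... | inj₁ r = proj₁ (fresh r) p
  ... | inj₂ r = cross p (∈-++⁺ʳ ms r) refl

-- The edges of a plane st-graph across a level

module Sweep (H : EmbeddedDigraph) (stH : IsPlaneSTGraph H) (ordering : HasBitonicSTOrdering H) where
  open EmbeddedDigraph H
  open Orbits H

  π : Fin n → ℕ
  π = proj₁ ordering

  π-inj : Injective _≡_ _≡_ π
  π-inj = proj₁ (proj₂ ordering)

  π-< : ∀ e → π (tl e) < π (hd e)
  π-< = proj₁ (proj₂ (proj₂ ordering))

  private
    succs = proj₂ (proj₂ (proj₂ ordering))

  open Switches H π π-<

  simple : Simple H
  simple = proj₁ (proj₁ stH)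

  private
    planar = proj₂ (proj₂ (proj₂ (proj₁ stH)))
    F = proj₁ planar
    coloring = proj₂ (proj₁ (proj₂ planar))
    st = proj₂ stH

  face : Dart m → Fin F
  face = proj₁ (proj₁ (proj₂ planar))

  face⇒SameFace : ∀ {d d'} → face d ≡ face d' → SameFace d d'
  face⇒SameFace {d} {d'} = proj₁ (proj₂ coloring d d')

  SameFace⇒face : ∀ {d d'} → SameFace d d' → face d ≡ face d'
  SameFace⇒face {d} {d'} = proj₂ (proj₂ coloring d d')

  s t : Fin n
  s = proj₁ st
  t = proj₁ (proj₂ st)

  e₀ : Fin m
  e₀ = proj₁ (proj₂ (proj₂ st))

  tl-e₀ : tl e₀ ≡ s
  tl-e₀ = proj₁ (proj₂ (proj₂ (proj₂ st)))

  hd-e₀ : hd e₀ ≡ t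
  hd-e₀ = proj₁ (proj₂ (proj₂ (proj₂ (proj₂ st))))

  private
    sources = proj₁ (proj₂ (proj₂ (proj₂ (proj₂ (proj₂ st)))))
    sinks   = proj₁ (proj₂ (proj₂ (proj₂ (proj₂ (proj₂ (proj₂ st))))))

  outerFace : Fin F
  outerFace = face outer

  e₀-outer : face (e₀ , false) ≡ outerFace ⊎ face (e₀ , true) ≡ outerFace
  e₀-outer = ⊎-map (sym ∘ SameFace⇒face) (sym ∘ SameFace⇒face) (proj₂ (proj₂ (proj₂ (proj₂ (proj₂ (proj₂ (proj₂ st)))))))

  s-no-in : NoIn H s
  s-no-in = proj₂ (sources s) refl

  t-no-out : NoOut H t
  t-no-out = proj₂ (sinks t) refl

  in-edge : ∀ v → v ≢ s → ∃ λ e → hd e ≡ v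
  in-edge v v≢s with any? (λ e → hd e Fin.≟ v)
  ... | yes p = p
  ... | no ¬p = contradiction (proj₁ (sources v) (λ e eq → ¬p (e , eq))) v≢s

  out-edge : ∀ v → v ≢ t → ∃ λ e → tl e ≡ v
  out-edge v v≢t with any? (λ e → tl e Fin.≟ v)
  ... | yes p = p
  ... | no ¬p = contradiction (proj₁ (sinks v) (λ e eq → ¬p (e , eq))) v≢t

  open Euler F face (proj₁ coloring) SameFace⇒face (proj₂ (proj₂ planar)) s t in-edge out-edge

  s-min : ∀ v → π s ≤ π v
  s-min v = go (suc (π v)) v (n<1+n _)
    where
    go : ∀ k v → π v < k → π s ≤ π v
    go (suc k) v v<k with v Fin.≟ s
    ... | yes refl = ≤-refl
    ... | no v≢s with in-edge v v≢s
    ...   | e , refl = <⇒≤ (≤-<-trans (go k (tl e) (<-≤-trans (π-< e) (s≤s⁻¹ v<k))) (π-< e))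

  t-max : ∀ v → π v ≤ π t
  t-max with argmax (allFin n) ∈-allFin {λ _ → ⊤} (λ _ → yes tt) (λ v → + π v) (t , tt)
  ... | u , _ , max with u Fin.≟ t
  ...   | yes refl = λ v → ℤₚ.drop‿+≤+ (max v tt)
  ...   | no u≢t with out-edge u u≢t
  ...     | e , refl = contradiction (ℤₚ.drop‿+≤+ (max (hd e) tt)) (<⇒≱ (π-< e))

  face-next : ∀ {d d'} → rot (flipD d) ≡ d' → face d ≡ face d'
  face-next p = SameFace⇒face (1 , p)

  outs : Fin n → List (Fin m)
  outs v = map proj₁ (proj₁ (succs v))

  private
    as-darts : ∀ {v L} → All (IsOutDart H v) L → L ≡ map (_, false) (map proj₁ L)
    as-darts [] = refl
    as-darts ((e , refl , _) ∷ ps) = cong (_ ∷_) (as-darts ps)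

    darts-of : ∀ v → proj₁ (succs v) ≡ map (_, false) (outs v)
    darts-of v = as-darts (proj₁ (proj₁ (proj₂ (succs v))))

  outs-tl : ∀ {v e} → e ∈ outs v → tl e ≡ v
  outs-tl {v} e∈ with ∈-map⁻ proj₁ e∈
  ... | d , d∈ , refl with All.lookup (proj₁ (proj₁ (proj₂ (succs v)))) d∈
  ...   | _ , refl , te = te

  ∈-outs : ∀ {v e} → tl e ≡ v → e ∈ outs v
  ∈-outs {v} {e} te = ∈-map⁺ proj₁ (proj₁ (proj₂ (proj₂ (proj₁ (proj₂ (succs v))))) e te)

  outs-unique : ∀ v → Unique (outs v)
  outs-unique v = Unique.map⁻ (subst Unique (darts-of v) (proj₁ (proj₂ (proj₁ (proj₂ (succs v))))))

  outs-linked : ∀ v → Linked (λ a b → rot (b , false) ≡ (a , false)) (outs v)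
  outs-linked v = Linkedₚ.map⁻ (subst (Linked _) (darts-of v) (proj₁ (proj₂ (proj₂ (proj₂ (proj₁ (proj₂ (succs v))))))))

  outs-first : ∀ v {l ls} → outs v ≡ l ∷ ls → proj₂ (rot (l , false)) ≡ true ⊎ SameFace outer (rot (l , false))
  outs-first v eq = proj₂ (proj₂ (proj₂ (proj₂ (proj₁ (proj₂ (succs v)))))) _ _ (trans (darts-of v) (cong (map _) eq))

  outs-bitonic : ∀ v → Bitonic H (map (π ∘ hd) (outs v))
  outs-bitonic v = subst (Bitonic H) (map-∘ (proj₁ (succs v))) (proj₂ (proj₂ (succs v)))

  IsFirst : Fin m → Set
  IsFirst e = ∃ λ ls → outs (tl e) ≡ e ∷ ls

  -- The edge `a` is the left neighbour of `b` at their tail. `not-first` rules out the closing step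
  -- from the leftmost edge back to the rightmost, which occurs around the source.
  record Cons (a b : Fin m) : Set where
    constructor mkCons
    field
      adjacent  : rot (b , false) ≡ (a , false)
      not-first : ¬ IsFirst b
      distinct  : a ≢ b
  open Cons

  private
    second≢first : ∀ as {a b : Fin m} {bs ls} → Unique (as ++ a ∷ b ∷ bs) → as ++ a ∷ b ∷ bs ≢ b ∷ ls
    second≢first []       u refl = AllPairs-∷ u (here refl) refl
    second≢first (_ ∷ as) u refl = AllPairs-∷ u (∈-++⁺ʳ as (there (here refl))) refl

    mkCons-in : ∀ v as {a b bs} → outs v ≡ as ++ a ∷ b ∷ bs → rot (b , false) ≡ (a , false) → Cons a b
    mkCons-in v as {a} {b} {bs} eq r = mkCons r
      (λ { (ls , eq') → second≢first as u (trans (sym eq) (trans (cong outs (sym b-tl)) eq')) })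
      (AllPairs-∷ (proj₁ (proj₂ (AllPairs-++⁻ as u))) (here refl))
      where
      u = subst Unique eq (outs-unique v)
      b-tl : tl b ≡ v
      b-tl = outs-tl (subst (b ∈_) (sym eq) (∈-++⁺ʳ as (there (here refl))))

  first-or-Cons : ∀ e → IsFirst e ⊎ ∃ λ a → Cons a e
  first-or-Cons e with Linked-predecessor (outs-linked (tl e)) (∈-outs refl)
  ... | inj₁ first = inj₁ first
  ... | inj₂ (as , a , bs , eq , r) = inj₂ (a , mkCons-in (tl e) as eq r)

  outs-Cons : ∀ v → Linked Cons (outs v)
  outs-Cons v = go [] (outs v) refl (outs-linked v)
    where
    go : ∀ as xs → outs v ≡ as ++ xs → Linked (λ a b → rot (b , false) ≡ (a , false)) xs → Linked Cons xs
    go as []           eq l       = []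
    go as (x ∷ [])     eq l       = [-]
    go as (x ∷ y ∷ xs) eq (r ∷ l) = mkCons-in v as eq r ∷ go (as ++ [ x ]) (y ∷ xs) (trans eq (sym (++-assoc as [ x ] (y ∷ xs)))) l

  Cons-tl : ∀ {a b} → Cons a b → tl a ≡ tl b
  Cons-tl {a} {b} c = rot⇒same-vertex {b , false} {a , false} (adjacent c)

  Cons-face : ∀ {a b} → Cons a b → face (b , true) ≡ face (a , false)
  Cons-face c = face-next (adjacent c)

  first-unique : ∀ {e e'} → tl e ≡ tl e' → IsFirst e → IsFirst e' → e ≡ e'
  first-unique te (ls , eq) (ls' , eq') with trans (sym eq) (trans (cong outs te) eq')
  ... | refl = refl

  -- The only form in which bitonicity enters the placement.
  no-valley : ∀ {a b c} → Cons a b → Cons b c → π (hd b) < π (hd a) → π (hd b) < π (hd c) → ⊥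
  no-valley {a} {b} {c} ab bc ba<  with Linked-predecessor (outs-linked (tl c)) (∈-outs refl)
  ... | inj₁ first = contradiction first (not-first bc)
  ... | inj₂ (as , b' , bs , eq , r) with same-edge r (adjacent bc)
  ... | refl with Linked-before as (subst (Linked _) eq (outs-linked (tl c)))
  ...   | inj₁ refl = contradiction (_ , trans (cong outs (Cons-tl bc)) eq) (not-first ab)
  ...   | inj₂ (as' , a' , refl , r') with same-edge r' (adjacent ab)
  ...     | refl = Bitonic-no-valley (π ∘ hd) as'
              (subst (λ l → Bitonic H (map (π ∘ hd) l)) (trans eq (++-assoc as' [ a ] (b ∷ c ∷ bs))) (outs-bitonic (tl c))) ba<

  first-at : ∀ v {e} → tl e ≡ v → ∃ λ l → tl l ≡ v × IsFirst l
  first-at v {e} te with outs v in eq | ∈-outs te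
  ... | l ∷ ls | _ = l , l-tl , ls , trans (cong outs l-tl) eq
    where
    l-tl : tl l ≡ v
    l-tl = outs-tl (subst (l ∈_) (sym eq) (here refl))

  s-first : ∃ λ l → tl l ≡ s × IsFirst l
  s-first = first-at s tl-e₀

  private
    l₁ = proj₁ s-first

  -- No edge enters `s`, so the condition on the leftmost successor leaves only the outer face: the
  -- closing angle at `s` is a source switch of it.
  s-outer-switch : ∃ λ w → rot (l₁ , false) ≡ (w , false) × face (w , false) ≡ outerFace
  s-outer-switch with rot (l₁ , false) in eq | outs-first (tl l₁) (proj₂ (proj₂ (proj₂ s-first)))
  ... | w , true  | _ = contradiction (trans (rot⇒same-vertex {l₁ , false} eq) (proj₁ (proj₂ s-first))) (s-no-in w)
  ... | w , false | inj₂ sf = w , refl , sym (SameFace⇒face sf)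

  -- The outer face has its only source switch in the closing angle at `s`, so the switch between
  -- two neighbours belongs to another face.
  Cons-not-outer : ∀ {a b} → Cons a b → face (b , true) ≢ outerFace
  Cons-not-outer {a} {b} c eq with s-outer-switch
  ... | w , r , wf with switch-unique (follows-out⇒IsSwitch (adjacent c)) (follows-out⇒IsSwitch r)
                          (trans (sym (Cons-face c)) (trans eq (sym wf)))
  ...   | refl with rot-injective (trans (adjacent c) (sym r))
  ...     | refl = not-first c (proj₂ (proj₂ s-first))

  -- Path p es q: the edges es, from left to right, are separated by faces, with p to the left
  -- of the first one and q to the right of the last one.
  data Path : Fin F → List (Fin m) → Fin F → Set where
    []  : ∀ {p} → Path p [] p
    _∷_ : ∀ {p q e es} → face (e , true) ≡ p → Path (face (e , false)) es q → Path p (e ∷ es) q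

  Path-++ : ∀ {p q r as bs} → Path p as q → Path q bs r → Path p (as ++ bs) r
  Path-++ []       P = P
  Path-++ (f ∷ P') P = f ∷ Path-++ P' P

  Path-split : ∀ as {p r bs} → Path p (as ++ bs) r → ∃ λ q → Path p as q × Path q bs r
  Path-split []       P = _ , [] , P
  Path-split (a ∷ as) (f ∷ P) with Path-split as P
  ... | q , P₁ , P₂ = q , f ∷ P₁ , P₂

  Path-[] : ∀ {p q} → Path p [] q → p ≡ q
  Path-[] [] = refl

  Path-∷ : ∀ {p q e es} → Path p (e ∷ es) q → face (e , true) ≡ p × Path (face (e , false)) es q
  Path-∷ (f ∷ P) = f , P

  Path-predecessor : ∀ {p q xs} {Q : Fin m → Fin m → Set} → Path p xs q → AllPairs Q xs → ∀ {b} → b ∈ xs →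
    (∃ λ rest → xs ≡ b ∷ rest × face (b , true) ≡ p) ⊎
    (∃ λ z → z ∈ xs × face (z , false) ≡ face (b , true) × Q z b)
  Path-predecessor (f ∷ P) _ (here refl) = inj₁ (_ , refl , f)
  Path-predecessor {xs = z ∷ _} (f ∷ P) (q ∷ qs) (there b∈) with Path-predecessor P qs b∈
  ... | inj₁ (_ , _ , eq) = inj₂ (z , here refl , sym eq , All.lookup q b∈)
  ... | inj₂ (z' , z'∈ , eq , q') = inj₂ (z' , there z'∈ , eq , q')

  outs-Path : ∀ {l ls} → Linked (λ a b → rot (b , false) ≡ (a , false)) (l ∷ ls) →
    ∃ λ z → Path (face (l , true)) (l ∷ ls) (face (z , false)) ×
      (∀ {o} → o ∈ l ∷ ls → o ≡ z ⊎ ∃ λ b → b ∈ ls × rot (b , false) ≡ (o , false))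
  outs-Path {l} [-] = l , refl ∷ [] , λ { (here eq) → inj₁ eq }
  outs-Path {l} {l' ∷ ls} (r ∷ link) with outs-Path link
  ... | z , P , last = z , refl ∷ subst (λ q → Path q (l' ∷ ls) (face (z , false))) (face-next r) P ,
        λ { (here refl) → inj₂ (l' , here refl , r)
          ; (there o∈) → ⊎-map id (λ { (b , b∈ , q) → b , there b∈ , q }) (last o∈) }

  outs-Path-from : ∀ {l} → IsFirst l → ∃ λ z → Path (face (l , true)) (outs (tl l)) (face (z , false)) ×
      (∀ {o} → tl o ≡ tl l → o ≡ z ⊎ ∃ λ b → tl b ≡ tl l × b ≢ l × rot (b , false) ≡ (o , false))
  outs-Path-from {l} (ls , eq) with outs-Path (subst (Linked _) eq (outs-linked (tl l)))
  ... | z , P , last = z , subst (λ os → Path _ os _) (sym eq) P , λ {o} to →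
    ⊎-map id (λ { (b , b∈ , r) → b , outs-tl (subst (b ∈_) (sym eq) (there b∈)) ,
                  (λ b≡l → AllPairs-∷ (subst Unique eq (outs-unique (tl l))) b∈ (sym b≡l)) , r })
      (last (subst (o ∈_) eq (∈-outs to)))

  -- The incoming edges after `i`, counter-clockwise and hence from left to right, up to the
  -- outgoing edge `o` that ends the run.
  data InChain : Fin m → List (Fin m) → Fin m → Set where
    exit : ∀ {i o} → rot (i , true) ≡ (o , false) → InChain i [] o
    step : ∀ {i i' I o} → rot (i , true) ≡ (i' , true) → InChain i' I o → InChain i (i' ∷ I) o

  collect : ∀ k i → proj₂ (iter rot k (rot (i , true))) ≡ false → ∃ λ I → ∃ λ o → InChain i I o
  collect k i end with rot (i , true) in eq
  collect k i end | o , false = [] , o , exit eq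
  collect (suc k) i end | i' , true with collect k i' (trans (cong proj₂ (iter-suc rot k (i' , true))) end)
  ... | I , o , c = i' ∷ I , o , step eq c

  InChain-hd : ∀ {i I o} → InChain i I o → ∀ {e} → e ∈ i ∷ I → hd e ≡ hd i
  InChain-hd c (here refl) = refl
  InChain-hd {i} (step {i' = i'} p c) (there e∈) = trans (InChain-hd c e∈) (rot⇒same-vertex {i , true} {i' , true} p)

  InChain-exit : ∀ {i I o} → InChain i I o → ∃ λ e → rot (e , true) ≡ (o , false) × hd e ≡ hd i
  InChain-exit {i} (exit p) = i , p , refl
  InChain-exit {i} (step {i' = i'} p c) with InChain-exit c
  ... | e , q , h = e , q , trans h (rot⇒same-vertex {i , true} {i' , true} p)

  InChain-closed : ∀ {i I o} → InChain i I o → ∀ {e} → e ∈ i ∷ I →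
    (∃ λ e' → e' ∈ i ∷ I × rot (e , true) ≡ (e' , true)) ⊎ rot (e , true) ≡ (o , false)
  InChain-closed (exit p) (here refl) = inj₂ p
  InChain-closed (step {i' = i'} p c) (here refl) = inj₁ (i' , there (here refl) , p)
  InChain-closed (step p c) (there e∈) with InChain-closed c e∈
  ... | inj₁ (e' , e'∈ , q) = inj₁ (e' , there e'∈ , q)
  ... | inj₂ q = inj₂ q

  InChain-Path : ∀ {i I o} → InChain i I o → Path (face (i , true)) (i ∷ I) (face (o , false))
  InChain-Path {i} {o = o} (exit p) = refl ∷ subst (λ q → Path q [] (face (o , false))) (sym (face-next {i , false} p)) []
  InChain-Path {i} {o = o} (step {i' = i'} {I = I} p c) =
    refl ∷ subst (λ q → Path q (i' ∷ I) (face (o , false))) (sym (face-next {i , false} p)) (InChain-Path c)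

  -- The faces `p` and `q` flank the block of incoming edges as well as `outs v`, so that replacing
  -- the one by the other turns the cut below `v` into the cut above it.
  record Split (v : Fin n) (C : List (Fin m)) : Set where
    field
      {A B I}   : List (Fin m)
      {i}       : Fin m
      {p q}     : Fin F
      C-split   : C ≡ A ++ (i ∷ I) ++ B
      all-in    : ∀ {e} → hd e ≡ v → e ∈ i ∷ I
      in-hd     : ∀ {e} → e ∈ i ∷ I → hd e ≡ v
      path-A    : Path outerFace A p
      path-I    : Path p (i ∷ I) q
      path-B    : Path q B outerFace
      path-outs : Path p (outs v) q
      first-out : ∀ {o} → tl o ≡ v → IsFirst o → rot (o , false) ≡ (i , true)
      outer-in  : v ≡ t → face (i , true) ≡ outerFace

  alive-in : ∀ {e} → Alive (π (hd e)) e
  alive-in {e} = π-< e , ≤-refl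

  e₀-alive : ∀ {v} → v ≢ s → Alive (π v) e₀
  e₀-alive {v} v≢s = subst (_< π v) (cong π (sym tl-e₀)) (ℕ.≤∧≢⇒< (s-min v) (λ eq → v≢s (sym (π-inj eq)))) ,
                     subst (π v ≤_) (cong π (sym hd-e₀)) (t-max v)

  module _ {v : Fin n} (v≢s : v ≢ s) {C : List (Fin m)} (C-alive : ∀ {e} → e ∈ C → Alive (π v) e)
    (alive-C : ∀ {e} → Alive (π v) e → e ∈ C) (path : Path outerFace C outerFace) where

    private
      alive-v : ∀ {e} → hd e ≡ v → Alive (π v) e
      alive-v refl = alive-in

    -- The edge e₀ is still alive, so two incoming edges that are consecutive around v do not
    -- enclose the outer face.
    match : v ≢ t → ∀ {i I o R} → InChain i I o → hd i ≡ v → Path (face (i , false)) R outerFace →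
      (∀ {e} → e ∈ R → Alive (π v) e) → ∃ λ B → R ≡ I ++ B × Path (face (o , false)) B outerFace
    match v≢t {i} {R = R} (exit r) hi P alive = R , refl , subst (λ q → Path q R outerFace) (face-next {i , false} r) P
    match v≢t {i} {R = []} (step {i' = i'} r c) hi P alive = ⊥-elim (absurd e₀-outer)
      where
      hi' : hd i' ≡ v
      hi' = trans (rot⇒same-vertex {i , true} {i' , true} r) hi
      absurd : ¬ (face (e₀ , false) ≡ outerFace ⊎ face (e₀ , true) ≡ outerFace)
      ¬e₀ : ∀ {e} → hd e ≡ v → e₀ ≢ e
      ¬e₀ he eq = v≢t (trans (sym he) (trans (cong hd (sym eq)) hd-e₀))
      absurd (inj₁ eq) = ¬e₀ hi (alive-right-unique (trans eq (sym (Path-[] P))) (e₀-alive v≢s) (alive-v hi))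
      absurd (inj₂ eq) = ¬e₀ hi' (alive-left-unique (trans eq (trans (sym (Path-[] P)) (face-next {i , false} r)))
        (e₀-alive v≢s) (alive-v hi'))
    match v≢t {i} {R = b ∷ R} (step {i' = i'} r c) hi P alive =
      proj₁ rest , cong₂ _∷_ b≡i' (proj₁ (proj₂ rest)) , proj₂ (proj₂ rest)
      where
      hi' : hd i' ≡ v
      hi' = trans (rot⇒same-vertex {i , true} {i' , true} r) hi
      b≡i' : b ≡ i'
      b≡i' = alive-left-unique (trans (proj₁ (Path-∷ P)) (face-next {i , false} r)) (alive (here refl)) (alive-v hi')
      rest = match v≢t c hi' (subst (λ u → Path (face (u , false)) R outerFace) b≡i' (proj₂ (Path-∷ P))) (alive ∘ there)

    -- At `t` the whole cut comes in. Elsewhere the block starts at the incoming edge right after an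
    -- outgoing one. Consecutive edges share a face both in the cut and around `v`, so the two
    -- sequences can be matched edge by edge.
    split : Split v C
    split with v Fin.≟ t
    split | yes refl = split-t C-alive alive-C path
      where
      no-outs : outs t ≡ []
      no-outs with outs t in eq
      ... | []     = refl
      ... | o ∷ _ = contradiction (outs-tl (subst (o ∈_) (sym eq) (here refl))) (t-no-out o)
      split-t : ∀ {C} → (∀ {e} → e ∈ C → Alive (π t) e) → (∀ {e} → Alive (π t) e → e ∈ C) →
        Path outerFace C outerFace → Split t C
      split-t {[]} _ alive-C' _ = contradiction (alive-C' (e₀-alive v≢s)) λ ()
      split-t {i ∷ I} C-alive' alive-C' P = record
        { A = [] ; B = [] ; C-split = cong (i ∷_) (sym (++-identityʳ I))
        ; all-in = λ { refl → alive-C' alive-in }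
        ; in-hd = λ {e} e∈ → π-inj (≤-antisym (t-max (hd e)) (proj₂ (C-alive' e∈)))
        ; path-A = [] ; path-I = P ; path-B = []
        ; path-outs = subst (λ os → Path outerFace os outerFace) (sym no-outs) []
        ; first-out = λ {o} to _ → contradiction to (t-no-out o)
        ; outer-in = λ _ → proj₁ (Path-∷ P) }
    split | no v≢t with in-edge v v≢s | out-edge v v≢t
    ... | g , hg | h , th with rot-cyc (h , false) (g , true) (trans th (sym hg))
    ... | k , eq with transition false k {h , false} refl (cong proj₂ eq)
    ... | o , i , oi , iv with rot-cyc (i , true) (h , false) iv
    ... | suc j , eq' with collect j i (trans (cong proj₂ (iter-suc rot j (i , true))) (cong proj₂ eq'))
    ... | I , x , c with ∈-∃++ (alive-C (alive-v (trans iv th)))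
    ... | A , R , refl with Path-split A path
    ... | p , PA , PR with match v≢t c (trans iv th) (proj₂ (Path-∷ PR)) (λ e∈ → C-alive (∈-++⁺ʳ A (there e∈)))
    ... | B , refl , PB = record
      { C-split = refl ; all-in = all-in ; in-hd = λ e∈ → trans (InChain-hd c e∈) hi
      ; path-A = subst (Path outerFace A) (sym (proj₁ (Path-∷ PR))) PA ; path-I = InChain-Path c ; path-B = PB
      ; path-outs = path-outs
      ; first-out = first-out ; outer-in = λ v≡t → contradiction v≡t v≢t }
      where
      hi : hd i ≡ v
      hi = trans iv th
      to : tl o ≡ v
      to = trans (sym (rot⇒same-vertex {o , false} {i , true} oi)) hi
      o-first : IsFirst o
      o-first with first-or-Cons o
      ... | inj₁ first    = first
      ... | inj₂ (a , oa) = ⊥-elim (ends-differ oi (Cons.adjacent oa))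
      first-out : ∀ {o'} → tl o' ≡ v → IsFirst o' → rot (o' , false) ≡ (i , true)
      first-out to' first with first-unique (trans to' (sym to)) first o-first
      ... | refl = oi
      path-outs : Path (face (i , true)) (outs v) (face (x , false))
      path-outs with outs-Path-from o-first | InChain-exit c
      ... | z , P , last | e , ex , he with last {x} (trans (rot⇒same-vertex {e , true} {x , false} ex) (trans he (trans hi (sym to))))
      ...   | inj₁ refl = subst₂ (λ p' os → Path p' os (face (x , false))) (face-next oi) (cong outs to) P
      ...   | inj₂ (b , _ , _ , bx) = ⊥-elim (preceding-ends-differ ex bx)
      -- This set of darts contains `(i , true)` and is closed under `rot`, so it contains all darts
      -- of `v`: no incoming edge escapes the block.
      Reached : Dart m → Set
      Reached (e , true)  = e ∈ i ∷ I
      Reached (e , false) = tl e ≡ v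
      reached-step : ∀ d → Reached d → Reached (rot d)
      reached-step (e , true) e∈ with InChain-closed c e∈
      ... | inj₁ (e' , e'∈ , r) = subst Reached (sym r) e'∈
      ... | inj₂ r = subst Reached (sym r) (trans (rot⇒same-vertex {e , true} {x , false} r) (trans (InChain-hd c e∈) hi))
      reached-step (e , false) te with first-or-Cons e
      ... | inj₁ first   = subst Reached (sym (first-out te first)) (here refl)
      ... | inj₂ (a , l) = subst Reached (sym (Cons.adjacent l)) (trans (Cons-tl l) te)
      reached : ∀ k → Reached (iter rot k (i , true))
      reached zero    = here refl
      reached (suc k) = reached-step _ (reached k)
      all-in : ∀ {e} → hd e ≡ v → e ∈ i ∷ I
      all-in {e} he with rot-cyc (i , true) (e , true) (trans hi (sym he))
      ... | k , eq = subst Reached eq (reached k)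

Linked-map∈ : {A : Set} {R R' : A → A → Set} {xs : List A} →
  (∀ {a b} → a ∈ xs → b ∈ xs → R a b → R' a b) → Linked R xs → Linked R' xs
Linked-map∈ f []      = []
Linked-map∈ f [-]     = [-]
Linked-map∈ f (r ∷ l) = f (here refl) (there (here refl)) r ∷ Linked-map∈ (λ a∈ b∈ → f (there a∈) (there b∈)) l

-- Placing the vertices level by level

module Placement (H : EmbeddedDigraph) (stH : IsPlaneSTGraph H) (ordering : HasBitonicSTOrdering H) where
  open EmbeddedDigraph H
  open Orbits H
  open Sweep H stH ordering
  open Switches H π π-<
  open Euler _ face (proj₁ (proj₂ (proj₁ (proj₂ (proj₂ (proj₂ (proj₂ (proj₁ stH)))))))) SameFace⇒face
    (proj₂ (proj₂ (proj₂ (proj₂ (proj₂ (proj₁ stH)))))) s t in-edge out-edge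

  -- Edges with a common tail have their vertical segments in one column, so their order is taken
  -- from the rotation instead of `x`.
  data LeftOf (x : Fin n → ℤ) (a b : Fin m) : Set where
    apart   : x (tl a) <ℤ x (tl b) → LeftOf x a b
    sibling : Cons a b → LeftOf x a b

  LeftOf⇒≤ : ∀ {x a b} → LeftOf x a b → x (tl a) ≤ℤ x (tl b)
  LeftOf⇒≤     (apart lt)  = ℤₚ.<⇒≤ lt
  LeftOf⇒≤ {x} (sibling c) = ℤₚ.≤-reflexive (cong x (Cons-tl c))

  -- Either `i` alone comes from the left and all other edges from the right, or `i` comes from the
  -- right and is the only incoming edge.
  Incoming : (Fin n → ℤ) → Fin n → Fin m → Set
  Incoming x v i = (x (tl i) <ℤ x v × (∀ {e} → hd e ≡ v → e ≢ i → x v <ℤ x (tl e)))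
                 ⊎ (x v <ℤ x (tl i) × (∀ {e} → hd e ≡ v → e ≡ i))

  record InOrder (x : Fin n → ℤ) (v : Fin n) : Set where
    field
      i         : Fin m
      i-hd      : hd i ≡ v
      first-out : ∀ {o} → tl o ≡ v → IsFirst o → rot (o , false) ≡ (i , true)
      outer-in  : v ≡ t → face (i , true) ≡ outerFace
      ascending : ∀ {e e'} → hd e ≡ v → rot (e , true) ≡ (e' , true) → e' ≢ i → x (tl e) <ℤ x (tl e')
      side      : Incoming x v i

  Obstructs : (Fin n → ℤ) → (e f : Fin m) → Set
  Obstructs x e f = Drawing.StrictlyBetween H x x (x (tl f)) (x (hd f)) (x (tl e))

  -- The state after the vertices v with π v < k have been placed.
  record State (k : ℕ) : Set where
    field
      cut      : List (Fin m)
      x        : Fin n → ℤ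
      C-alive  : ∀ {e} → e ∈ cut → Alive k e
      alive-C  : ∀ {e} → Alive k e → e ∈ cut
      unique   : Unique cut
      path     : Path outerFace cut outerFace
      sorted   : Linked (LeftOf x) cut
      x-inj    : ∀ {u v} → π u < k → π v < k → x u ≡ x v → u ≡ v
      no-cross : ∀ {e f} → π (hd f) < k → π (tl e) < π (hd f) → π (hd f) < π (hd e) → ¬ Obstructs x e f
      -- From left to right the keys require left bends with rising heads and then right bends with
      -- falling heads. So the one of two neighbours with the lower head has to bend away from the
      -- other.
      bend-left  : ∀ {a b} → Cons a b → π (hd a) < π (hd b) → π (hd a) < k → x (hd a) <ℤ x (tl a)
      bend-right : ∀ {a b} → Cons a b → π (hd b) < π (hd a) → π (hd b) < k → x (tl b) <ℤ x (hd b)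
      incoming : ∀ {v} → π v < k → v ≢ s → InOrder x v

  initial : State 0
  initial = record
    { cut = [] ; x = λ _ → + 0 ; C-alive = λ () ; alive-C = λ () ; unique = [] ; path = [] ; sorted = []
    ; x-inj = λ () ; no-cross = λ () ; bend-left = λ _ _ () ; bend-right = λ _ _ () ; incoming = λ () }

  -- The values of `π` may have gaps, and at a gap no edge starts or ends.
  idle : ∀ {k} → (∀ v → π v ≢ k) → State k → State (suc k)
  idle {k} none S = record
    { cut = cut ; x = x
    ; C-alive = λ e∈ → ℕ.m<n⇒m<1+n (proj₁ (C-alive e∈)) , ℕ.≤∧≢⇒< (proj₂ (C-alive e∈)) (none _ ∘ sym)
    ; alive-C = λ al → alive-C (below (proj₁ al) , <⇒≤ (proj₂ al))
    ; unique = unique ; path = path ; sorted = sorted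
    ; x-inj = λ p q → x-inj (below p) (below q)
    ; no-cross = λ p → no-cross (below p)
    ; bend-left = λ c lt p → bend-left c lt (below p)
    ; bend-right = λ c lt p → bend-right c lt (below p)
    ; incoming = λ p → incoming (below p) }
    where
    open State S
    below : ∀ {v} → π v < suc k → π v < k
    below {v} p = ℕ.≤∧≢⇒< (s≤s⁻¹ p) (none v)

  start : ∀ {k} → π s ≡ k → State k → State (suc k)
  start refl S = record
    { cut = outs s ; x = State.x S
    ; C-alive = λ {e} e∈ → s≤s (≤-reflexive (cong π (outs-tl e∈))) , subst (λ u → π u < π (hd e)) (outs-tl e∈) (π-< e)
    ; alive-C = λ al → ∈-outs (only (proj₁ al))
    ; unique = outs-unique s
    ; path = outer-path
    ; sorted = Linked.map sibling (outs-Cons s)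
    ; x-inj = λ p q _ → trans (only p) (sym (only q))
    ; no-cross = λ {e} {f} p → contradiction (only p) (s-no-in f)
    ; bend-left = λ {a} _ _ p → contradiction (only p) (s-no-in a)
    ; bend-right = λ {_} {b} _ _ p → contradiction (only p) (s-no-in b)
    ; incoming = λ p v≢s → contradiction (only p) v≢s }
    where
    only : ∀ {v} → π v < suc (π s) → v ≡ s
    only {v} p = π-inj (≤-antisym (s≤s⁻¹ p) (s-min v))
    outer-path : Path outerFace (outs s) outerFace
    outer-path with s-outer-switch
    ... | w , r , wf with s-first
    ...   | l , ls , first with outs-Path-from first
    ...     | z , P , last with last {w} (rot⇒same-vertex {l , false} {w , false} r)
    ...       | inj₁ refl = subst (λ v → Path outerFace (outs v) outerFace) ls
                (subst₂ (λ p q → Path p (outs (tl l)) q) (trans (face-next r) wf) wf P)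
    ...       | inj₂ (b , _ , b≢l , rb) = contradiction (cong proj₁ (rot-injective (trans rb (sym r)))) b≢l

  module Step {v : Fin n} (S : State (π v)) (sp : Split v (State.cut S)) where
    open State S
    private k = π v
    open Split sp

    Order : Fin m → Fin m → Set
    Order a b = x (tl a) ≤ℤ x (tl b) × a ≢ b

    private
      ordered : AllPairs Order (A ++ (i ∷ I) ++ B)
      ordered = subst (AllPairs Order) C-split (AllPairs.zip
        (Linkedₚ.Linked⇒AllPairs (λ {a} {b} {c} → ℤₚ.≤-trans {x (tl a)} {x (tl b)} {x (tl c)}) (Linked.map LeftOf⇒≤ sorted) , unique))

      ordered-IB = proj₁ (proj₂ (AllPairs-++⁻ A ordered))
      ordered-I  = proj₁ (AllPairs-++⁻ (i ∷ I) ordered-IB)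

      A<IB : ∀ {a b} → a ∈ A → b ∈ (i ∷ I) ++ B → Order a b
      A<IB = proj₂ (proj₂ (AllPairs-++⁻ A ordered))

      I<B : ∀ {a b} → a ∈ i ∷ I → b ∈ B → Order a b
      I<B = proj₂ (proj₂ (AllPairs-++⁻ (i ∷ I) ordered-IB))

      ∈A : ∀ {e} → e ∈ A → e ∈ cut
      ∈A e∈ = subst (_ ∈_) (sym C-split) (∈-++⁺ˡ e∈)

      ∈I : ∀ {e} → e ∈ i ∷ I → e ∈ cut
      ∈I e∈ = subst (_ ∈_) (sym C-split) (∈-++⁺ʳ A (∈-++⁺ˡ e∈))

      ∈B : ∀ {e} → e ∈ B → e ∈ cut
      ∈B e∈ = subst (_ ∈_) (sym C-split) (∈-++⁺ʳ A (∈-++⁺ʳ (i ∷ I) e∈))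

      hd-A : ∀ {e} → e ∈ A → hd e ≢ v
      hd-A e∈ he = proj₂ (A<IB e∈ (∈-++⁺ˡ (all-in he))) refl

      hd-B : ∀ {e} → e ∈ B → hd e ≢ v
      hd-B e∈ he = proj₂ (I<B (all-in he) e∈) refl

      old : ∀ {u} → π u < k → u ≢ v
      old lt refl = <-irrefl refl lt

      tl-old : ∀ {e} → e ∈ cut → tl e ≢ v
      tl-old e∈ = old (proj₁ (C-alive e∈))

      hd-i : hd i ≡ v
      hd-i = in-hd (here refl)

      tl<v : ∀ {e} → hd e ≡ v → π (tl e) < k
      tl<v refl = π-< _

      strict-in : ∀ {a b} → hd a ≡ v → hd b ≡ v → Order a b → x (tl a) <ℤ x (tl b)
      strict-in ha hb (le , a≢b) = ℤₚ.≤∧≢⇒< le λ eq →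
        a≢b (simple _ _ (x-inj (tl<v ha) (tl<v hb) eq) (trans ha (sym hb)))

      -- v is placed just to the right of the tail of its leftmost incoming edge i, or just to the left if
      -- the right neighbour of i at that tail is still alive; then i is the only incoming edge.
      record Placed : Set where
        field
          x'      : Fin n → ℤ
          keeps   : Insertion.Keeps x (tl i) v x'
          apart-v : ∀ {u} → u ≢ v → x' u <ℤ x' v ⊎ x' v <ℤ x' u
          right-of-A : ∀ {a} → a ∈ A → x' (tl a) <ℤ x' v
          left-of-B  : ∀ {b} → b ∈ B → x' v <ℤ x' (tl b)
          left-of-I  : ∀ {j} → j ∈ I → x' v <ℤ x' (tl j)
          side    : x' (tl i) <ℤ x' v ⊎ (x' v <ℤ x' (tl i) × I ≡ [] × ∃ λ b → Cons i b × k < π (hd b))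

      place-right : (∀ {b} → b ∈ B → x (tl i) <ℤ x (tl b)) → Placed
      place-right i<B with Insertion.insert-right x (tl i) v
      ... | x' , keeps , new = record
        { x' = x' ; keeps = keeps
        ; apart-v = λ {u} u≢v → ⊎-map (proj₁ (new u≢v)) (proj₂ (new u≢v)) (≤-or-< u)
        ; right-of-A = λ a∈ → proj₁ (new (tl-old (∈A a∈))) (proj₁ (A<IB a∈ (here refl)))
        ; left-of-B = λ b∈ → proj₂ (new (tl-old (∈B b∈))) (i<B b∈)
        ; left-of-I = λ j∈ → proj₂ (new (tl-old (∈I (there j∈))))
            (strict-in hd-i (in-hd (there j∈)) (AllPairs-∷ ordered-I j∈))
        ; side = inj₁ (proj₁ (new (tl-old (∈I (here refl)))) ℤₚ.≤-refl) }
        where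
        ≤-or-< : ∀ u → x u ≤ℤ x (tl i) ⊎ x (tl i) <ℤ x u
        ≤-or-< u with x (tl i) ℤₚ.<? x u
        ... | yes lt = inj₂ lt
        ... | no ¬lt = inj₁ (ℤₚ.≮⇒≥ ¬lt)

      place-left : (∀ {a} → a ∈ A → x (tl a) <ℤ x (tl i)) → I ≡ [] → (∃ λ b → Cons i b × k < π (hd b)) → Placed
      place-left A<i I≡[] next with Insertion.insert-left x (tl i) v
      ... | x' , keeps , new = record
        { x' = x' ; keeps = keeps
        ; apart-v = λ {u} u≢v → ⊎-map (proj₁ (new u≢v)) (proj₂ (new u≢v)) (<-or-≤ u)
        ; right-of-A = λ a∈ → proj₁ (new (tl-old (∈A a∈))) (A<i a∈)
        ; left-of-B = λ b∈ → proj₂ (new (tl-old (∈B b∈))) (proj₁ (I<B (here refl) b∈))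
        ; left-of-I = λ {j} j∈ → contradiction (subst (j ∈_) I≡[] j∈) λ ()
        ; side = inj₂ (proj₂ (new (tl-old (∈I (here refl)))) ℤₚ.≤-refl , I≡[] , next) }
        where
        <-or-≤ : ∀ u → x u <ℤ x (tl i) ⊎ x (tl i) ≤ℤ x u
        <-or-≤ u with x u ℤₚ.<? x (tl i)
        ... | yes lt = inj₁ lt
        ... | no ¬lt = inj₂ (ℤₚ.≮⇒≥ ¬lt)

      before-strict : ∀ as {bs} → Linked (LeftOf x) (as ++ i ∷ bs) → (∀ {a} → a ∈ as → ¬ Cons a i) →
        ∀ {a} → a ∈ as → x (tl a) <ℤ x (tl i)
      before-strict (a ∷ []) (apart lt ∷ _)  none (here refl) = lt
      before-strict (a ∷ []) (sibling c ∷ _) none (here refl) = contradiction c (none (here refl))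
      before-strict (a ∷ a' ∷ as) (l ∷ ls) none (here refl) =
        ℤₚ.≤-<-trans (LeftOf⇒≤ l) (before-strict (a' ∷ as) ls (none ∘ there) (here refl))
      before-strict (a ∷ a' ∷ as) (l ∷ ls) none (there a∈) = before-strict (a' ∷ as) ls (none ∘ there) a∈

      later : ∀ {e} → e ∈ cut → hd e ≢ v → k < π (hd e)
      later e∈ h≢v = ℕ.≤∧≢⇒< (proj₂ (C-alive e∈)) (λ eq → h≢v (sym (π-inj eq)))

      empty-or-∈ : (xs : List (Fin m)) → xs ≡ [] ⊎ ∃ λ y → ∃ λ ys → xs ≡ y ∷ ys
      empty-or-∈ []       = inj₁ refl
      empty-or-∈ (y ∷ ys) = inj₂ (y , ys , refl)

      placed : Placed
      placed with empty-or-∈ I | empty-or-∈ B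
      -- A second incoming edge has a different tail because the graph is simple; it is strictly to
      -- the right, and nothing in `B` lies further left.
      ... | inj₂ (j , _ , eqI) | _ = place-right λ b∈ → ℤₚ.<-≤-trans
          (strict-in hd-i (in-hd (there j∈)) (AllPairs-∷ ordered-I j∈)) (proj₁ (I<B (there j∈) b∈))
        where
        j∈ : j ∈ I
        j∈ = subst (j ∈_) (sym eqI) (here refl)
      ... | inj₁ eqI | inj₁ eqB = place-right λ {b} b∈ → contradiction (subst (b ∈_) eqB b∈) λ ()
      ... | inj₁ eqI | inj₂ (b , B' , eqB) with Linked.head (subst₂ (λ I' B'' → Linked (LeftOf x) (i ∷ I' ++ B'')) eqI eqB
                                                 (Linked-++ʳ A (subst (Linked (LeftOf x)) C-split sorted)))
      ...   | apart lt = place-right λ b∈ → i<B (subst (_ ∈_) eqB b∈)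
        where
        i<B : ∀ {b'} → b' ∈ b ∷ B' → x (tl i) <ℤ x (tl b')
        i<B (here refl) = lt
        i<B (there b'∈) = ℤₚ.<-≤-trans lt
          (proj₁ (AllPairs-∷ (subst (AllPairs Order) eqB (proj₁ (proj₂ (AllPairs-++⁻ (i ∷ I) ordered-IB)))) b'∈))
      -- The first edge of `B` leaves the tail of `i` and ends higher. A left neighbour of `i` in
      -- `A` would end higher too and make `i` a valley; hence `A` is strictly to the left of that
      -- tail.
      ...   | sibling c = place-left
          (before-strict A (subst (Linked (LeftOf x)) C-split sorted) λ a∈ ai → no-valley ai c
            (subst (λ u → π u < π (hd _)) (sym hd-i) (later (∈A a∈) (hd-A a∈)))
            (subst (λ u → π u < π (hd b)) (sym hd-i) k<b))
          eqI (b , c , k<b)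
        where
        b∈ : b ∈ B
        b∈ = subst (b ∈_) (sym eqB) (here refl)
        k<b : k < π (hd b)
        k<b = later (∈B b∈) (hd-B b∈)

    open Placed placed

    private
      keep-< : ∀ {u w} → u ≢ v → w ≢ v → x u <ℤ x w → x' u <ℤ x' w
      keep-< p q = proj₁ (keeps p q)

      keep-≤ : ∀ {u w} → u ≢ v → w ≢ v → x u ≤ℤ x w → x' u ≤ℤ x' w
      keep-≤ p q = proj₂ (keeps p q)

      reflect-< : ∀ {u w} → u ≢ v → w ≢ v → x' u <ℤ x' w → x u <ℤ x w
      reflect-< {u} {w} p q lt with x u ℤₚ.<? x w
      ... | yes lt' = lt'
      ... | no ¬lt  = contradiction (keep-≤ q p (ℤₚ.≮⇒≥ ¬lt)) (ℤₚ.<⇒≱ lt)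

      reflect-≡ : ∀ {u w} → u ≢ v → w ≢ v → x' u ≡ x' w → x u ≡ x w
      reflect-≡ {u} {w} p q eq with ℤₚ.<-cmp (x u) (x w)
      ... | tri< lt _ _ = contradiction eq (ℤₚ.<⇒≢ (keep-< p q lt))
      ... | tri≈ _ e _  = e
      ... | tri> _ _ gt = contradiction (sym eq) (ℤₚ.<⇒≢ (keep-< q p gt))

      new-or-old : ∀ {u} → π u < suc k → u ≡ v ⊎ π u < k
      new-or-old p with m≤n⇒m<n∨m≡n (s≤s⁻¹ p)
      ... | inj₁ lt = inj₂ lt
      ... | inj₂ eq = inj₁ (π-inj eq)

      cut' : List (Fin m)
      cut' = A ++ outs v ++ B

      stays-alive : ∀ {e} → e ∈ cut → hd e ≢ v → Alive (suc k) e
      stays-alive e∈ h≢v = ℕ.m<n⇒m<1+n (proj₁ (C-alive e∈)) , later e∈ h≢v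

      C-alive' : ∀ {e} → e ∈ cut' → Alive (suc k) e
      C-alive' {e} e∈ with ∈-++⁻ A e∈
      ... | inj₁ a∈ = stays-alive (∈A a∈) (hd-A a∈)
      ... | inj₂ r∈ with ∈-++⁻ (outs v) r∈
      ...   | inj₁ o∈ = s≤s (≤-reflexive (cong π (outs-tl o∈))) , subst (λ u → π u < π (hd e)) (outs-tl o∈) (π-< e)
      ...   | inj₂ b∈ = stays-alive (∈B b∈) (hd-B b∈)

      A-or-B : ∀ {e} → π (tl e) < k → k < π (hd e) → e ∈ A ⊎ e ∈ B
      A-or-B {e} t<k k<h with ∈-++⁻ A (subst (e ∈_) C-split (alive-C (t<k , <⇒≤ k<h)))
      ... | inj₁ a∈ = inj₁ a∈
      ... | inj₂ r∈ with ∈-++⁻ (i ∷ I) r∈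
      ...   | inj₁ i∈ = contradiction (cong π (sym (in-hd i∈))) (ℕ.<⇒≢ k<h)
      ...   | inj₂ b∈ = inj₂ b∈

      alive-C' : ∀ {e} → Alive (suc k) e → e ∈ cut'
      alive-C' (t<sk , k<h) with new-or-old t<sk
      ... | inj₁ te = ∈-++⁺ʳ A (∈-++⁺ˡ (∈-outs te))
      ... | inj₂ t<k with A-or-B t<k k<h
      ...   | inj₁ a∈ = ∈-++⁺ˡ a∈
      ...   | inj₂ b∈ = ∈-++⁺ʳ A (∈-++⁺ʳ (outs v) b∈)

      unique' : Unique cut'
      unique' = Unique-replace A (i ∷ I) (outs v) (subst Unique C-split unique) (outs-unique v)
        λ o∈ → (λ a∈ → tl-old (∈A a∈) (outs-tl o∈)) , (λ b∈ → tl-old (∈B b∈) (outs-tl o∈))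

      sorted' : Linked (LeftOf x') cut'
      sorted' = Linked-++ (Linked-++ˡ A kept)
        (Linked-++ (Linked.map sibling (outs-Cons v)) (Linked-++ʳ (i ∷ I) (Linked-++ʳ A kept))
          (λ {_} {b} o∈ b∈ → apart (subst (λ u → x' u <ℤ x' (tl b)) (sym (outs-tl o∈)) (left-of-B b∈))))
        cross
        where
        keep : ∀ {a b} → a ∈ cut → b ∈ cut → LeftOf x a b → LeftOf x' a b
        keep a∈ b∈ (apart lt)  = apart (keep-< (tl-old a∈) (tl-old b∈) lt)
        keep a∈ b∈ (sibling c) = sibling c
        kept : Linked (LeftOf x') (A ++ (i ∷ I) ++ B)
        kept = subst (Linked (LeftOf x')) C-split (Linked-map∈ keep sorted)
        cross : ∀ {a b} → a ∈ A → b ∈ outs v ++ B → LeftOf x' a b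
        cross {a} a∈ r∈ with ∈-++⁻ (outs v) r∈
        ... | inj₁ o∈ = apart (subst (λ u → x' (tl a) <ℤ x' u) (sym (outs-tl o∈)) (right-of-A a∈))
        ... | inj₂ b∈ = apart (ℤₚ.<-trans (right-of-A a∈) (left-of-B b∈))

      x-inj' : ∀ {u w} → π u < suc k → π w < suc k → x' u ≡ x' w → u ≡ w
      x-inj' p q eq with new-or-old p | new-or-old q
      ... | inj₁ refl | inj₁ refl = refl
      ... | inj₂ p' | inj₂ q' = x-inj p' q' (reflect-≡ (old p') (old q') eq)
      ... | inj₁ refl | inj₂ q' with apart-v (old q')
      ...   | inj₁ lt = contradiction (sym eq) (ℤₚ.<⇒≢ lt)
      ...   | inj₂ gt = contradiction eq (ℤₚ.<⇒≢ gt)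
      x-inj' p q eq | inj₂ p' | inj₁ refl with apart-v (old p')
      ...   | inj₁ lt = contradiction eq (ℤₚ.<⇒≢ lt)
      ...   | inj₂ gt = contradiction (sym eq) (ℤₚ.<⇒≢ gt)

      -- For the new vertex, only edges of `A` and `B` pass its height, and their columns are never
      -- strictly between `v` and the tail of an incoming edge.
      no-cross' : ∀ {e f} → π (hd f) < suc k → π (tl e) < π (hd f) → π (hd f) < π (hd e) → ¬ Obstructs x' e f
      no-cross' {e} {f} p te he ob with new-or-old p
      ... | inj₂ hf<k = no-cross hf<k te he (⊎-map
            (λ { (a , b) → reflect-< tf≢v te≢v a , reflect-< te≢v (old hf<k) b })
            (λ { (a , b) → reflect-< (old hf<k) te≢v a , reflect-< te≢v tf≢v b }) ob)
        where
        te≢v = old (<-trans te hf<k)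
        tf≢v = old (<-trans (π-< f) hf<k)
      ... | inj₁ refl with A-or-B te he | ob
      ...   | inj₁ a∈ | inj₁ (f<e , _) = ℤₚ.<⇒≱ f<e (keep-≤ (tl-old (∈A a∈)) (old (π-< f)) (proj₁ (A<IB a∈ (∈-++⁺ˡ (all-in refl)))))
      ...   | inj₁ a∈ | inj₂ (v<e , _) = ℤₚ.<-asym v<e (right-of-A a∈)
      ...   | inj₂ b∈ | inj₁ (_ , e<v) = ℤₚ.<-asym e<v (left-of-B b∈)
      ...   | inj₂ b∈ | inj₂ (_ , e<f) = ℤₚ.<⇒≱ e<f (keep-≤ (old (π-< f)) (tl-old (∈B b∈)) (proj₁ (I<B (all-in refl) b∈)))

      in-predecessor : ∀ {b} → b ∈ i ∷ I → b ≡ i ⊎ ∃ λ z → z ∈ i ∷ I × face (z , false) ≡ face (b , true) × Order z b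
      in-predecessor b∈ with Path-predecessor path-I ordered-I b∈
      ... | inj₁ (_ , refl , _) = inj₁ refl
      ... | inj₂ pred           = inj₂ pred

      -- The face between `i` and `b` is not the outer one, so the cut goes on behind it, and the
      -- next edge, having this face on its left, is `b`. As `b` ends above `v`, it is not in the
      -- block.
      next-in-cut : ∀ {b} → Cons i b → k < π (hd b) → b ∈ B
      next-in-cut {b} c k<b = go I B (λ j∈ → in-hd (there j∈)) (λ e∈ → e∈) (λ e∈ → C-alive (∈B e∈)) (proj₂ (Path-∷ (Path-++ path-I path-B)))
        where
        b-alive : Alive k b
        b-alive = subst (λ u → π u < k) (Cons-tl c) (tl<v hd-i) , <⇒≤ k<b
        go : ∀ I' B' → (∀ {j} → j ∈ I' → hd j ≡ v) → (∀ {e} → e ∈ B' → e ∈ B) → (∀ {e} → e ∈ B' → Alive k e) →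
          Path (face (i , false)) (I' ++ B') outerFace → b ∈ B
        go [] [] _ _ _ P = contradiction (trans (Cons-face c) (Path-[] P)) (Cons-not-outer c)
        go [] (z ∷ _) _ sub al P = subst (_∈ B)
          (alive-left-unique (trans (proj₁ (Path-∷ P)) (sym (Cons-face c))) (al (here refl)) b-alive) (sub (here refl))
        go (j ∷ _) _ hds _ _ P = contradiction (cong π (trans (sym (hds (here refl))) (cong hd
          (alive-left-unique (trans (proj₁ (Path-∷ P)) (sym (Cons-face c)))
            (subst (λ u → Alive (π u) j) (hds (here refl)) alive-in) b-alive)))) (ℕ.<⇒≢ k<b)

      bend-left' : ∀ {a b} → Cons a b → π (hd a) < π (hd b) → π (hd a) < suc k → x' (hd a) <ℤ x' (tl a)
      bend-left' {a} c lt p with new-or-old p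
      ... | inj₂ ha<k = keep-< (old ha<k) (old (<-trans (π-< a) ha<k)) (bend-left c lt ha<k)
      ... | inj₁ ha with all-in ha
      ...   | there a∈  = subst (λ u → x' u <ℤ x' (tl a)) (sym ha) (left-of-I a∈)
      ...   | here refl with side
      ...     | inj₂ (lt' , _) = subst (λ u → x' u <ℤ x' (tl a)) (sym ha) lt'
      -- The right neighbour is in `B` and has the same tail as `i`, while `v` lies to the left of
      -- all tails of `B`.
      ...     | inj₁ i<v = contradiction (ℤₚ.<-trans i<v (left-of-B (next-in-cut c (subst (λ u → π u < _) ha lt))))
                             (ℤₚ.<-irrefl (cong x' (Cons-tl c)))

      bend-right' : ∀ {a b} → Cons a b → π (hd b) < π (hd a) → π (hd b) < suc k → x' (tl b) <ℤ x' (hd b)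
      bend-right' {a} {b} c lt p with new-or-old p
      ... | inj₂ hb<k = keep-< (old (<-trans (π-< b) hb<k)) (old hb<k) (bend-right c lt hb<k)
      ... | inj₁ hb with in-predecessor (all-in hb)
      -- If `b` is not the first incoming edge, its predecessor `z` has the same face on its right
      -- as `a`; so `z` is `a`, which however ends higher than `v`.
      ...   | inj₂ (z , z∈ , zf , _) with alive-right-unique (trans zf (Cons-face c)) (C-alive (∈I z∈))
                 (subst (λ u → π u < k) (sym (Cons-tl c)) (tl<v hb) , <⇒≤ (subst (λ u → π u < _) hb lt))
      ...     | refl = contradiction (cong π (trans hb (sym (in-hd z∈)))) (ℕ.<⇒≢ lt)
      bend-right' {a} {b} c lt p | inj₁ hb | inj₁ refl with side
      ...     | inj₁ i<v = subst (λ u → x' (tl b) <ℤ x' u) (sym hb) i<v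
      -- A placement to the left comes with a right neighbour ending higher; with `a` on the other
      -- side this is a valley.
      ...     | inj₂ (_ , _ , b' , c' , k<b') = ⊥-elim (no-valley c c' lt (subst (λ u → π u < _) (sym hb) k<b'))

      new-InOrder : InOrder x' v
      new-InOrder = record
        { i = i ; i-hd = hd-i ; first-out = first-out ; outer-in = outer-in
        ; ascending = ascending
        ; side = ⊎-map (λ lt → lt , λ {e} he e≢i → left-of-I (tail-∈ (all-in he) e≢i))
                       (λ { (lt , I≡[] , _) → lt , λ {e} he → head-≡ (subst (λ l → e ∈ i ∷ l) I≡[] (all-in he)) }) side }
        where
        tail-∈ : ∀ {e} → e ∈ i ∷ I → e ≢ i → e ∈ I
        tail-∈ (here eq)  e≢i = contradiction eq e≢i
        tail-∈ (there e∈) _   = e∈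
        head-≡ : ∀ {e} → e ∈ i ∷ [] → e ≡ i
        head-≡ (here eq) = eq
        ascending : ∀ {e e'} → hd e ≡ v → rot (e , true) ≡ (e' , true) → e' ≢ i → x' (tl e) <ℤ x' (tl e')
        ascending {e} {e'} he r e'≢i with trans (rot⇒same-vertex {e , true} {e' , true} r) he
        ... | he' with in-predecessor (all-in he')
        ...   | inj₁ eq = contradiction eq e'≢i
        ...   | inj₂ (z , z∈ , zf , o) with alive-right-unique (trans zf (sym (face-next {e , false} r))) (C-alive (∈I z∈)) (C-alive (∈I (all-in he)))
        ...     | refl = keep-< (tl-old (∈I z∈)) (tl-old (∈I (all-in he'))) (strict-in he he' o)

      old-InOrder : ∀ {u} → π u < k → InOrder x u → InOrder x' u
      old-InOrder {u} u<k O = record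
        { i = O.i ; i-hd = O.i-hd ; first-out = O.first-out ; outer-in = O.outer-in
        ; ascending = λ {e} {e'} he r e'≢i → keep-< (tail he) (tail (trans (rot⇒same-vertex {e , true} {e' , true} r) he)) (O.ascending he r e'≢i)
        ; side = ⊎-map
            (λ { (lt , rest) → keep-< (tail O.i-hd) (old u<k) lt , λ he e≢i → keep-< (old u<k) (tail he) (rest he e≢i) })
            (λ { (lt , only) → keep-< (old u<k) (tail O.i-hd) lt , only }) O.side }
        where
        module O = InOrder O
        tail : ∀ {e} → hd e ≡ u → tl e ≢ v
        tail refl = old (<-trans (π-< _) u<k)

    state' : State (suc k)
    state' = record
      { cut = cut' ; x = x' ; C-alive = C-alive' ; alive-C = alive-C' ; unique = unique'
      ; path = Path-++ path-A (Path-++ path-outs path-B) ; sorted = sorted'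
      ; x-inj = x-inj' ; no-cross = no-cross' ; bend-left = bend-left' ; bend-right = bend-right'
      ; incoming = λ p u≢s → incoming' (new-or-old p) u≢s }
      where
      incoming' : ∀ {u} → u ≡ v ⊎ π u < k → u ≢ s → InOrder x' u
      incoming' (inj₁ refl) _   = new-InOrder
      incoming' (inj₂ u<k)  u≢s = old-InOrder u<k (incoming u<k u≢s)

  step-at : ∀ {v} → v ≢ s → State (π v) → State (suc (π v))
  step-at v≢s S = Step.state' S (split v≢s (State.C-alive S) (State.alive-C S) (State.path S))

  state : ∀ k → State k
  state zero = initial
  state (suc k) with any? (λ v → π v ℕ.≟ k)
  ... | no none = idle (λ v eq → none (v , eq)) (state k)
  ... | yes (v , eq) with v Fin.≟ s
  ...   | yes refl = start eq (state k)
  ...   | no v≢s   = subst (State ∘ suc) eq (step-at v≢s (subst State (sym eq) (state k)))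

  open State (state (suc (π t))) using (x; x-inj; no-cross; bend-left; bend-right; incoming)

  private
    placed : ∀ {v} → π v < suc (π t)
    placed {v} = s≤s (t-max v)

    y : Fin n → ℤ
    y v = + π v

    y-< : ∀ {u v} → π u < π v → y u <ℤ y v
    y-< = ℤ.+<+

    x-injective : Injective _≡_ _≡_ x
    x-injective = x-inj placed placed

    y-injective : Injective _≡_ _≡_ y
    y-injective eq = π-inj (ℤₚ.+-injective eq)

    upward : ∀ e → y (tl e) <ℤ y (hd e)
    upward e = y-< (π-< e)

    layout : Layout tl hd
    layout = record { x = x ; y = y ; x-inj = x-injective ; y-inj = y-injective ; upward = upward ; simple = simple }

  open GraphKeys H layout

  -- The neighbour with the lower head bends away from the other one, which fixes the order of the
  -- keys whichever way the other bends.
  Cons⇒≺ : ∀ {a b} → Cons a b → (b , false) ≺ (a , false)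
  Cons⇒≺ {a} {b} c with <-cmp (π (hd a)) (π (hd b))
  ... | tri≈ _ eq _ = contradiction (simple a b (Cons-tl c) (π-inj eq)) (Cons.distinct c)
  ... | tri< a<b _ _ with out-to-left (bend-left c a<b placed) | bend b
  ...   | ga , sa | inj₁ r = by-group (proj₁ (out-to-right r)) ga (s≤s (s≤s z≤n))
  ...   | ga , sa | inj₂ l = by-second (proj₁ (out-to-left l)) ga (proj₂ (out-to-left l)) sa (ℤₚ.neg-mono-< (y-< a<b))
  Cons⇒≺ {a} {b} c | tri> _ _ b<a with out-to-right (bend-right c b<a placed) | bend a
  ...   | gb , sb | inj₁ r = by-second gb (proj₁ (out-to-right r)) sb (proj₂ (out-to-right r)) (y-< b<a)
  ...   | gb , sb | inj₂ l = by-group gb (proj₁ (out-to-left l)) (s≤s (s≤s z≤n))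

  Ascends : Dart m → Set
  Ascends d = d ≺ rot d

  ascends : ∀ {d d'} → rot d ≡ d' → d ≺ d' → Ascends d
  ascends {d} r = subst (d ≺_) (sym r)

  rot-Next-from : ∀ top → (∀ d → dartVertex d ≡ dartVertex top → d ≢ top → Ascends d) →
    ∀ d → dartVertex d ≡ dartVertex top → Next d (rot d)
  rot-Next-from top asc = oneDescent⇒Next _≟D_ rot rot-at top
    (λ d dt → rot-cyc (rot top) d (trans (rot-at top) (sym dt))) asc

  out-ascends : ∀ {e} → ¬ IsFirst e → Ascends (e , false)
  out-ascends {e} ¬first with first-or-Cons e
  ... | inj₁ first   = contradiction first ¬first
  ... | inj₂ (a , c) = ascends (Cons.adjacent c) (Cons⇒≺ c)

  module _ {v : Fin n} (O : InOrder x v) where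
    open InOrder O

    -- Here `(i , true)` is the only dart of group 3, the last in the key order, and so the place of
    -- the single descent.
    rot-Next-right : x (tl i) <ℤ x v → (∀ {e} → hd e ≡ v → e ≢ i → x v <ℤ x (tl e)) →
      ∀ d → dartVertex d ≡ v → Next d (rot d)
    rot-Next-right i<v rest d dv = rot-Next-from (i , true) asc d (trans dv (sym i-hd))
      where
      i-left : x (tl i) <ℤ x (hd i)
      i-left = subst (λ u → x (tl i) <ℤ x u) (sym i-hd) i<v
      from-right : ∀ {e} → hd e ≡ v → e ≢ i → x (hd e) <ℤ x (tl e)
      from-right {e} he e≢i = subst (λ u → x u <ℤ x (tl e)) (sym he) (rest he e≢i)
      asc : ∀ d → dartVertex d ≡ hd i → d ≢ (i , true) → Ascends d
      asc (e , false) te _ with first-or-Cons e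
      ... | inj₁ first   = ascends (first-out (trans te i-hd) first) (out-below-in i-left)
      ... | inj₂ (a , c) = ascends (Cons.adjacent c) (Cons⇒≺ c)
      asc (e , true) he d≢ with rot (e , true) in r
      ... | o , false = in-below-out (from-right (trans he i-hd) (λ eq → d≢ (cong (_, true) eq)))
      ... | e' , true with e' Fin.≟ i
      ...   | yes refl = by-group (in-from-right (from-right (trans he i-hd) (λ eq → d≢ (cong (_, true) eq))))
                                  (in-from-left i-left) (s≤s z≤n)
      ...   | no e'≢i  = by-second (in-from-right (from-right (trans he i-hd) (λ eq → d≢ (cong (_, true) eq))))
                                   (in-from-right (from-right (trans (rot⇒same-vertex {e , true} {e' , true} r) (trans he i-hd)) e'≢i))
                                   refl refl (ascending (trans he i-hd) r e'≢i)

    -- The only incoming dart has group 0 and comes first, so the descent is at the leftmost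
    -- outgoing edge; at `t` there is just one dart.
    rot-Next-left : x v <ℤ x (tl i) → (∀ {e} → hd e ≡ v → e ≡ i) → ∀ d → dartVertex d ≡ v → Next d (rot d)
    rot-Next-left v<i only d dv with v Fin.≟ t
    ... | yes refl = rot-Next-from (i , true) asc d (trans dv (sym i-hd))
      where
      asc : ∀ d → dartVertex d ≡ hd i → d ≢ (i , true) → Ascends d
      asc (e , true)  he d≢ = contradiction (cong (_, true) (only (trans he i-hd))) d≢
      asc (e , false) te _  = contradiction (trans te i-hd) (t-no-out e)
    ... | no v≢t with first-at v (proj₂ (out-edge v v≢t))
    ...   | l , tl-l , first = rot-Next-from (l , false) asc d (trans dv (sym tl-l))
      where
      asc : ∀ d → dartVertex d ≡ tl l → d ≢ (l , false) → Ascends d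
      asc (e , false) te d≢ = out-ascends (λ first' → d≢ (cong (_, false) (first-unique te first' first)))
      asc (e , true) he _ with rot (e , true) in r | only (trans he tl-l)
      ... | o , false | refl = in-below-out (subst (λ u → x u <ℤ x (tl i)) (sym i-hd) v<i)
      ... | e' , true | refl with only (trans (rot⇒same-vertex {i , true} {e' , true} r) i-hd)
      ...   | refl = ⊥-elim (ends-differ refl (rot-injective (trans r (sym (first-out tl-l first)))))

  rot-Next : ∀ v d → dartVertex d ≡ v → Next d (rot d)
  rot-Next v d dv with v Fin.≟ s
  ... | no v≢s with InOrder.side (incoming placed v≢s)
  ...   | inj₁ (i<v , rest) = rot-Next-right (incoming placed v≢s) i<v rest d dv
  ...   | inj₂ (v<i , only) = rot-Next-left (incoming placed v≢s) v<i only d dv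
  rot-Next v d dv | yes refl with s-first
  ...   | l , tl-l , first = rot-Next-from (l , false) asc d (trans dv (sym tl-l))
    where
    asc : ∀ d → dartVertex d ≡ tl l → d ≢ (l , false) → Ascends d
    asc (e , false) te d≢ = out-ascends (λ first' → d≢ (cong (_, false) (first-unique te first' first)))
    asc (e , true)  he _  = contradiction (trans he tl-l) (s-no-in e)

  t≢s : t ≢ s
  t≢s eq = s-no-in e₀ (trans hd-e₀ eq)

  -- An angle at `t` that ends at an edge other than `i` ends at one coming from the right, with
  -- keys rising into it, and so misses the upward direction. The angle ending at `i` is outer.
  outer-north : ∀ d → dartVertex d ≡ t → North d (rot d) → SameFace outer (rot d)
  outer-north (e , false) te _ = contradiction te (t-no-out e)
  outer-north (e , true) he north with incoming placed t≢s | rot (e , true) in r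
  ... | O | o , false = contradiction (trans (rot⇒same-vertex {e , true} r) he) (t-no-out o)
  ... | O | e' , true with e' Fin.≟ InOrder.i O
  ...   | yes refl = face⇒SameFace (sym (InOrder.outer-in O refl))
  ...   | no e'≢i  = ⊥-elim (absurd (InOrder.side O))
    where
    open InOrder O
    he' : hd e' ≡ t
    he' = trans (rot⇒same-vertex {e , true} {e' , true} r) he
    absurd : ¬ Incoming x t i
    absurd (inj₂ (_ , only)) = e'≢i (only he')
    absurd (inj₁ (_ , rest)) = not-north north
      where
      g' : group (e' , true) ≡ 0
      g' = in-from-right (subst (λ u → x u <ℤ x (tl e')) (sym he') (rest he' e'≢i))
      not-north : ¬ North (e , true) (e' , true)
      not-north (inj₁ (_ , 2≤)) = contradiction (subst (2 ≤_) g' 2≤) λ ()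
      not-north (inj₂ (_ , inj₂ 2≤)) = contradiction (subst (2 ≤_) g' 2≤) λ ()
      not-north (inj₂ (e'≼e , inj₁ ≤1)) with group-in e
      ... | inj₁ g = ≺⇒⋡ (by-second g g' refl refl (ascending he r e'≢i)) e'≼e
      ... | inj₂ g = contradiction (subst (_≤ 1) g ≤1) λ { (s≤s ()) }

  no-crossing : ∀ e f → ¬ Drawing.Cross H x y e f
  no-crossing e f (inj₁ (te<hf , hf<he) , ob) = no-cross placed (ℤₚ.drop‿+<+ te<hf) (ℤₚ.drop‿+<+ hf<he) ob
  no-crossing e f (inj₂ (he<hf , hf<te) , _)  = ℤₚ.<-asym (upward e) (ℤₚ.<-trans he<hf hf<te)

  drawable : UpwardPlanarLDrawable H
  drawable = x , y , record
    { x-inj = x-injective ; y-inj = y-injective ; upward = upward ; noCross = no-crossing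
    ; respRot = λ d → Next⇒CcwNext (rot-Next (dartVertex d) d refl)
    ; respOuter = λ v v-top d dv north → outer-north d (trans dv (top v v-top)) (NorthIn⇒North north) }
    where
    top : ∀ v → (∀ w → y w ≤ℤ y v) → v ≡ t
    top v v-top = π-inj (≤-antisym (t-max v) (ℤₚ.drop‿+≤+ (v-top t)))

-- Completion of a drawing to a plane st-graph

-- In a drawing with the edge (s , t) as left and upper border, a sink v is joined to the head of the
-- lowest horizontal segment above v, and a source v to the tail of the closest vertical segment
-- to the left of v: the new edge overlaps the segment that it hits.
module Completion {N : ℕ} (x y : Fin N → ℤ) (s t : Fin N)
  (s-left : ∀ {v} → v ≢ s → x s <ℤ x v) (s-low : ∀ {v} → v ≢ s → y s <ℤ y v)
  (t-right : ∀ {v} → v ≢ t → x v <ℤ x t) (t-high : ∀ {v} → v ≢ t → y v <ℤ y t) where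

  Edge : Set
  Edge = Fin N × Fin N

  Inside : ℤ → ℤ → ℤ → Set
  Inside a b c = (a <ℤ c × c <ℤ b) ⊎ (b <ℤ c × c <ℤ a)

  inside? : ∀ a b c → Dec (Inside a b c)
  inside? a b c = ((a ℤₚ.<? c) ×-dec (c ℤₚ.<? b)) ⊎-dec ((b ℤₚ.<? c) ×-dec (c ℤₚ.<? a))

  Crosses : Edge → Edge → Set
  Crosses (u , w) (p , v) = Inside (y u) (y w) (y v) × Inside (x p) (x v) (x u)

  record Valid (E : List Edge) : Set where
    field
      root     : (s , t) ∈ E
      unique   : Unique E
      upward   : ∀ {u w} → (u , w) ∈ E → y u <ℤ y w
      no-cross : ∀ {e f} → e ∈ E → f ∈ E → ¬ Crosses e f

  HasOut HasIn : List Edge → Fin N → Set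
  HasOut E v = ∃ λ w → (v , w) ∈ E
  HasIn  E v = ∃ λ u → (u , v) ∈ E

  private
    extend : ∀ {E u w} → Valid E → ¬ ((u , w) ∈ E) → y u <ℤ y w →
      (∀ {e} → e ∈ E → ¬ Crosses (u , w) e) → (∀ {e} → e ∈ E → ¬ Crosses e (u , w)) → Valid ((u , w) ∷ E)
    extend {E} {u} {w} V new up c₁ c₂ = record
      { root = there root
      ; unique = Allₚ.¬Any⇒All¬ E new ∷ unique
      ; upward = λ { (here refl) → up ; (there e∈) → upward e∈ }
      ; no-cross = λ { (here refl) (here refl) (inj₁ (_ , lt) , _) → ℤₚ.<-irrefl refl lt
                     ; (here refl) (here refl) (inj₂ (lt , _) , _) → ℤₚ.<-irrefl refl lt
                     ; (here refl) (there f∈) → c₁ f∈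
                     ; (there e∈) (here refl) → c₂ e∈
                     ; (there e∈) (there f∈) → no-cross e∈ f∈ } }
      where open Valid V

    Inside-trans : ∀ {a b c d} → Inside a b c → Inside c b d → Inside a b d
    Inside-trans (inj₁ (a<c , c<b)) (inj₁ (c<d , d<b)) = inj₁ (ℤₚ.<-trans a<c c<d , d<b)
    Inside-trans (inj₁ (a<c , c<b)) (inj₂ (b<d , d<c)) = contradiction (ℤₚ.<-trans b<d d<c) (ℤₚ.<-asym c<b)
    Inside-trans (inj₂ (b<c , c<a)) (inj₁ (c<d , d<b)) = contradiction (ℤₚ.<-trans c<d d<b) (ℤₚ.<-asym b<c)
    Inside-trans (inj₂ (b<c , c<a)) (inj₂ (b<d , d<c)) = inj₂ (b<d , ℤₚ.<-trans d<c c<a)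

    upward-inside : ∀ {a b c} → a <ℤ b → Inside a b c → a <ℤ c × c <ℤ b
    upward-inside a<b (inj₁ p)           = p
    upward-inside a<b (inj₂ (b<c , c<a)) = contradiction (ℤₚ.<-trans b<c c<a) (ℤₚ.<-asym a<b)

  -- A horizontal segment crossing the new vertical one would be a lower candidate, and the new
  -- horizontal segment is part of the one that is hit.
  add-out : ∀ {E v} → Valid E → v ≢ t → ¬ HasOut E v → ∃ λ w → Valid ((v , w) ∷ E)
  add-out {E} {v} V v≢t none with argmin (allFin (length E)) ∈-allFin {Hits ∘ lookup E} (hits? ∘ lookup E) (y ∘ proj₂ ∘ lookup E)
      -- The horizontal segment of `(s , t)` spans the whole width above `v`, so a candidate exists.
      (index root , subst Hits (sym (lookup-index root)) (t-high v≢t , inj₁ (s-left v≢s , t-right v≢t)))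
    where
    open Valid V
    Hits : Edge → Set
    Hits (p , w) = y v <ℤ y w × Inside (x p) (x w) (x v)
    hits? : ∀ e → Dec (Hits e)
    hits? (p , w) = (y v ℤₚ.<? y w) ×-dec inside? (x p) (x w) (x v)
    v≢s : v ≢ s
    v≢s refl = none (t , root)
  ... | i , (v<w , between) , min = w , extend V (λ e∈ → none (w , e∈)) v<w c₁ c₂
    where
    open Valid V
    w = proj₂ (lookup E i)
    lowest : ∀ {e} → e ∈ E → y v <ℤ y (proj₂ e) × Inside (x (proj₁ e)) (x (proj₂ e)) (x v) → y w ≤ℤ y (proj₂ e)
    lowest e∈ hits = subst (λ e → y w ≤ℤ y (proj₂ e)) (lookup-index e∈)
      (min (index e∈) (subst (λ e → y v <ℤ y (proj₂ e) × Inside (x (proj₁ e)) (x (proj₂ e)) (x v)) (sym (lookup-index e∈)) hits))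
    c₁ : ∀ {e} → e ∈ E → ¬ Crosses (v , w) e
    c₁ {p' , w'} e∈ (ins , between') with upward-inside v<w ins
    ... | v<w' , w'<w = ℤₚ.<⇒≱ w'<w (lowest e∈ (v<w' , between'))
    c₂ : ∀ {e} → e ∈ E → ¬ Crosses e (v , w)
    c₂ e∈ (ins , between') = no-cross e∈ (∈-lookup i) (ins , Inside-trans between between')

  -- Dually, the new vertical segment is part of the one that is hit, and a vertical segment
  -- crossing the new horizontal one would be a closer candidate.
  add-in : ∀ {E v} → Valid E → v ≢ s → ¬ HasIn E v → ∃ λ u → Valid ((u , v) ∷ E)
  add-in {E} {v} V v≢s none with argmax (allFin (length E)) ∈-allFin {Hits ∘ lookup E} (hits? ∘ lookup E) (x ∘ proj₁ ∘ lookup E)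
      (index root , subst Hits (sym (lookup-index root)) ((s-low v≢s , t-high v≢t) , s-left v≢s))
    where
    open Valid V
    Hits : Edge → Set
    Hits (u , w) = (y u <ℤ y v × y v <ℤ y w) × x u <ℤ x v
    hits? : ∀ e → Dec (Hits e)
    hits? (u , w) = ((y u ℤₚ.<? y v) ×-dec (y v ℤₚ.<? y w)) ×-dec (x u ℤₚ.<? x v)
    v≢t : v ≢ t
    v≢t refl = none (s , root)
  ... | i , ((u<v , v<w) , left) , max = u , extend V (λ e∈ → none (u , e∈)) u<v c₁ c₂
    where
    open Valid V
    u = proj₁ (lookup E i)
    closest : ∀ {e} → e ∈ E → (y (proj₁ e) <ℤ y v × y v <ℤ y (proj₂ e)) × x (proj₁ e) <ℤ x v → x (proj₁ e) ≤ℤ x u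
    closest e∈ hits = subst (λ e → x (proj₁ e) ≤ℤ x u) (lookup-index e∈)
      (max (index e∈) (subst (λ e → (y (proj₁ e) <ℤ y v × y v <ℤ y (proj₂ e)) × x (proj₁ e) <ℤ x v) (sym (lookup-index e∈)) hits))
    c₁ : ∀ {e} → e ∈ E → ¬ Crosses (u , v) e
    c₁ e∈ (ins , between) with upward-inside u<v ins
    ... | u<w' , w'<v = no-cross (∈-lookup i) e∈ (inj₁ (u<w' , ℤₚ.<-trans w'<v v<w) , between)
    c₂ : ∀ {e} → e ∈ E → ¬ Crosses e (u , v)
    c₂ e∈ (ins , between) with upward-inside (upward e∈) ins | upward-inside left between
    ... | p<v , v<w' | u<p , p<v' = ℤₚ.<⇒≱ u<p (closest e∈ ((p<v , v<w') , p<v'))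

  has-out? : ∀ E v → Dec (HasOut E v)
  has-out? E v with any? (λ i → proj₁ (lookup E i) Fin.≟ v)
  ... | yes (i , refl) = yes (proj₂ (lookup E i) , ∈-lookup i)
  ... | no ¬p = no λ { (w , e∈) → ¬p (index e∈ , cong proj₁ (lookup-index e∈)) }

  has-in? : ∀ E v → Dec (HasIn E v)
  has-in? E v with any? (λ i → proj₂ (lookup E i) Fin.≟ v)
  ... | yes (i , refl) = yes (proj₁ (lookup E i) , ∈-lookup i)
  ... | no ¬p = no λ { (w , e∈) → ¬p (index e∈ , cong proj₂ (lookup-index e∈)) }

  Extension : List Edge → (List Edge → Set) → Set
  Extension E P = Σ (List Edge) λ E' → Valid E' × (∀ {e} → e ∈ E → e ∈ E') × P E'

  Complete : List Edge → Fin N → Set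
  Complete E v = (v ≢ t → HasOut E v) × (v ≢ s → HasIn E v)

  private
    complete-out : ∀ {E} v → Valid E → Extension E (λ E' → v ≢ t → HasOut E' v)
    complete-out {E} v V with v Fin.≟ t | has-out? E v
    ... | yes v≡t | _       = E , V , id , λ v≢t → contradiction v≡t v≢t
    ... | no _    | yes out = E , V , id , λ _ → out
    ... | no v≢t  | no none with add-out V v≢t none
    ...   | w , V' = _ , V' , there , λ _ → w , here refl

    complete-in : ∀ {E} v → Valid E → Extension E (λ E' → v ≢ s → HasIn E' v)
    complete-in {E} v V with v Fin.≟ s | has-in? E v
    ... | yes v≡s | _      = E , V , id , λ v≢s → contradiction v≡s v≢s
    ... | no _    | yes in' = E , V , id , λ _ → in'
    ... | no v≢s  | no none with add-in V v≢s none
    ...   | u , V' = _ , V' , there , λ _ → u , here refl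

    complete-at : ∀ {E} v → Valid E → Extension E (λ E' → Complete E' v)
    complete-at v V with complete-out v V
    ... | _ , V₁ , sub₁ , out with complete-in v V₁
    ...   | E₂ , V₂ , sub₂ , in' = E₂ , V₂ , sub₂ ∘ sub₁ , (λ v≢t → proj₁ (out v≢t) , sub₂ (proj₂ (out v≢t))) , in'

    complete-along : ∀ vs {E} → Valid E → Extension E (λ E' → ∀ {v} → v ∈ vs → Complete E' v)
    complete-along [] {E} V = E , V , id , λ ()
    complete-along (v ∷ vs) V with complete-along vs V
    ... | _ , V₁ , sub₁ , c₁ with complete-at v V₁
    ...   | E₂ , V₂ , sub₂ , c₂ = E₂ , V₂ , sub₂ ∘ sub₁ ,
      λ { (here refl) → c₂
        ; (there v∈) → (λ v≢t → proj₁ (proj₁ (c₁ v∈) v≢t) , sub₂ (proj₂ (proj₁ (c₁ v∈) v≢t)))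
                     , (λ v≢s → proj₁ (proj₂ (c₁ v∈) v≢s) , sub₂ (proj₂ (proj₂ (c₁ v∈) v≢s))) }

  completion : ∀ {E} → Valid E → Extension E (λ E' → ∀ v → Complete E' v)
  completion V with complete-along (allFin N) V
  ... | E' , V' , sub , c = E' , V' , sub , λ v → c (∈-allFin v)

-- The rotation system induced by a layout

module RotationSystem {N m : ℕ} (tl hd : Fin m → Fin N) (L : Layout tl hd) (outer₀ : Dart m) where

  open Keys tl hd L
  open FiniteSuccessor (darts m) ∈-darts Fin._≟_ _≟D_
  private module P = FinitePermutation code code-injective next next-injective

  previous : Dart m → Dart m
  previous d = iter next (proj₁ (P.period d)) d

  next-previous : ∀ d → next (previous d) ≡ d
  next-previous d = proj₂ (P.period d)

  -- Every other dart of the vertex lies on the full circle from `d` to itself, which the iterates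
  -- within one period exhaust.
  next-cyclic : ∀ d d' → at d ≡ at d' → InOrbit next d d'
  next-cyclic d d' a with d ≟D d'
  ... | yes refl = orbit-refl
  ... | no d≢d' with Between-iter next next-Next (proj₁ (P.period d)) {d} {d'} (sym a)
                       (subst (Between d d') (sym (proj₂ (P.period d))) (Between-self a d≢d'))
  ...   | j , _ , eq = suc j , eq

  graph : EmbeddedDigraph
  graph = record
    { n = N ; m = m ; tl = tl ; hd = hd ; rot = next ; rot⁻¹ = previous ; outer = outer₀
    ; rot-inv₁ = next-previous ; rot-inv₂ = λ d → next-injective (next-previous (next d))
    ; rot-at = λ d → proj₁ (next-Next d) ; rot-cyc = next-cyclic }

  graph-Next : ∀ d → Next d (EmbeddedDigraph.rot graph d)
  graph-Next = next-Next

AllPairs-map∈ : {A : Set} {R R' : A → A → Set} {xs : List A} →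
  (∀ {a b} → a ∈ xs → b ∈ xs → R a b → R' a b) → AllPairs R xs → AllPairs R' xs
AllPairs-map∈ f []       = []
AllPairs-map∈ f (p ∷ ps) = All.tabulate (λ b∈ → f (here refl) (there b∈) (All.lookup p b∈)) ∷
  AllPairs-map∈ (λ a∈ b∈ → f (there a∈) (there b∈)) ps

-- Faces of a drawn st-graph

record STDrawing (H : EmbeddedDigraph) : Set where
  open EmbeddedDigraph H
  field
    layout : Layout tl hd
  open Layout layout public
  field
    no-cross : ∀ e f → ¬ Drawing.Cross H x y e f
    rot-Next : ∀ d → GraphKeys.Next H layout d (rot d)
    s t      : Fin n
    e₀       : Fin m
    tl-e₀    : tl e₀ ≡ s
    hd-e₀    : hd e₀ ≡ t
    s-left   : ∀ {v} → v ≢ s → x s <ℤ x v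
    s-low    : ∀ {v} → v ≢ s → y s <ℤ y v
    t-right  : ∀ {v} → v ≢ t → x v <ℤ x t
    t-high   : ∀ {v} → v ≢ t → y v <ℤ y t
    in-edge  : ∀ v → v ≢ s → ∃ λ e → hd e ≡ v
    out-edge : ∀ v → v ≢ t → ∃ λ e → tl e ≡ v
    outer-e₀ : outer ≡ (e₀ , true)

module DrawnST (H : EmbeddedDigraph) (D : STDrawing H) where
  open EmbeddedDigraph H
  open Orbits H
  open STDrawing D
  open GraphKeys H layout

  π : Fin n → ℕ
  π = proj₁ (normalise y)

  π-mono : ∀ {u v} → y u <ℤ y v → π u < π v
  π-mono = proj₂ (normalise y)

  π-reflect : ∀ {u v} → π u < π v → y u <ℤ y v
  π-reflect {u} {v} lt with ℤₚ.<-cmp (y u) (y v)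
  ... | tri< lt' _ _ = lt'
  ... | tri≈ _ eq _  = contradiction (cong π (y-inj eq)) (ℕ.<⇒≢ lt)
  ... | tri> _ _ gt  = contradiction (π-mono gt) (ℕ.<-asym lt)

  π-inj : Injective _≡_ _≡_ π
  π-inj {u} {v} eq with ℤₚ.<-cmp (y u) (y v)
  ... | tri< lt _ _ = contradiction eq (ℕ.<⇒≢ (π-mono lt))
  ... | tri≈ _ e _  = y-inj e
  ... | tri> _ _ gt = contradiction (sym eq) (ℕ.<⇒≢ (π-mono gt))

  π-< : ∀ e → π (tl e) < π (hd e)
  π-< e = π-mono (upward e)

  π-≤t : ∀ v → π v ≤ π t
  π-≤t v with v Fin.≟ t
  ... | yes refl = ≤-refl
  ... | no v≢t   = <⇒≤ (π-mono (t-high v≢t))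

  open Switches H π π-<

  s-no-in : ∀ e → hd e ≢ s
  s-no-in e eq with tl e Fin.≟ s
  ... | yes te = tl≢hd e (trans te (sym eq))
  ... | no ¬te = ℤₚ.<-asym (s-low ¬te) (subst (λ u → y (tl e) <ℤ y u) eq (upward e))

  t-no-out : ∀ e → tl e ≢ t
  t-no-out e eq with hd e Fin.≟ t
  ... | yes he = tl≢hd e (trans eq (sym he))
  ... | no ¬he = ℤₚ.<-asym (t-high ¬he) (subst (λ u → y u <ℤ y (hd e)) eq (upward e))

  -- The switch below a dart serves as the name of its face; what has to be shown is that `faceNext`
  -- preserves it.
  color : Dart m → Fin m
  color d = proj₁ (reaches d)

  color-eq : ∀ {d d' σ} → Reaches d σ → Reaches d' σ → color d ≡ color d'
  color-eq r r' = trans (Reaches-unique (proj₂ (reaches _)) r) (Reaches-unique r' (proj₂ (reaches _)))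

  -- The left-to-right order across a level. Edges with a common tail share a column, and among them
  -- a later key means further left.
  data _◁_ (e e' : Fin m) : Set where
    apart   : x (tl e) <ℤ x (tl e') → e ◁ e'
    sibling : tl e ≡ tl e' → (e' , false) ≺ (e , false) → e ◁ e'

  ◁-compare : ∀ {e e'} → e ≢ e' → e ◁ e' ⊎ e' ◁ e
  ◁-compare {e} {e'} e≢e' with ℤₚ.<-cmp (x (tl e)) (x (tl e'))
  ... | tri< lt _ _ = inj₁ (apart lt)
  ... | tri> _ _ gt = inj₂ (apart gt)
  ... | tri≈ _ eq _ with ≺-compare (e , false) (e' , false) (x-inj eq)
  ...   | inj₁ p           = inj₂ (sibling (sym (x-inj eq)) p)
  ...   | inj₂ (inj₁ refl) = contradiction refl e≢e'
  ...   | inj₂ (inj₂ p)    = inj₁ (sibling (x-inj eq) p)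

  ◁-apart : ∀ {e e'} → tl e ≢ tl e' → e ◁ e' → x (tl e) <ℤ x (tl e')
  ◁-apart ne (apart lt)     = lt
  ◁-apart ne (sibling eq _) = contradiction eq ne

  ◁-sibling : ∀ {e e'} → tl e ≡ tl e' → e ◁ e' → (e' , false) ≺ (e , false)
  ◁-sibling eq (apart lt)    = contradiction lt (ℤₚ.<-irrefl (cong x eq))
  ◁-sibling eq (sibling _ p) = p

  ◁-in : ∀ {e e'} → hd e ≡ hd e' → e ◁ e' → x (tl e) <ℤ x (tl e')
  ◁-in h (apart lt) = lt
  ◁-in h (sibling eq p) with simple _ _ eq h
  ... | refl = contradiction p ≺-irrefl

  Passes : Fin n → Fin m → Set
  Passes v g = π (tl g) < π v × π v < π (hd g)

  private
    y-inside : ∀ {v g} → Passes v g → y (tl g) <ℤ y v × y v <ℤ y (hd g)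
    y-inside (p , q) = π-reflect p , π-reflect q

    ¬Passes-through : ∀ {v g f} → Passes v g → hd f ≡ v → ¬ Drawing.StrictlyBetween H x y (x (tl f)) (x v) (x (tl g))
    ¬Passes-through {v} {g} {f} ps refl b = no-cross g f (inj₁ (y-inside {v} {g} ps) , b)

  -- The column of `g` cannot cut the horizontal segment of `f`, so `g` is on the same side of both
  -- its ends. If the tails agree, `f` has the lower head and must bend away from `g`.
  passes-left : ∀ {v g f} → Passes v g → hd f ≡ v → g ◁ f → x (tl g) <ℤ x v
  passes-left {v} {g} {f} ps hf (apart lt) with x (tl g) ℤₚ.<? x v
  ... | yes lt' = lt'
  ... | no ¬lt = contradiction (inj₂ (ℤₚ.≤∧≢⇒< (ℤₚ.≮⇒≥ ¬lt) (λ eq → <-irrefl (cong π (sym (x-inj eq))) (proj₁ ps)) , lt))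
                   (¬Passes-through {g = g} ps hf)
  passes-left {g = g} {f} ps refl (sibling te p) with bend f
  ... | inj₁ r = subst (λ u → x u <ℤ x (hd f)) (sym te) r
  ... | inj₂ l with bend g
  ...   | inj₁ r = contradiction (by-group (proj₁ (out-to-right r)) (proj₁ (out-to-left l)) (s≤s (s≤s z≤n))) (≺⇒⋡ p ∘ inj₁)
  ...   | inj₂ l' = contradiction (by-second (proj₁ (out-to-left l')) (proj₁ (out-to-left l)) (proj₂ (out-to-left l')) (proj₂ (out-to-left l))
                     (ℤₚ.neg-mono-< (π-reflect (proj₂ ps)))) (≺⇒⋡ p ∘ inj₁)

  passes-right : ∀ {v g f} → Passes v g → hd f ≡ v → f ◁ g → x v <ℤ x (tl g)
  passes-right {v} {g} {f} ps hf (apart lt) with x v ℤₚ.<? x (tl g)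
  ... | yes lt' = lt'
  ... | no ¬lt = contradiction (inj₁ (lt , ℤₚ.≤∧≢⇒< (ℤₚ.≮⇒≥ ¬lt) (λ eq → <-irrefl (cong π (x-inj eq)) (proj₁ ps))))
                   (¬Passes-through {g = g} ps hf)
  passes-right {g = g} {f} ps refl (sibling te p) with bend f
  ... | inj₂ l = subst (λ u → x (hd f) <ℤ x u) te l
  ... | inj₁ r with bend g
  ...   | inj₂ l = contradiction (by-group (proj₁ (out-to-right r)) (proj₁ (out-to-left l)) (s≤s (s≤s z≤n))) (≺⇒⋡ p ∘ inj₁)
  ...   | inj₁ r' = contradiction (by-second (proj₁ (out-to-right r)) (proj₁ (out-to-right r')) (proj₂ (out-to-right r)) (proj₂ (out-to-right r'))
                     (π-reflect (proj₂ ps))) (≺⇒⋡ p ∘ inj₁)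

  out≼in : ∀ {o g} → (o , false) ≼ (g , true) → x (tl g) <ℤ x (hd g)
  out≼in {o} {g} le with bend g
  ... | inj₁ l = l
  ... | inj₂ r = contradiction le (≺⇒⋡ (in-below-out {g} {o} r))

  in≼out : ∀ {g o} → (g , true) ≼ (o , false) → x (hd g) <ℤ x (tl g)
  in≼out {g} {o} le with bend g
  ... | inj₁ l = contradiction le (≺⇒⋡ (out-below-in {g} {o} l))
  ... | inj₂ r = r

  both-left : ∀ {g f} → x (tl g) <ℤ x (hd g) → x (tl f) <ℤ x (hd f) → x (tl g) <ℤ x (tl f) → (g , true) ≺ (f , true)
  both-left l l' = by-second (in-from-left l) (in-from-left l') refl refl

  both-right : ∀ {g f} → x (hd g) <ℤ x (tl g) → x (hd f) <ℤ x (tl f) → x (tl g) <ℤ x (tl f) → (g , true) ≺ (f , true)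
  both-right r r' = by-second (in-from-right r) (in-from-right r') refl refl

  left-of : ∀ {g f} → hd g ≡ hd f → x (tl g) <ℤ x (tl f) → x (tl f) <ℤ x (hd f) → x (tl g) <ℤ x (hd g)
  left-of {g} h lt l = subst (λ u → x (tl g) <ℤ x u) (sym h) (ℤₚ.<-trans lt l)

  right-of : ∀ {g f} → hd g ≡ hd f → x (tl g) <ℤ x (tl f) → x (hd g) <ℤ x (tl g) → x (hd f) <ℤ x (tl f)
  right-of {f = f} h lt r = subst (λ u → x u <ℤ x (tl f)) h (ℤₚ.<-trans r lt)

  -- After the outgoing darts come the incoming ones from the left or, if there are none, the circle
  -- starts again with those from the right; both kinds are sorted by their tails.
  leftmost-out : ∀ {v o} → v ≢ s → tl o ≡ v → (∀ {g} → tl g ≡ v → ¬ ((o , false) ≺ (g , false))) →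
    ∃ λ f → rot (o , false) ≡ (f , true) × hd f ≡ v × (∀ {g} → hd g ≡ v → ¬ (g ◁ f))
  leftmost-out {v} {o} v≢s refl top with rot (o , false) in r | rot-Next (o , false)
  ... | g , false | te , inj₁ (p , _) = contradiction p (top te)
  ... | g , false | te , inj₂ (min , max) with in-edge v v≢s
  ...   | a , ha = contradiction (in≼out (max (a , true) ha)) (ℤₚ.<-asym (out≼in (min (a , true) ha)))
  leftmost-out v≢s refl top | f , true | he , inj₁ (p , none) = f , refl , he , λ {g} hg g◁f →
    let lt = ◁-in (trans hg (sym he)) g◁f
        l  = left-of {g} {f} (trans hg (sym he)) lt (out≼in (inj₁ p))
    in none (g , true) hg (out-below-in l , both-left l (out≼in (inj₁ p)) lt)
  leftmost-out v≢s refl top | f , true | he , inj₂ (min , max) = f , refl , he , λ {g} hg g◁f →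
    ≺⇒⋡ (both-right (in≼out (max (g , true) hg)) (in≼out (max (f , true) he)) (◁-in (trans hg (sym he)) g◁f)) (min (g , true) hg)

  rot⁻¹-Next : ∀ d → Next (rot⁻¹ d) d
  rot⁻¹-Next d = subst (Next (rot⁻¹ d)) (rot-inv₁ d) (rot-Next (rot⁻¹ d))

  rightmost-out : ∀ {v o} → v ≢ s → tl o ≡ v → (∀ {g} → tl g ≡ v → ¬ ((g , false) ≺ (o , false))) →
    ∃ λ f → rot (f , true) ≡ (o , false) × hd f ≡ v × (∀ {g} → hd g ≡ v → ¬ (f ◁ g))
  rightmost-out {v} {o} v≢s refl low with rot⁻¹ (o , false) in r | rot⁻¹-Next (o , false)
  ... | g , false | te , inj₁ (p , _) = contradiction p (low (sym te))
  ... | g , false | te , inj₂ (min , max) with in-edge v v≢s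
  ...   | a , ha = contradiction (in≼out (max (a , true) (trans ha te))) (ℤₚ.<-asym (out≼in (min (a , true) (trans ha te))))
  rightmost-out {o = o} v≢s refl low | f , true | te , inj₁ (p , none) = f , trans (cong rot (sym r)) (rot-inv₁ _) , sym te , λ {g} hg f◁g →
    let h  = trans (sym te) (sym hg)
        lt = ◁-in h f◁g
        r' = right-of {f} {g} h lt (in≼out (inj₁ p))
    in none (g , true) (sym h) (both-right (in≼out (inj₁ p)) r' lt , in-below-out r')
  rightmost-out {o = o} v≢s refl low | f , true | te , inj₂ (min , max) = f , trans (cong rot (sym r)) (rot-inv₁ _) , sym te , λ {g} hg f◁g →
    let h  = trans (sym te) (sym hg)
    in ≺⇒⋡ (both-left (out≼in (min (f , true) refl)) (out≼in (min (g , true) (sym h))) (◁-in h f◁g)) (max (g , true) (sym h))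

  record Adjacent (k : ℕ) (e e' : Fin m) : Set where
    constructor adj
    field
      alive₁ : Alive k e
      alive₂ : Alive k e'
      order  : e ◁ e'
      none   : ∀ {g} → Alive k g → e ◁ g → ¬ (g ◁ e')

  record Last (k : ℕ) (e : Fin m) : Set where
    constructor last
    field
      alive : Alive k e
      none  : ∀ {g} → Alive k g → ¬ (e ◁ g)

  module Level {k : ℕ} {v : Fin n} (kv : π v ≡ k) where

    fresh : ∀ {g} → tl g ≡ v → Alive (suc k) g
    fresh {g} refl = s≤s (≤-reflexive kv) , subst (_< π (hd g)) kv (π-< g)

    ends-here : ∀ {g} → hd g ≡ v → Alive k g
    ends-here {g} refl = subst (π (tl g) <_) kv (π-< g) , ≤-reflexive (sym kv)

    older : ∀ {g} → Alive (suc k) g → tl g ≢ v → Passes v g × Alive k g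
    older (p , q) t≢v = (subst (_ <_) (sym kv) lt , subst (_< _) (sym kv) q) , lt , <⇒≤ q
      where lt = ℕ.≤∧≢⇒< (s≤s⁻¹ p) (λ eq → t≢v (π-inj (trans eq (sym kv))))

    survives : ∀ {g} → Alive k g → hd g ≢ v → Passes v g × Alive (suc k) g
    survives (p , q) h≢v = (subst (_ <_) (sym kv) p , subst (_< _) (sym kv) lt) , ℕ.m<n⇒m<1+n p , lt
      where lt = ℕ.≤∧≢⇒< q (λ eq → h≢v (π-inj (trans (sym eq) (sym kv))))

    Alive⇒≢t : ∀ {g} → Alive (suc k) g → v ≢ t
    Alive⇒≢t {g} (_ , q) refl = <⇒≱ q (subst (π (hd g) ≤_) kv (π-≤t (hd g)))

    out-of : ∀ {g} → Alive (suc k) g → ∃ λ h → tl h ≡ v × Alive (suc k) h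
    out-of al with out-edge v (Alive⇒≢t al)
    ... | h , th = h , th , fresh th

  unchanged : ∀ {k} → (∀ v → π v ≢ k) → ∀ {g} → (Alive k g → Alive (suc k) g) × (Alive (suc k) g → Alive k g)
  unchanged none = (λ { (p , q) → ℕ.m<n⇒m<1+n p , ℕ.≤∧≢⇒< q (none _ ∘ sym) }) ,
                   (λ { (p , q) → ℕ.≤∧≢⇒< (s≤s⁻¹ p) (none _) , <⇒≤ q })

  same-color : ∀ k {e e'} → Adjacent k e e' → color (e , false) ≡ color (e' , true)
  same-color zero (adj (() , _) _ _ _)
  same-color (suc k) {e} {e'} (adj al al' e◁e' none) with any? (λ v → π v ℕ.≟ k)
  ... | no ¬v = same-color k (adj (proj₂ un al) (proj₂ un al') e◁e' (λ ag → none (proj₁ un ag)))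
    where
    un : ∀ {g} → (Alive k g → Alive (suc k) g) × (Alive (suc k) g → Alive k g)
    un = unchanged (λ v eq → ¬v (v , eq))
  ... | yes (v , kv) with tl e Fin.≟ v | tl e' Fin.≟ v
  ...   | no te | no te' = same-color k (adj (proj₂ (older al te)) (proj₂ (older al' te')) e◁e' none')
    where
    open Level kv
    none' : ∀ {g} → Alive k g → e ◁ g → ¬ (g ◁ e')
    none' {g} ag eg ge' with hd g Fin.≟ v
    ... | no hg = none (proj₂ (survives ag hg)) eg ge'
    -- An edge ending at `v` between the two would put an outgoing edge of `v` between them above
    -- the level.
    ... | yes hg with out-of al
    ...   | h , th , ah = none ah (apart (subst (λ u → x (tl e) <ℤ x u) (sym th) (passes-left (proj₁ (older al te)) hg eg)))
                                  (apart (subst (λ u → x u <ℤ x (tl e')) (sym th) (passes-right (proj₁ (older al' te')) hg ge')))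
  ...   | yes te | yes te' = color-eq (switch r) (turn r)
    where
    open Level kv
    e'≺e : (e' , false) ≺ (e , false)
    e'≺e = ◁-sibling (trans te (sym te')) e◁e'
    free : ∀ z → dartVertex z ≡ tl e' → ¬ Between (e' , false) z (e , false)
    free z zv (inj₂ (le , _)) = ≺⇒⋡ e'≺e le
    free (g , false) tg (inj₁ (p , q)) = none (fresh (trans tg te')) (sibling (trans te (trans (sym te') (sym tg))) q) (sibling tg p)
    free (g , true)  hg (inj₁ (p , q)) = ℤₚ.<-asym (out≼in (inj₁ p)) (in≼out (inj₁ q))
    r : rot (e' , false) ≡ (e , false)
    r = Next-unique _≟D_ (rot-Next (e' , false)) (¬Between⇒Next (trans te (sym te')) free)
  ...   | no te | yes te' with leftmost-out v≢s te' top
    where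
    open Level kv
    v≢s : v ≢ s
    v≢s refl = contradiction (π-reflect (proj₁ (proj₁ (older al te)))) (ℤₚ.<-asym (s-low te))
    e<v : x (tl e) <ℤ x v
    e<v = subst (λ u → x (tl e) <ℤ x u) te' (◁-apart (λ eq → te (trans eq te')) e◁e')
    top : ∀ {g} → tl g ≡ v → ¬ ((e' , false) ≺ (g , false))
    top {g} tg p = none (fresh tg) (apart (subst (λ u → x (tl e) <ℤ x u) (sym tg) e<v)) (sibling (trans tg (sym te')) p)
  ...     | f , r , hf , leftmost = trans (same-color k (adj (proj₂ (older al te)) (ends-here hf) e◁f none'))
                                      (color-eq (proj₂ (reaches (f , true))) (down r (proj₂ (reaches (f , true)))))
    where
    open Level kv
    e<v : x (tl e) <ℤ x v
    e<v = subst (λ u → x (tl e) <ℤ x u) te' (◁-apart (λ eq → te (trans eq te')) e◁e')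
    e◁f : e ◁ f
    e◁f with ◁-compare {e} {f} (λ { refl → <-irrefl (cong π (sym hf)) (proj₂ (proj₁ (older al te))) })
    ... | inj₁ p = p
    ... | inj₂ p = contradiction (passes-right (proj₁ (older al te)) hf p) (ℤₚ.<-asym e<v)
    none' : ∀ {g} → Alive k g → e ◁ g → ¬ (g ◁ f)
    none' {g} ag eg gf with hd g Fin.≟ v
    ... | yes hg = leftmost hg gf
    ... | no hg  = none (proj₂ (survives ag hg)) eg
          (apart (subst (λ u → x (tl g) <ℤ x u) (sym te') (passes-left (proj₁ (survives ag hg)) hf gf)))
  same-color (suc k) {e} {e'} (adj al al' e◁e' none) | yes (v , kv) | yes te | no te' with rightmost-out v≢s te low
    where
    open Level kv
    v≢s : v ≢ s
    v≢s refl = contradiction (π-reflect (proj₁ (proj₁ (older al' te')))) (ℤₚ.<-asym (s-low te'))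
    v<e' : x v <ℤ x (tl e')
    v<e' = subst (λ u → x u <ℤ x (tl e')) te (◁-apart (λ eq → te' (trans (sym eq) te)) e◁e')
    low : ∀ {g} → tl g ≡ v → ¬ ((g , false) ≺ (e , false))
    low {g} tg p = none (fresh tg) (sibling (trans te (sym tg)) p) (apart (subst (λ u → x u <ℤ x (tl e')) (sym tg) v<e'))
  ...     | f , r , hf , rightmost = trans (color-eq (back r (proj₂ (reaches (f , false)))) (proj₂ (reaches (f , false))))
                                      (same-color k (adj (ends-here hf) (proj₂ (older al' te')) f◁e' none'))
    where
    open Level kv
    v<e' : x v <ℤ x (tl e')
    v<e' = subst (λ u → x u <ℤ x (tl e')) te (◁-apart (λ eq → te' (trans (sym eq) te)) e◁e')
    f◁e' : f ◁ e'
    f◁e' with ◁-compare {f} {e'} (λ { refl → <-irrefl (cong π (sym hf)) (proj₂ (proj₁ (older al' te'))) })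
    ... | inj₁ p = p
    ... | inj₂ p = contradiction (passes-left (proj₁ (older al' te')) hf p) (ℤₚ.<-asym v<e')
    none' : ∀ {g} → Alive k g → f ◁ g → ¬ (g ◁ e')
    none' {g} ag fg ge' with hd g Fin.≟ v
    ... | yes hg = rightmost hg fg
    ... | no hg  = none (proj₂ (survives ag hg))
          (apart (subst (λ u → x u <ℤ x (tl g)) (sym te) (passes-right (proj₁ (survives ag hg)) hf fg))) ge'

  s-out-right : ∀ {g} → tl g ≡ s → x (tl g) <ℤ x (hd g)
  s-out-right {g} tg = subst (λ u → x u <ℤ x (hd g)) (sym tg) (s-left (λ eq → tl≢hd g (trans tg (sym eq))))

  e₀-highest : ∀ {g} → tl g ≡ s → (g , false) ≼ (e₀ , false)
  e₀-highest {g} tg with hd g Fin.≟ t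
  ... | yes hg = inj₂ (cong (_, false) (simple g e₀ (trans tg (sym tl-e₀)) (trans hg (sym hd-e₀))))
  ... | no ¬hg = inj₁ (by-second (proj₁ (out-to-right r)) (proj₁ (out-to-right r₀)) (proj₂ (out-to-right r)) (proj₂ (out-to-right r₀))
      (subst (λ u → y (hd g) <ℤ y u) (sym hd-e₀) (t-high ¬hg)))
    where
    r  = s-out-right tg
    r₀ = s-out-right tl-e₀

  -- The outer face closes up around the drawing: the right side of the rightmost edge meets the
  -- left side of `e₀`. The descent ends at `s`, where the angle from the leftmost edge `e₀` round
  -- to the rightmost one is the switch.
  last-color : ∀ k {e} → Last k e → color (e , false) ≡ color (e₀ , true)
  last-color zero (last (() , _) _)
  last-color (suc k) {e} (last al none) with any? (λ v → π v ℕ.≟ k)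
  ... | no ¬v = last-color k (last (proj₂ un al) (λ ag → none (proj₁ un ag)))
    where
    un : ∀ {g} → (Alive k g → Alive (suc k) g) × (Alive (suc k) g → Alive k g)
    un = unchanged (λ v eq → ¬v (v , eq))
  ... | yes (v , kv) with tl e Fin.≟ v
  ...   | no te = last-color k (last (proj₂ (older al te)) none')
    where
    open Level kv
    none' : ∀ {g} → Alive k g → ¬ (e ◁ g)
    none' {g} ag eg with hd g Fin.≟ v
    ... | no hg = none (proj₂ (survives ag hg)) eg
    ... | yes hg with out-of al
    ...   | h , th , ah = none ah (apart (subst (λ u → x (tl e) <ℤ x u) (sym th) (passes-left (proj₁ (older al te)) hg eg)))
  ...   | yes te with v Fin.≟ s
  ...     | yes refl = color-eq (switch r) (turn r)
    where
    open Level kv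
    lowest : ∀ z → dartVertex z ≡ tl e₀ → (e , false) ≼ z
    lowest (g , true)  hg = contradiction (trans hg tl-e₀) (s-no-in g)
    lowest (g , false) tg with ≺-or-≽ (g , false) (e , false) (trans tg (trans tl-e₀ (sym te)))
    ... | inj₁ p = contradiction (sibling (trans te (sym (trans tg tl-e₀))) p) (none (fresh (trans tg tl-e₀)))
    ... | inj₂ p = p
    highest : ∀ z → dartVertex z ≡ tl e₀ → z ≼ (e₀ , false)
    highest (g , true)  hg = contradiction (trans hg tl-e₀) (s-no-in g)
    highest (g , false) tg = e₀-highest (trans tg tl-e₀)
    r : rot (e₀ , false) ≡ (e , false)
    r = Next-unique _≟D_ (rot-Next (e₀ , false)) (trans te (sym tl-e₀) , inj₂ (lowest , highest))
  ...     | no v≢s with rightmost-out v≢s te (λ {g} tg p → none (Level.fresh kv tg) (sibling (trans te (sym tg)) p))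
  ...       | f , r , hf , rightmost = trans (color-eq (back r (proj₂ (reaches (f , false)))) (proj₂ (reaches (f , false))))
                                         (last-color k (last (ends-here hf) none'))
    where
    open Level kv
    none' : ∀ {g} → Alive k g → ¬ (f ◁ g)
    none' {g} ag fg with hd g Fin.≟ v
    ... | yes hg = rightmost hg fg
    ... | no hg  = none (proj₂ (survives ag hg))
          (apart (subst (λ u → x u <ℤ x (tl g)) (sym te) (passes-right (proj₁ (survives ag hg)) hf fg)))

  ≺-left : ∀ {g f} → hd g ≡ hd f → (g , true) ≺ (f , true) → x (tl g) <ℤ x (hd g) → x (tl f) <ℤ x (hd f) → g ◁ f
  ≺-left {g} {f} h p l l' with ◁-compare {g} {f} (λ { refl → ≺-irrefl p })
  ... | inj₁ q = q
  ... | inj₂ q = contradiction (both-left l' l (◁-in (sym h) q)) (≺⇒⋡ p ∘ inj₁)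

  ≺-right : ∀ {g f} → hd g ≡ hd f → (g , true) ≺ (f , true) → x (hd g) <ℤ x (tl g) → x (hd f) <ℤ x (tl f) → g ◁ f
  ≺-right {g} {f} h p r r' with ◁-compare {g} {f} (λ { refl → ≺-irrefl p })
  ... | inj₁ q = q
  ... | inj₂ q = contradiction (both-right r' r (◁-in (sym h) q)) (≺⇒⋡ p ∘ inj₁)

  right≺left : ∀ {g f} → x (hd g) <ℤ x (tl g) → x (tl f) <ℤ x (hd f) → (g , true) ≺ (f , true)
  right≺left r l = by-group (in-from-right r) (in-from-left l) (s≤s z≤n)

  t-in-left : ∀ {g} → hd g ≡ t → x (tl g) <ℤ x (hd g)
  t-in-left {g} hg = subst (λ u → x (tl g) <ℤ x u) (sym hg) (t-right (λ eq → tl≢hd g (trans eq (sym hg))))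

  lowest-at-t : ∀ {e} → hd e ≡ t → (∀ z → dartVertex z ≡ t → (e , true) ≼ z) → e ≡ e₀
  lowest-at-t {e} he min with tl e Fin.≟ s
  ... | yes te = simple e e₀ (trans te (sym tl-e₀)) (trans he (sym hd-e₀))
  ... | no ¬s  = contradiction (min (e₀ , true) hd-e₀)
    (≺⇒⋡ (both-left (t-in-left hd-e₀) (t-in-left he) (subst (λ u → x u <ℤ x (tl e)) (sym tl-e₀) (s-left ¬s))))

  private
    module Peak {e e' : Fin m} (r : rot (e , true) ≡ (e' , true)) where

      h : hd e' ≡ hd e
      h = rot⇒same-vertex {e , true} {e' , true} r

      nx : Next (e , true) (e' , true)
      nx = subst (Next (e , true)) r (rot-Next (e , true))

      adjacent : e ◁ e' → (∀ {g} → hd g ≡ hd e → e ◁ g → ¬ (g ◁ e')) → color (e , false) ≡ color (e' , true)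
      adjacent e◁e' none = same-color (π (hd e)) (adj (ends-here refl) (ends-here h) e◁e' none')
        where
        open Level {π (hd e)} {hd e} refl
        none' : ∀ {g} → Alive (π (hd e)) g → e ◁ g → ¬ (g ◁ e')
        none' {g} ag eg ge' with hd g Fin.≟ hd e
        ... | yes hg = none hg eg ge'
        ... | no hg  = ℤₚ.<-asym (passes-right (proj₁ (survives ag hg)) refl eg) (passes-left (proj₁ (survives ag hg)) h ge')

      rising : x (tl e) <ℤ x (hd e) ⊎ x (hd e') <ℤ x (tl e') → (e , true) ≺ (e' , true) →
        (x (tl e) <ℤ x (hd e) → x (tl e') <ℤ x (hd e')) → (x (hd e') <ℤ x (tl e') → x (hd e) <ℤ x (tl e)) →
        color (e , false) ≡ color (e' , true)
      rising (inj₁ l) p ll _ = adjacent (≺-left (sym h) p l (ll l)) λ {g} hg eg ge' →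
        let lg = left-of {g} {e'} (trans hg (sym h)) (◁-in (trans hg (sym h)) ge') (ll l)
        in Next⇒¬Between nx (g , true) hg (inj₁ (both-left l lg (◁-in (sym hg) eg) , both-left lg (ll l) (◁-in (trans hg (sym h)) ge')))
      rising (inj₂ r') p _ rr = adjacent (≺-right (sym h) p (rr r') r') λ {g} hg eg ge' →
        let rg = right-of {e} {g} (sym hg) (◁-in (sym hg) eg) (rr r')
        in Next⇒¬Between nx (g , true) hg (inj₁ (both-right (rr r') rg (◁-in (sym hg) eg) , both-right rg r' (◁-in (trans hg (sym h)) ge')))

      -- The one face step not covered by `Reaches`, over an angle between two incoming edges.
      -- Either these are neighbours just below their head, or the head is `t` and the angle is the
      -- closing one.
      peak-color : color (e , false) ≡ color (e' , true)
      peak-color with hd e Fin.≟ t | nx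
      ... | yes he | _ , inj₁ (p , none) = rising (inj₁ (t-in-left he)) p (λ _ → t-in-left (trans h he))
              (λ r' → contradiction (t-in-left (trans h he)) (ℤₚ.<-asym r'))
      ... | yes he | _ , inj₂ (min , max) with lowest-at-t (trans h he) (λ z zt → min z (trans zt (sym he)))
      ...   | refl = last-color (π t) (last (subst (λ u → Alive (π u) e) he (π-< e , ≤-refl)) none)
        where
        none : ∀ {g} → Alive (π t) g → ¬ (e ◁ g)
        none {g} (_ , q) eg = ≺⇒⋡ (both-left (t-in-left he) (t-in-left hg) (◁-in (trans he (sym hg)) eg)) (max (g , true) (trans hg (sym he)))
          where
          hg : hd g ≡ t
          hg = π-inj (≤-antisym (π-≤t (hd g)) q)
      peak-color | no he≢t | nx' with out-edge (hd e) he≢t | nx'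
      ... | o , to | _ , inj₁ (p , none) with bend e | bend e'
      ...   | inj₁ l | inj₁ l' = rising (inj₁ l) p (λ _ → l') (λ r' → contradiction l' (ℤₚ.<-asym r'))
      ...   | inj₂ r₁ | inj₂ r₂ = rising (inj₂ r₂) p (λ l → contradiction r₁ (ℤₚ.<-asym l)) (λ _ → r₁)
      ...   | inj₁ l | inj₂ r' = contradiction (inj₁ p) (≺⇒⋡ (right≺left r' l))
      -- Arriving from the right and then from the left, the two edges would have the outgoing edge
      -- `o` in their angle.
      ...   | inj₂ r' | inj₁ l = contradiction (in-below-out r' , out-below-in l) (none (o , false) to)
      peak-color | no he≢t | nx' | o , to | _ , inj₂ (min , max) =
        adjacent (apart (ℤₚ.<-trans l (subst (λ u → x u <ℤ x (tl e')) h r'))) none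
        where
        l : x (tl e) <ℤ x (hd e)
        l = out≼in (max (o , false) to)
        r' : x (hd e') <ℤ x (tl e')
        r' = in≼out (min (o , false) to)
        none : ∀ {g} → hd g ≡ hd e → e ◁ g → ¬ (g ◁ e')
        none {g} hg eg ge' with bend g
        ... | inj₁ lg = ≺⇒⋡ (both-left l lg (◁-in (sym hg) eg)) (max (g , true) hg)
        ... | inj₂ rg = ≺⇒⋡ (both-right rg r' (◁-in (trans hg (sym h)) ge')) (min (g , true) hg)

  color-faceNext : ∀ d → color (faceNext d) ≡ color d
  color-faceNext (e , true) = go (rot (e , false)) refl
    where
    go : ∀ d' → rot (e , false) ≡ d' → color d' ≡ color (e , true)
    go (e' , false) r = color-eq (switch r) (turn r)
    go (e' , true)  r = color-eq (proj₂ (reaches (e' , true))) (down r (proj₂ (reaches (e' , true))))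
  color-faceNext (e , false) = go (rot (e , true)) refl
    where
    go : ∀ d' → rot (e , true) ≡ d' → color d' ≡ color (e , false)
    go (e' , false) r = color-eq (back r (proj₂ (reaches (e , false)))) (proj₂ (reaches (e , false)))
    go (e' , true)  r = sym (Peak.peak-color r)

  isSwitch? : ∀ e → Dec (IsSwitch e)
  isSwitch? e = proj₂ (rot⁻¹ (e , false)) Bool.≟ false

  sources : List (Fin m)
  sources = filter isSwitch? (allFin m)

  color∈ : ∀ d → color d ∈ sources
  color∈ d = ∈-filter⁺ isSwitch? (∈-allFin (color d)) (Reaches⇒IsSwitch (proj₂ (reaches d)))

  face : Dart m → Fin (length sources)
  face d = index (color∈ d)

  face-SameFace : ∀ d d' → (face d ≡ face d' → SameFace d d') × (SameFace d d' → face d ≡ face d')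
  face-SameFace d d' = to , from
    where
    to : face d ≡ face d' → SameFace d d'
    to eq = orbit-trans (Face.orbit-sym (Reaches⇒SameFace (proj₂ (reaches d))))
      (subst (λ σ → SameFace (σ , false) d') (sym same) (Reaches⇒SameFace (proj₂ (reaches d'))))
      where
      same : color d ≡ color d'
      same = trans (sym (lookup-index (color∈ d))) (trans (cong (lookup sources) eq) (lookup-index (color∈ d')))
    from : SameFace d d' → face d ≡ face d'
    from o = lookup-injective (Unique.filter⁺ isSwitch? (Unique.allFin⁺ m))
      (trans (lookup-index (color∈ d)) (trans (sym (orbit-const color color-faceNext o)) (sym (lookup-index (color∈ d')))))

  face-surjective : ∀ i → Σ (Dart m) λ d → face d ≡ i
  face-surjective i = (σ , false) , lookup-injective (Unique.filter⁺ isSwitch? (Unique.allFin⁺ m))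
    (trans (lookup-index (color∈ (σ , false))) (color-eq' (proj₂ (IsSwitch⇒follows-out (proj₂ (∈-filter⁻ isSwitch? {xs = allFin m} (∈-lookup i)))))))
    where
    σ = lookup sources i
    color-eq' : ∀ {e'} → rot (e' , false) ≡ (σ , false) → color (σ , false) ≡ σ
    color-eq' r = Reaches-unique (proj₂ (reaches (σ , false))) (switch r)

  private
    others : List (Fin m)
    others = filter (λ e → ¬? (isSwitch? e)) (allFin m)

    ∈-others : ∀ {e} → ¬ IsSwitch e → e ∈ others
    ∈-others {e} ¬sw = ∈-filter⁺ (λ e → ¬? (isSwitch? e)) (∈-allFin e) ¬sw

    others-¬IsSwitch : ∀ {e} → e ∈ others → ¬ IsSwitch e
    others-¬IsSwitch e∈ = proj₂ (∈-filter⁻ (λ e → ¬? (isSwitch? e)) {xs = allFin m} e∈)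

    not-below : ∀ {e e'} → tl e ≡ tl e' → ¬ IsSwitch e' → ¬ ((e , false) ≺ (e' , false))
    not-below {e} {e'} te ¬sw p with ¬IsSwitch⇒follows-in ¬sw
    ... | i , r with subst (Next (i , true)) r (rot-Next (i , true))
    ...   | a , inj₁ (q , none) = none (e , false) (trans te a) (in-below-out (in≼out (inj₁ q)) , p)
    ...   | a , inj₂ (min , _)  = ≺⇒⋡ p (min (e , false) (trans te a))

    others-tl : ∀ {e e'} → e ∈ others → e' ∈ others → e ≢ e' → tl e ≢ tl e'
    others-tl {e} {e'} e∈ e'∈ e≢e' te with ≺-compare (e , false) (e' , false) te
    ... | inj₁ p           = not-below te (others-¬IsSwitch e'∈) p
    ... | inj₂ (inj₁ refl) = e≢e' refl
    ... | inj₂ (inj₂ p)    = not-below (sym te) (others-¬IsSwitch e∈) p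

    s∉ : ∀ {e} → e ∈ others → tl e ≢ s
    s∉ {e} e∈ te with ¬IsSwitch⇒follows-in (others-¬IsSwitch e∈)
    ... | i , r = s-no-in i (trans (sym (rot⇒same-vertex {i , true} {e , false} r)) te)

    s≢t : s ≢ t
    s≢t eq = s-no-in e₀ (trans hd-e₀ (sym eq))

    vertices : List (Fin n)
    vertices = s ∷ t ∷ map tl others

    vertices-unique : Unique vertices
    vertices-unique = (s≢t ∷ All.tabulate λ v∈ eq → missing (λ e∈ te → s∉ e∈ te) v∈ (sym eq)) ∷
      (All.tabulate (λ v∈ eq → missing (λ {e} _ te → t-no-out e te) v∈ (sym eq))) ∷
      AllPairsₚ.map⁺ (AllPairs-map∈ others-tl (Unique.filter⁺ (λ e → ¬? (isSwitch? e)) (Unique.allFin⁺ m)))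
      where
      missing : ∀ {u} → (∀ {e} → e ∈ others → tl e ≢ u) → ∀ {v} → v ∈ map tl others → v ≢ u
      missing free v∈ refl with ∈-map⁻ tl v∈
      ... | e , e∈ , eq = free e∈ (sym eq)

    vertices-complete : ∀ v → v ∈ vertices
    vertices-complete v with v Fin.≟ s | v Fin.≟ t
    ... | yes v≡s | _       = here v≡s
    ... | no _    | yes v≡t = there (here v≡t)
    ... | no v≢s  | no v≢t with in-edge v v≢s | out-edge v v≢t
    ...   | i , iv | o , ov with rot-cyc (i , true) (o , false) (trans iv (sym ov))
    ...   | k , eq with transition true k {i , true} refl (cong proj₂ eq)
    ...   | i' , o' , r , te = there (there (subst (_∈ map tl others) (trans te iv)
      (∈-map⁺ tl (∈-others λ sw → preceding-ends-differ r (proj₂ (IsSwitch⇒follows-out sw))))))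

  -- The edges that are no switches correspond to the vertices other than `s` and `t`: each of these
  -- has exactly one outgoing edge right after an incoming one.
  euler : n + length sources ≡ m + 2
  euler = trans (cong (_+ length sources) (sym (length-complete vertices-unique vertices-complete)))
    (trans (cong (λ l → 2 + l + length sources) (length-map tl others))
    (trans (cong (λ l → 2 + l) (ℕ.+-comm (length others) (length sources)))
    (trans (cong (λ l → 2 + l) (trans (length-filter-¬ isSwitch? (allFin m)) (length-tabulate id))) (ℕ.+-comm 2 m))))

  private
    _⁀_ : ∀ {u v w} → UWalk H u v → UWalk H v w → UWalk H u w
    here    ⁀ q = q
    fwd e p ⁀ q = fwd e (p ⁀ q)
    bwd e p ⁀ q = bwd e (p ⁀ q)

    walks : ∀ k v → π v < k → UWalk H v s × UWalk H s v
    walks (suc k) v v<k with v Fin.≟ s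
    ... | yes refl = here , here
    ... | no v≢s with in-edge v v≢s
    ...   | e , refl with walks k (tl e) (<-≤-trans (π-< e) (s≤s⁻¹ v<k))
    ...     | to-s , from-s = bwd e to-s , from-s ⁀ fwd e here

    connected : Connected H
    connected u v = proj₁ (walks _ u (n<1+n _)) ⁀ proj₂ (walks _ v (n<1+n _))

    path-up : ∀ {u v} → DPath H u v → y u <ℤ y v
    path-up (edge e)   = upward e
    path-up (cons e p) = ℤₚ.<-trans (upward e) (path-up p)

  isPlaneSTGraph : IsPlaneSTGraph H
  isPlaneSTGraph = (simple , connected , (λ v p → ℤₚ.<-irrefl refl (path-up p)) ,
      length sources , (face , face-surjective , face-SameFace) , euler) ,
    s , t , e₀ , tl-e₀ , hd-e₀ ,
    (λ v → no-in v , λ { refl → s-no-in }) , (λ v → no-out v , λ { refl → t-no-out }) , inj₂ (0 , outer-e₀)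
    where
    no-in : ∀ v → NoIn H v → v ≡ s
    no-in v none with v Fin.≟ s
    ... | yes eq = eq
    ... | no v≢s = contradiction (proj₂ (in-edge v v≢s)) (none _)
    no-out : ∀ v → NoOut H v → v ≡ t
    no-out v none with v Fin.≟ t
    ... | yes eq = eq
    ... | no v≢t = contradiction (proj₂ (out-edge v v≢t)) (none _)

  private
    outer-north : ∀ d → dartVertex d ≡ t → North d (rot d) → SameFace outer (rot d)
    outer-north (e , false) te _ = contradiction te (t-no-out e)
    outer-north (e , true) he north with rot (e , true) | rot-Next (e , true)
    ... | o , false | to , _ = contradiction (trans to he) (t-no-out o)
    ... | e' , true | he' , inj₂ (min , _) = 0 , trans outer-e₀
      (cong (_, true) (sym (lowest-at-t (trans he' he) (λ z zt → min z (trans zt (sym he))))))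
    ... | e' , true | he' , inj₁ (p , _) = ⊥-elim (not-north north)
      where
      not-north : ¬ North (e , true) (e' , true)
      not-north (inj₁ (low , _)) = contradiction (subst (_≤ 1) (in-from-left (t-in-left he)) low) λ { (s≤s ()) }
      not-north (inj₂ (q , _))   = ≺⇒⋡ p q

  drawable : UpwardPlanarLDrawable H
  drawable = x , y , record
    { x-inj = x-inj ; y-inj = y-inj ; upward = upward ; noCross = no-cross
    ; respRot = λ d → Next⇒CcwNext (rot-Next d)
    ; respOuter = λ v v-top d dv north → outer-north d (trans dv (top v v-top)) (NorthIn⇒North north) }
    where
    top : ∀ v → (∀ w → y w ≤ℤ y v) → v ≡ t
    top v v-top with v Fin.≟ t
    ... | yes eq = eq
    ... | no v≢t = contradiction (v-top t) (ℤₚ.<⇒≱ (t-high v≢t))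

  -- Bitonic successor lists of a drawn st-graph

  Descends : Fin m → Fin m → Set
  Descends a b = (b , false) ≺ (a , false)

  module Successors (v : Fin n) where

    private
      insert : ∀ e es → tl e ≡ v → (∀ {a} → a ∈ es → tl a ≡ v) → AllPairs Descends es →
        Σ (List (Fin m)) λ es' → AllPairs Descends es' × e ∈ es' ×
          (∀ {a} → a ∈ es → a ∈ es') × (∀ {a} → a ∈ es' → a ≡ e ⊎ a ∈ es)
      insert e [] te _ _ = [ e ] , [] ∷ [] , here refl , (λ ()) , λ { (here eq) → inj₁ eq }
      insert e (a ∷ as) te all (p ∷ ps) with ≺-compare (e , false) (a , false) (trans te (sym (all (here refl))))
      ... | inj₂ (inj₁ refl) = e ∷ as , p ∷ ps , here refl , id , inj₂
      ... | inj₂ (inj₂ a≺e) = e ∷ a ∷ as , (a≺e ∷ All.map (λ b≺a → ≺-trans b≺a a≺e) p) ∷ p ∷ ps , here refl , there ,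
              λ { (here eq) → inj₁ eq ; (there b∈) → inj₂ b∈ }
      ... | inj₁ e≺a with insert e as te (all ∘ there) ps
      ...   | es' , ps' , e∈ , sub , sup = a ∷ es' , All.tabulate (λ b∈ → below (sup b∈)) ∷ ps' , there e∈ ,
              (λ { (here eq) → here eq ; (there b∈) → there (sub b∈) }) ,
              λ { (here eq) → inj₂ (here eq) ; (there b∈) → ⊎-map id there (sup b∈) }
        where
        below : ∀ {b} → b ≡ e ⊎ b ∈ as → Descends a b
        below (inj₁ refl) = e≺a
        below (inj₂ b∈)   = All.lookup p b∈

      sort : ∀ es → Σ (List (Fin m)) λ L → AllPairs Descends L × (∀ {a} → a ∈ L → tl a ≡ v) ×
        (∀ {a} → a ∈ es → tl a ≡ v → a ∈ L)
      sort [] = [] , [] , (λ ()) , λ ()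
      sort (e ∷ es) with sort es | tl e Fin.≟ v
      ... | L , ps , out , all | no ¬te = L , ps , out , λ { (here refl) te → contradiction te ¬te ; (there a∈) te → all a∈ te }
      ... | L , ps , out , all | yes te with insert e L te out ps
      ...   | L' , ps' , e∈ , sub , sup = L' , ps' , (λ a∈ → out' (sup a∈)) ,
              λ { (here refl) _ → e∈ ; (there a∈) te' → sub (all a∈ te') }
        where
        out' : ∀ {a} → a ≡ e ⊎ a ∈ L → tl a ≡ v
        out' (inj₁ refl) = te
        out' (inj₂ a∈)   = out a∈

      sorted = sort (allFin m)
      descending = proj₁ (proj₂ sorted)

    outs : List (Fin m)
    outs = proj₁ sorted

    outs-tl : ∀ {a} → a ∈ outs → tl a ≡ v
    outs-tl = proj₁ (proj₂ (proj₂ sorted))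

    ∈-outs : ∀ {a} → tl a ≡ v → a ∈ outs
    ∈-outs = proj₂ (proj₂ (proj₂ sorted)) (∈-allFin _)

    private
      -- The last hypothesis accounts for the edges already dropped from the front of the list: they
      -- have higher keys, so none of them lies between two consecutive elements.
      rot-linked : ∀ as → AllPairs Descends as → (∀ {a} → a ∈ as → tl a ≡ v) →
        (∀ {z} → tl z ≡ v → z ∈ as ⊎ (∀ {a} → a ∈ as → Descends z a)) →
        Linked (λ a b → rot (b , false) ≡ (a , false)) as
      rot-linked []           _        _   _    = []
      rot-linked (a ∷ [])     _        _   _    = [-]
      rot-linked (a ∷ b ∷ as) (p ∷ ps) out rest = Next-unique _≟D_ (rot-Next (b , false)) (¬Between⇒Next (trans ta (sym tb)) free) ∷
        rot-linked (b ∷ as) ps (out ∘ there) rest'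
        where
        ta = out (here refl)
        tb = out (there (here refl))
        b≺a : (b , false) ≺ (a , false)
        b≺a = All.lookup p (here refl)
        free : ∀ z → dartVertex z ≡ tl b → ¬ Between (b , false) z (a , false)
        free z zv (inj₂ (le , _)) = ≺⇒⋡ b≺a le
        free (g , true)  hg (inj₁ (q , r)) = ℤₚ.<-asym (out≼in (inj₁ q)) (in≼out (inj₁ r))
        free (g , false) tg (inj₁ (q , r)) with rest (trans tg tb)
        ... | inj₁ (here refl)         = ≺-irrefl r
        ... | inj₁ (there (here refl)) = ≺-irrefl q
        ... | inj₁ (there (there g∈))  = ≺⇒⋡ q (inj₁ (AllPairs-∷ ps g∈))
        ... | inj₂ above               = ≺⇒⋡ r (inj₁ (above (here refl)))
        rest' : ∀ {z} → tl z ≡ v → z ∈ b ∷ as ⊎ (∀ {c} → c ∈ b ∷ as → Descends z c)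
        rest' tz with rest tz
        ... | inj₁ (here refl) = inj₂ (All.lookup p)
        ... | inj₁ (there z∈)  = inj₁ z∈
        ... | inj₂ above       = inj₂ (above ∘ there)

      -- At `s` the leftmost edge is `e₀`, since all edges there bend right and `t` is the highest
      -- head; the angle beyond it is a face step from `outer`. Elsewhere an incoming edge follows.
      first-angle : ∀ {as d rest} → AllPairs Descends as → (∀ {a} → a ∈ as → tl a ≡ v) → (∀ {a} → tl a ≡ v → a ∈ as) →
        map (_, false) as ≡ d ∷ rest → proj₂ (rot d) ≡ true ⊎ SameFace outer (rot d)
      first-angle {a ∷ as} (p ∷ _) out all refl with v Fin.≟ s
      ... | no v≢s with leftmost-out v≢s (out (here refl)) top
        where
        top : ∀ {g} → tl g ≡ v → ¬ ((a , false) ≺ (g , false))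
        top tg q with all tg
        ... | here refl = ≺-irrefl q
        ... | there g∈  = ≺⇒⋡ q (inj₁ (All.lookup p g∈))
      ...   | f , r , _ = inj₁ (cong proj₂ r)
      first-angle {a ∷ as} (p ∷ _) out all refl | yes refl with all tl-e₀
      ... | here refl = inj₂ (1 , cong faceNext outer-e₀)
      ... | there e₀∈ = contradiction (e₀-highest (out (here refl))) (≺⇒⋡ (All.lookup p e₀∈))

    succList : SuccList H v (map (_, false) outs)
    succList = Allₚ.map⁺ (All.tabulate λ {a} a∈ → a , refl , outs-tl a∈) ,
      Unique.map⁺ (cong proj₁) (AllPairs.map (λ { p refl → ≺-irrefl p }) descending) ,
      (λ e te → ∈-map⁺ (_, false) (∈-outs te)) ,
      Linkedₚ.map⁺ (rot-linked outs descending outs-tl (inj₁ ∘ ∈-outs)) ,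
      λ d rest eq → first-angle descending outs-tl ∈-outs eq

    private
      head-< : ∀ {a b} → tl a ≡ tl b → Descends a b → x (hd b) <ℤ x (tl b) → π (hd a) < π (hd b) × x (hd a) <ℤ x (tl a)
      head-< {a} {b} te p lb with bend a
      ... | inj₁ ra = contradiction (by-group (proj₁ (out-to-right ra)) (proj₁ (out-to-left lb)) (s≤s (s≤s z≤n))) (≺⇒⋡ p ∘ inj₁)
      ... | inj₂ la with <-cmp (π (hd a)) (π (hd b))
      ...   | tri< lt _ _ = lt , la
      ...   | tri≈ _ eq _ = contradiction (subst (λ c → (b , false) ≺ (c , false)) (simple a b te (π-inj eq)) p) ≺-irrefl
      ...   | tri> _ _ gt = contradiction (by-second (proj₁ (out-to-left la)) (proj₁ (out-to-left lb)) (proj₂ (out-to-left la)) (proj₂ (out-to-left lb))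
                              (ℤₚ.neg-mono-< (π-reflect gt))) (≺⇒⋡ p ∘ inj₁)

      head-> : ∀ {a b} → tl a ≡ tl b → Descends a b → x (tl a) <ℤ x (hd a) → π (hd b) < π (hd a) × x (tl b) <ℤ x (hd b)
      head-> {a} {b} te p ra with bend b
      ... | inj₂ lb = contradiction (by-group (proj₁ (out-to-right ra)) (proj₁ (out-to-left lb)) (s≤s (s≤s z≤n))) (≺⇒⋡ p ∘ inj₁)
      ... | inj₁ rb with <-cmp (π (hd a)) (π (hd b))
      ...   | tri> _ _ gt = gt , rb
      ...   | tri≈ _ eq _ = contradiction (subst (λ c → (b , false) ≺ (c , false)) (simple a b te (π-inj eq)) p) ≺-irrefl
      ...   | tri< lt _ _ = contradiction (by-second (proj₁ (out-to-right ra)) (proj₁ (out-to-right rb)) (proj₂ (out-to-right ra)) (proj₂ (out-to-right rb))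
                              (π-reflect lt)) (≺⇒⋡ p ∘ inj₁)

      falling : ∀ {a as} → (∀ {b} → b ∈ a ∷ as → tl b ≡ v) → Linked Descends (a ∷ as) → x (tl a) <ℤ x (hd a) →
        Linked (λ k l → l < k) (map (π ∘ hd) (a ∷ as))
      falling out [-] _ = [-]
      falling out (p ∷ ps) ra with head-> (trans (out (here refl)) (sym (out (there (here refl))))) p ra
      ... | lt , rb = lt ∷ falling (out ∘ there) ps rb

      rise : ∀ {j k ks} → j < k → Bitonic H (k ∷ ks) → Bitonic H (j ∷ k ∷ ks)
      rise {j} {k} {ks} j<k bi = go bi refl
        where
        go : ∀ {l} → Bitonic H l → l ≡ k ∷ ks → Bitonic H (j ∷ k ∷ ks)
        go (peak []           p zs up fall) refl = peak [ j ] p zs (j<k ∷ [-]) fall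
        go (peak (_ ∷ [])     p zs up fall) refl = peak (j ∷ k ∷ []) p zs (j<k ∷ up) fall
        go (peak (_ ∷ z ∷ ys) p zs up fall) refl = peak (j ∷ k ∷ z ∷ ys) p zs (j<k ∷ up) fall

      -- Left bends come first, with rising heads, then right bends, with falling heads. At the
      -- change of side either of the two edges may be the peak.
      bitonic-heads : ∀ {as} → (∀ {b} → b ∈ as → tl b ≡ v) → Linked Descends as → Bitonic H (map (π ∘ hd) as)
      bitonic-heads {[]} out _ = empty
      bitonic-heads {a ∷ []} out _ = peak [] (π (hd a)) [] [-] [-]
      bitonic-heads {a ∷ b ∷ as} out (p ∷ ps) with bend a | bend b
      ... | inj₁ ra | _ = peak [] (π (hd a)) (map (π ∘ hd) (b ∷ as)) [-] (falling out (p ∷ ps) ra)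
      ... | inj₂ la | inj₂ lb = rise (proj₁ (head-< (trans (out (here refl)) (sym (out (there (here refl))))) p lb))
            (bitonic-heads (out ∘ there) ps)
      ... | inj₂ la | inj₁ rb with <-cmp (π (hd a)) (π (hd b))
      ...   | tri< lt _ _ = rise lt (bitonic-heads (out ∘ there) ps)
      ...   | tri> _ _ gt = peak [] (π (hd a)) (map (π ∘ hd) (b ∷ as)) [-] (gt ∷ falling (out ∘ there) ps rb)
      ...   | tri≈ _ eq _ = contradiction (subst (λ c → Descends a c) (sym (simple a b
                              (trans (out (here refl)) (sym (out (there (here refl))))) (π-inj eq))) p) ≺-irrefl

    bitonic : Bitonic H (map (π ∘ hd ∘ proj₁) (map (_, false) outs))
    bitonic = subst (Bitonic H) (map-∘ outs) (bitonic-heads outs-tl (Linkedₚ.AllPairs⇒Linked descending))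

  bitonicSTOrdering : HasBitonicSTOrdering H
  bitonicSTOrdering = π , π-inj , π-< , λ v → map (_, false) (Successors.outs v) , Successors.succList v , Successors.bitonic v

-- Faces of the completed graph

-- Each pair costs at most one class: the class of `b` is moved onto that of `a` and its number is
-- punched out.
merge : ∀ {F} (ps : List (Fin F × Fin F)) → Σ ℕ λ F' → Σ (Fin F → Fin F') λ q →
  (∀ j → ∃ λ i → q i ≡ j) × (∀ {a b} → (a , b) ∈ ps → q a ≡ q b) × F ≤ F' + length ps
merge {F} [] = F , id , (λ j → j , refl) , (λ ()) , ≤-reflexive (sym (ℕ.+-identityʳ F))
merge ((a , b) ∷ ps) with merge ps
... | F' , q , surj , same , size with q a Fin.≟ q b
...   | yes qa≡qb = F' , q , surj , (λ { (here refl) → qa≡qb ; (there p) → same p }) ,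
        ≤-trans size (ℕ.+-monoʳ-≤ F' (ℕ.n≤1+n (length ps)))
...   | no qa≢qb with F'
...     | zero   = ⊥-elim (Fin.¬Fin0 (q a))
...     | suc F″ = F″ , collapse ∘ q , surj' , same' , ≤-trans size (≤-reflexive (sym (ℕ.+-suc F″ (length ps))))
  where
  collapse : Fin (suc F″) → Fin F″
  collapse z with q b Fin.≟ z
  ... | yes _   = punchOut (λ eq → qa≢qb (sym eq))
  ... | no qb≢z = punchOut qb≢z
  collapse-punchIn : ∀ j → collapse (punchIn (q b) j) ≡ j
  collapse-punchIn j with q b Fin.≟ punchIn (q b) j
  ... | yes eq = contradiction (sym eq) (Fin.punchInᵢ≢i (q b) j)
  ... | no _   = trans (Fin.punchOut-cong (q b) refl) (Fin.punchOut-punchIn (q b))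
  surj' : ∀ j → ∃ λ i → collapse (q i) ≡ j
  surj' j with surj (punchIn (q b) j)
  ... | i , eq = i , trans (cong collapse eq) (collapse-punchIn j)
  collapse-ab : collapse (q a) ≡ collapse (q b)
  collapse-ab with q b Fin.≟ q a | q b Fin.≟ q b
  ... | yes eq | _     = contradiction (sym eq) qa≢qb
  ... | no _   | yes _ = Fin.punchOut-cong (q b) refl
  ... | no _   | no ¬p = contradiction refl ¬p
  same' : ∀ {c d} → (c , d) ∈ (a , b) ∷ ps → collapse (q c) ≡ collapse (q d)
  same' (here refl) = collapse-ab
  same' (there p)   = cong collapse (same p)

module Regions (H : EmbeddedDigraph) (D : STDrawing H) (G : EmbeddedDigraph) (dag : IsPlaneDAG G) (S : SubDigraph G H)
  (drawing : Drawing.IsUpwardPlanarLDrawing G (STDrawing.x D ∘ SubDigraph.fv S) (STDrawing.y D ∘ SubDigraph.fv S))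
  (s-new : ∀ v → SubDigraph.fv S v ≢ STDrawing.s D) (t-new : ∀ v → SubDigraph.fv S v ≢ STDrawing.t D)
  (vertex-cases : ∀ u → u ≡ STDrawing.s D ⊎ u ≡ STDrawing.t D ⊎ ∃ λ v → u ≡ SubDigraph.fv S v)
  (order : EmbeddedDigraph.n H ≡ 2 + EmbeddedDigraph.n G) where

  private
    module G = EmbeddedDigraph G
    module H = EmbeddedDigraph H
    module GO = Orbits G
    module HO = Orbits H
    module Dr = Drawing.IsUpwardPlanarLDrawing drawing
    module ST = DrawnST H D
  open STDrawing D
  open SubDigraph S
  open H using (m; tl; hd)
  open Embedding G H S (proj₁ dag) layout hiding (x; y)

  yG : Fin G.n → ℤ
  yG v = y (fv v)

  New : Fin m → Set
  New e = ¬ (∃ λ e' → fe e' ≡ e)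

  inImg? : ∀ d → Dec (InImg d)
  inImg? d = anyDart? (λ q → fd q ≟D d)

  ¬InImg⇒New : ∀ {d} → ¬ InImg d → New (proj₁ d)
  ¬InImg⇒New {_ , b} none (e' , eq) = none ((e' , b) , cong (_, b) eq)

  tl-s⇒New : ∀ {e} → tl e ≡ s → New e
  tl-s⇒New te (e' , refl) = s-new _ (trans (sym (tl-fe e')) te)

  hd-t⇒New : ∀ {e} → hd e ≡ t → New e
  hd-t⇒New he (e' , refl) = t-new _ (trans (sym (hd-fe e')) he)

  private
    highest = argmax (allFin G.n) ∈-allFin {λ _ → ⊤} (λ _ → yes tt) yG (G.tl (proj₁ G.outer) , tt)

  apex : Fin G.n
  apex = proj₁ highest

  apex-top : ∀ w → yG w ≤ℤ yG apex
  apex-top w = proj₂ (proj₂ highest) w tt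

  -- Any edge leaving the highest vertex of `G` ends at `t`, the only vertex above. With `e₀` it is
  -- kept out of the merging because in Euler's formula the two new vertices pay for two of the new
  -- edges.
  g₀ : Fin m
  g₀ = proj₁ (out-edge (fv apex) (t-new apex))

  tl-g₀ : tl g₀ ≡ fv apex
  tl-g₀ = proj₂ (out-edge (fv apex) (t-new apex))

  hd-g₀ : hd g₀ ≡ t
  hd-g₀ with vertex-cases (hd g₀)
  ... | inj₁ eq               = contradiction eq (ST.s-no-in g₀)
  ... | inj₂ (inj₁ eq)        = eq
  ... | inj₂ (inj₂ (w , eq)) = contradiction (apex-top w)
    (ℤₚ.<⇒≱ (subst₂ (λ u u' → y u <ℤ y u') tl-g₀ eq (upward g₀)))

  e₀≢g₀ : e₀ ≢ g₀
  e₀≢g₀ eq = s-new apex (trans (sym tl-g₀) (trans (cong tl (sym eq)) tl-e₀))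

  private
    rest? : ∀ e → Dec (New e × e ≢ e₀ × e ≢ g₀)
    rest? e = ¬? (any? (λ e' → fe e' Fin.≟ e)) ×-dec (¬? (e Fin.≟ e₀) ×-dec ¬? (e Fin.≟ g₀))

    rest : List (Fin m)
    rest = filter rest? (allFin m)

    rest⇒ : ∀ {e} → e ∈ rest → New e × e ≢ e₀ × e ≢ g₀
    rest⇒ e∈ = proj₂ (∈-filter⁻ rest? {xs = allFin m} e∈)

    edges : List (Fin m)
    edges = map fe (allFin G.m) ++ e₀ ∷ g₀ ∷ rest

    edges-unique : Unique edges
    edges-unique = Unique.++⁺ (Unique.map⁺ fe-injective (Unique.allFin⁺ G.m))
      ((e₀≢g₀ ∷ All.tabulate (λ e∈ eq → proj₁ (proj₂ (rest⇒ e∈)) (sym eq))) ∷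
       All.tabulate (λ e∈ eq → proj₂ (proj₂ (rest⇒ e∈)) (sym eq)) ∷ Unique.filter⁺ rest? (Unique.allFin⁺ m))
      λ { (p , q) → new q (old p) }
      where
      old : ∀ {e} → e ∈ map fe (allFin G.m) → ∃ λ e' → fe e' ≡ e
      old e∈ with ∈-map⁻ fe e∈
      ... | e' , _ , eq = e' , sym eq
      new : ∀ {e} → e ∈ e₀ ∷ g₀ ∷ rest → New e
      new (here refl)         = tl-s⇒New tl-e₀
      new (there (here refl)) = hd-t⇒New hd-g₀
      new (there (there e∈))  = proj₁ (rest⇒ e∈)

    edges-complete : ∀ e → e ∈ edges
    edges-complete e with any? (λ e' → fe e' Fin.≟ e)
    ... | yes (e' , refl) = ∈-++⁺ˡ (∈-map⁺ fe (∈-allFin e'))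
    ... | no new with e Fin.≟ e₀ | e Fin.≟ g₀
    ...   | yes eq | _      = ∈-++⁺ʳ (map fe (allFin G.m)) (here eq)
    ...   | no _   | yes eq = ∈-++⁺ʳ (map fe (allFin G.m)) (there (here eq))
    ...   | no ne  | no ng  = ∈-++⁺ʳ (map fe (allFin G.m)) (there (there (∈-filter⁺ rest? (∈-allFin e) (new , ne , ng))))

    edges-size : G.m + (2 + length rest) ≡ m
    edges-size = trans (sym (trans (length-++ (map fe (allFin G.m)))
      (cong (_+ (2 + length rest)) (trans (length-map fe (allFin G.m)) (length-tabulate id)))))
      (length-complete edges-unique edges-complete)

    merged = merge (map (λ e → ST.face (e , false) , ST.face (e , true)) rest)
    q = proj₁ (proj₂ merged)

  -- The faces of H merged across all new edges but e₀ and g₀; the last edge at the new vertex s, and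
  -- at the new vertex t, separates two faces that have already been merged around the vertex.
  region : Dart m → Fin (proj₁ merged)
  region d = q (ST.face d)

  region-face : ∀ d → region (H.faceNext d) ≡ region d
  region-face d = cong q (sym (proj₂ (ST.face-SameFace d (H.faceNext d)) (1 , refl)))

  -- If every rotation step except the one at `d₀` keeps the region, the turn that starts behind
  -- `d₀` and ends at it stays in one region; so the two sides of the edge of `d₀` agree after all.
  region-around : ∀ d₀ → (∀ d → H.dartVertex d ≡ H.dartVertex d₀ → d ≢ d₀ → region (H.rot d) ≡ region d) →
    ∀ d → H.dartVertex d ≡ H.dartVertex d₀ → region d ≡ region (H.rot d₀)
  region-around d₀ step d dd₀ with H.rot-cyc (H.rot d₀) d (trans (H.rot-at d₀) (sym dd₀))
  ... | k , refl = go k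
    where
    go : ∀ k → region (iter H.rot k (H.rot d₀)) ≡ region (H.rot d₀)
    go zero = refl
    go (suc k) with iter H.rot k (H.rot d₀) ≟D d₀
    ... | yes eq = cong (region ∘ H.rot) eq
    ... | no ne  = trans (step _ (trans (HO.rot-orbit-at k (H.rot d₀)) (H.rot-at d₀)) ne) (go k)

  private
    region-rest : ∀ {e} → New e → e ≢ e₀ → e ≢ g₀ → region (e , false) ≡ region (e , true)
    region-rest {e} new ne ng = proj₁ (proj₂ (proj₂ (proj₂ merged)))
      (∈-map⁺ (λ e → ST.face (e , false) , ST.face (e , true)) (∈-filter⁺ rest? (∈-allFin e) (new , ne , ng)))

    region-e₀ : region (e₀ , false) ≡ region (e₀ , true)
    region-e₀ = trans (region-around (e₀ , false) step (e₀ , false) refl) (region-face (e₀ , true))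
      where
      step : ∀ d → H.dartVertex d ≡ tl e₀ → d ≢ (e₀ , false) → region (H.rot d) ≡ region d
      step (g , true)  hg _  = contradiction (trans hg tl-e₀) (ST.s-no-in g)
      step (g , false) tg ne = trans (region-face (g , true)) (sym (region-rest (tl-s⇒New (trans tg tl-e₀))
        (λ eq → ne (cong (_, false) eq)) λ eq → s-new apex (trans (sym tl-g₀) (trans (cong tl (sym eq)) (trans tg tl-e₀)))))

    region-g₀ : region (g₀ , false) ≡ region (g₀ , true)
    region-g₀ = sym (trans (region-around (g₀ , true) step (g₀ , true) refl) (region-face (g₀ , false)))
      where
      step : ∀ d → H.dartVertex d ≡ hd g₀ → d ≢ (g₀ , true) → region (H.rot d) ≡ region d
      step (g , false) tg _  = contradiction (trans tg hd-g₀) (ST.t-no-out g)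
      step (g , true)  hg ne with g Fin.≟ e₀
      -- The edge `e₀` also ends at `t`, but it has been settled at `s`, so `g₀` is the only one
      -- left open here.
      ... | yes refl = trans (region-face (g , false)) region-e₀
      ... | no ¬e₀   = trans (region-face (g , false)) (region-rest (hd-t⇒New (trans hg hd-g₀)) ¬e₀ λ eq → ne (cong (_, true) eq))

  region-new : ∀ {e} → New e → region (e , false) ≡ region (e , true)
  region-new {e} new with e Fin.≟ e₀ | e Fin.≟ g₀
  ... | yes refl | _        = region-e₀
  ... | no _     | yes refl = region-g₀
  ... | no ne    | no ng    = region-rest new ne ng

  region-flip : ∀ d → New (proj₁ d) → region (flipD d) ≡ region d
  region-flip (e , false) new = sym (region-new new)
  region-flip (e , true)  new = region-new new

  region-rot : ∀ d → New (proj₁ d) → region (H.rot d) ≡ region d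
  region-rot (e , false) new = trans (region-face (e , true)) (sym (region-new new))
  region-rot (e , true)  new = trans (region-face (e , false)) (region-new new)

  region-rot-iter : ∀ k d → (∀ j → j < k → ¬ InImg (iter H.rot j d)) → region (iter H.rot k d) ≡ region d
  region-rot-iter zero    d none = refl
  region-rot-iter (suc k) d none = trans (region-rot _ (¬InImg⇒New (none k (n<1+n k))))
    (region-rot-iter k d (λ j j<k → none j (ℕ.m<n⇒m<1+n j<k)))

  region-s : ∀ d → H.dartVertex d ≡ s → region d ≡ region (e₀ , false)
  region-s d ds = trans (all d (trans ds (sym tl-e₀))) (sym (all (e₀ , false) refl))
    where
    all = region-around (e₀ , false) λ
      { (g , true) hg _ → contradiction (trans hg tl-e₀) (ST.s-no-in g)
      ; (g , false) tg _ → region-rot (g , false) (tl-s⇒New (trans tg tl-e₀)) }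

  region-t : ∀ d → H.dartVertex d ≡ t → region d ≡ region (g₀ , false)
  region-t d dt = trans (trans (all d (trans dt (sym hd-g₀))) (sym (all (g₀ , true) refl))) (sym region-g₀)
    where
    all = region-around (g₀ , true) λ
      { (g , false) tg _ → contradiction (trans tg hd-g₀) (ST.t-no-out g)
      ; (g , true) hg _ → region-rot (g , true) (hd-t⇒New (trans hg hd-g₀)) }

  dart-at : ∀ v → ∃ λ d → G.dartVertex d ≡ v
  dart-at v with proj₁ (proj₂ dag) v (G.tl (proj₁ G.outer))
  ... | here    = (proj₁ G.outer , false) , refl
  ... | fwd e _ = (e , false) , refl
  ... | bwd e _ = (e , true) , refl

  first : ∀ z v → H.dartVertex z ≡ fv v → ∃ λ d → FirstG z d × region (fd d) ≡ region z
  first z v zv with dart-at v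
  ... | d , dv with H.rot-cyc z (fd d) (trans zv (trans (cong fv (sym dv)) (sym (at-fd d))))
  ... | k , eq with least (λ i → inImg? (iter H.rot i z)) k (d , sym eq)
  ... | j , _ , (d' , eq') , none = d' , (j , sym eq' , none) , trans (cong region eq') (region-rot-iter j z none)

  abstract
    -- The dart of the least return is the key successor of `d` within `G`, and so is `G.rot d`,
    -- because the rotation of `G` respects its drawing.
    first-return : ∀ d → Σ ℕ λ k → iter H.rot (suc k) (fd d) ≡ fd (G.rot d) ×
      (∀ j → 1 ≤ j → j < suc k → ¬ InImg (iter H.rot j (fd d)))
    first-return d with HO.Rot.period (fd d)
    ... | p , eq with least (λ i → inImg? (iter H.rot (suc i) (fd d))) p (d , sym eq)
    ... | j , _ , (d' , eq') , none = j , trans (sym eq') (cong fd same) , none'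
      where
      none' : ∀ i → 1 ≤ i → i < suc j → ¬ InImg (iter H.rot i (fd d))
      none' (suc i) _ i<j = none i (s≤s⁻¹ i<j)
      same : d' ≡ G.rot d
      same = KG.Next-unique _≟D_
        (first-return⇒Next rot-Next j
          (fv-injective (trans (sym (at-fd d')) (trans (cong H.dartVertex eq') (trans (HO.rot-orbit-at (suc j) (fd d)) (at-fd d)))))
          (sym eq') none')
        (KG.CcwNext⇒Next (Dr.respRot d))

  region-after : ∀ d k → (∀ j → 1 ≤ j → j < suc k → ¬ InImg (iter H.rot j (fd d))) →
    ∀ i → i ≤ k → region (iter H.rot (suc i) (fd d)) ≡ region (H.rot (fd d))
  region-after d k none i i≤k = trans (cong region (sym (iter-suc H.rot i (fd d))))
    (region-rot-iter i (H.rot (fd d)) λ j j<i im →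
      none (suc j) (s≤s z≤n) (s≤s (<-≤-trans j<i i≤k)) (subst InImg (iter-suc H.rot j (fd d)) im))

  region-between : ∀ d k → (∀ j → 1 ≤ j → j < suc k → ¬ InImg (iter H.rot j (fd d))) →
    ∀ z → H.dartVertex z ≡ H.dartVertex (fd d) → KH.Between (fd d) z (iter H.rot (suc k) (fd d)) →
    region (iter H.rot (suc k) (fd d)) ≡ region z
  region-between d k none z zd bet with KH.Between-iter H.rot rot-Next k zd bet
  ... | i , i<k , eq = trans (region-after d k none k ≤-refl)
    (trans (sym (region-after d k none i (<⇒≤ i<k))) (cong region eq))

  -- A rotation step of `G` is one step of `H` followed by steps past new darts only, which keep the
  -- region. So each face of `G` has one region.
  region-faceNext : ∀ d → region (fd (G.faceNext d)) ≡ region (fd d)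
  region-faceNext d = trans (cong region (sym (proj₁ (proj₂ (first-return (flipD d))))))
    (trans (region-after (flipD d) _ (proj₂ (proj₂ (first-return (flipD d)))) _ ≤-refl) (region-face (fd d)))

  -- All angles at `s` and all angles at `t` are in one region, as `e₀` links the two vertices, and
  -- `g₀` links `t` to the highest vertex of `G`.
  represent : ∀ z → Σ (Dart G.m) λ d → region (fd d) ≡ region z × (∀ v → H.dartVertex z ≡ fv v → FirstG z d)
  represent z = go (vertex-cases (H.dartVertex z))
    where
    via-g₀ = first (g₀ , false) apex tl-g₀
    Represents = Σ (Dart G.m) λ d → region (fd d) ≡ region z × (∀ v → H.dartVertex z ≡ fv v → FirstG z d)
    old : ∀ v → H.dartVertex z ≡ fv v → (∃ λ d → FirstG z d × region (fd d) ≡ region z) → Represents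
    old v eq (d , fst , same) = d , same , λ _ _ → fst
    go : H.dartVertex z ≡ s ⊎ H.dartVertex z ≡ t ⊎ (∃ λ v → H.dartVertex z ≡ fv v) → Represents
    go (inj₂ (inj₂ (v , eq))) = old v eq (first z v eq)
    go (inj₁ eq) = proj₁ via-g₀ ,
      trans (proj₂ (proj₂ via-g₀)) (sym (trans (region-s z eq) (trans region-e₀ (region-t (e₀ , true) hd-e₀)))) ,
      λ v eq' → contradiction (trans (sym eq') eq) (s-new v)
    go (inj₂ (inj₁ eq)) = proj₁ via-g₀ , trans (proj₂ (proj₂ via-g₀)) (sym (region-t z eq)) ,
      λ v eq' → contradiction (trans (sym eq') eq) (t-new v)

  private
    planar = proj₂ (proj₂ (proj₂ dag))
    F = proj₁ planar
    faceG = proj₁ (proj₁ (proj₂ planar))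
    faceG-surjective = proj₁ (proj₂ (proj₁ (proj₂ planar)))
    faceG-SameFace = proj₂ (proj₂ (proj₁ (proj₂ planar)))

    region-of-face : Fin F → Fin (proj₁ merged)
    region-of-face i = region (fd (proj₁ (faceG-surjective i)))

    region-of-face-≡ : ∀ d → region-of-face (faceG d) ≡ region (fd d)
    region-of-face-≡ d = orbit-const (region ∘ fd) region-faceNext
      (proj₁ (faceG-SameFace d (proj₁ (faceG-surjective (faceG d)))) (sym (proj₂ (faceG-surjective (faceG d)))))

    region-of-face-surjective : ∀ j → ∃ λ i → region-of-face i ≡ j
    region-of-face-surjective j with proj₁ (proj₂ (proj₂ merged)) j
    ... | i , eq with ST.face-surjective i
    ... | z , refl with represent z
    ... | d , same , _ = faceG d , trans (region-of-face-≡ d) (trans same eq)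

    -- The two Euler formulas give `length ST.sources ≡ F + length rest`, and merging across `rest`
    -- removes at most `length rest` classes.
    faces-bound : F ≤ proj₁ merged
    faces-bound = ℕ.+-cancelʳ-≤ (length rest) F (proj₁ merged) (≤-trans (≤-reflexive (sym sizes))
      (≤-trans (proj₂ (proj₂ (proj₂ (proj₂ merged)))) (≤-reflexive (cong (λ l → proj₁ merged + l)
        (length-map (λ e → ST.face (e , false) , ST.face (e , true)) rest)))))
      where
      sizes : length ST.sources ≡ F + length rest
      sizes = ℕ.+-cancelˡ-≡ (2 + G.n) _ _ (trans (cong (_+ length ST.sources) (sym order)) (trans ST.euler (trans (cong (_+ 2) (sym edges-size))
        (trans (ℕ.+-comm _ 2) (cong (λ l → 2 + l) (trans (sym (ℕ.+-assoc G.m 2 (length rest)))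
          (trans (cong (_+ length rest) (sym (proj₂ (proj₂ planar)))) (ℕ.+-assoc G.n F (length rest)))))))))

  region⇒SameFace : ∀ {d d'} → region (fd d) ≡ region (fd d') → G.SameFace d d'
  region⇒SameFace {d} {d'} eq = proj₁ (faceG-SameFace d d') (surjective⇒injective region-of-face faces-bound
    region-of-face-surjective (trans (region-of-face-≡ d) (trans eq (sym (region-of-face-≡ d')))))

  lab : Dart m → Dart G.m
  lab z = proj₁ (represent z)

  lab-SameFace : ∀ {z z'} → region z ≡ region z' → G.SameFace (lab z) (lab z')
  lab-SameFace {z} {z'} eq = region⇒SameFace (trans (proj₁ (proj₂ (represent z))) (trans eq (sym (proj₁ (proj₂ (represent z'))))))

  -- The northern angle of the highest vertex is outer in `G` and contains `g₀`, whose region is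
  -- that of every angle at `t`.
  region-outer : region (fd G.outer) ≡ region (e₀ , true)
  region-outer with dart-at apex
  ... | d , dv with GO.Rot.period d
  ... | p , eq with KG.North-iter G.rot (λ d → KG.CcwNext⇒Next (Dr.respRot d)) p (subst (KG.North d) (sym eq) (KG.North-self d))
  ... | j , _ , north = trans (orbit-const (region ∘ fd) region-faceNext (GO.Face.orbit-sym
          (Dr.respOuter apex apex-top a a-at (KG.North⇒NorthIn north))))
        (trans below (sym (region-t (e₀ , true) hd-e₀)))
    where
    a = iter G.rot j d
    a-at : G.dartVertex a ≡ apex
    a-at = trans (GO.rot-orbit-at j d) dv
    below : region (fd (G.rot a)) ≡ region (g₀ , false)
    below = trans (cong region (sym (proj₁ (proj₂ (first-return a)))))
      (region-between a _ (proj₂ (proj₂ (first-return a))) (g₀ , false)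
        (trans tl-g₀ (trans (cong fv (sym a-at)) (sym (at-fd a))))
        (subst (KH.Between (fd a) (g₀ , false)) (sym (proj₁ (proj₂ (first-return a))))
          (Apex.North⇒Between apex apex-top a-at (trans (G.rot-at a) a-at) north)))

  augments : Augments G H
  augments = fv , fv-injective , fe , fe-injective , tl-fe , hd-fe ,
    (λ d → suc (proj₁ (first-return d)) , s≤s z≤n , proj₂ (first-return d)) ,
    lab ,
    (λ z v zv → proj₂ (proj₂ (represent z)) v zv) ,
    (λ z → lab-SameFace (sym (region-face z))) ,
    (λ z new → lab-SameFace (sym (region-flip z new))) ,
    region⇒SameFace (trans region-outer (trans (cong region (sym outer-e₀)) (sym (proj₁ (proj₂ (represent H.outer))))))

  augmentation : IsPlaneSTGraph H × Augments G H × UpwardPlanarLDrawable H × HasBitonicSTOrdering H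
  augmentation = ST.isPlaneSTGraph , augments , ST.drawable , ST.bitonicSTOrdering

-- The framed drawing, its completion, and the equivalences

module Frame {n : ℕ} (f : Fin n → ℤ) (f-inj : Injective _≡_ _≡_ f) (v₀ : Fin n) where

  private
    lowest  = argmin (allFin n) ∈-allFin {λ _ → ⊤} (λ _ → yes tt) f (v₀ , tt)
    highest = argmax (allFin n) ∈-allFin {λ _ → ⊤} (λ _ → yes tt) f (v₀ , tt)
    lo = ℤ.pred (f (proj₁ lowest))
    hi = ℤ.suc (f (proj₁ highest))

    lo< : ∀ v → lo <ℤ f v
    lo< v = ℤₚ.i≤pred[j]⇒i<j (ℤₚ.pred-mono (proj₂ (proj₂ lowest) v tt))

    <hi : ∀ v → f v <ℤ hi
    <hi v = ℤₚ.suc[i]≤j⇒i<j (ℤₚ.suc-mono (proj₂ (proj₂ highest) v tt))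

    lo<hi : lo <ℤ hi
    lo<hi = ℤₚ.<-trans (lo< v₀) (<hi v₀)

  framed : Fin (2 + n) → ℤ
  framed zero          = lo
  framed (suc zero)    = hi
  framed (suc (suc v)) = f v

  framed-min : ∀ {v} → v ≢ zero → framed zero <ℤ framed v
  framed-min {zero}        ne = contradiction refl ne
  framed-min {suc zero}    _  = lo<hi
  framed-min {suc (suc v)} _  = lo< v

  framed-max : ∀ {v} → v ≢ suc zero → framed v <ℤ framed (suc zero)
  framed-max {zero}        _  = lo<hi
  framed-max {suc zero}    ne = contradiction refl ne
  framed-max {suc (suc v)} _  = <hi v

  framed-injective : Injective _≡_ _≡_ framed
  framed-injective {zero}  {zero}  _  = refl
  framed-injective {zero}  {suc w} eq = contradiction eq (ℤₚ.<⇒≢ (framed-min {suc w} λ ()))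
  framed-injective {suc v} {zero}  eq = contradiction (sym eq) (ℤₚ.<⇒≢ (framed-min {suc v} λ ()))
  framed-injective {suc zero} {suc zero} _ = refl
  framed-injective {suc zero} {suc (suc w)} eq = contradiction (sym eq) (ℤₚ.<⇒≢ (<hi w))
  framed-injective {suc (suc v)} {suc zero} eq = contradiction eq (ℤₚ.<⇒≢ (<hi v))
  framed-injective {suc (suc v)} {suc (suc w)} eq = cong (λ u → suc (suc u)) (f-inj eq)

module Augment (G : EmbeddedDigraph) (dag : IsPlaneDAG G) (xG yG : Fin (EmbeddedDigraph.n G) → ℤ)
  (drawing : Drawing.IsUpwardPlanarLDrawing G xG yG) where

  private
    module G = EmbeddedDigraph G
    module GO = Orbits G
    module Dr = Drawing.IsUpwardPlanarLDrawing drawing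

  simpleG : Simple G
  simpleG = proj₁ dag

  module X = Frame xG Dr.x-inj (G.tl (proj₁ G.outer))
  module Y = Frame yG Dr.y-inj (G.tl (proj₁ G.outer))

  x y : Fin (2 + G.n) → ℤ
  x = X.framed
  y = Y.framed

  s t : Fin (2 + G.n)
  s = zero
  t = suc zero

  fv : Fin G.n → Fin (2 + G.n)
  fv v = suc (suc v)

  fv-injective : Injective _≡_ _≡_ fv
  fv-injective refl = refl

  open Completion x y s t X.framed-min Y.framed-min X.framed-max Y.framed-max

  old-edge : Fin G.m → Edge
  old-edge e = fv (G.tl e) , fv (G.hd e)

  private
    old-edges : List Edge
    old-edges = map old-edge (allFin G.m)

    -- Only crossings with `(s , t)` need an argument: no edge passes the height of `t`, and no
    -- horizontal segment of `G` reaches as far left as `s`.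
    framed-valid : Valid ((s , t) ∷ old-edges)
    framed-valid = record
      { root = here refl
      ; unique = All.tabulate (λ e∈ eq → fresh (subst (_∈ old-edges) (sym eq) e∈)) ∷
          Unique.map⁺ (λ eq → simpleG _ _ (fv-injective (cong proj₁ eq)) (fv-injective (cong proj₂ eq))) (Unique.allFin⁺ G.m)
      ; upward = λ { (here refl) → Y.framed-min {t} (λ ()) ; (there e∈) → up e∈ }
      ; no-cross = no-cross₀ }
      where
      fresh : ¬ ((s , t) ∈ old-edges)
      fresh e∈ with ∈-map⁻ old-edge e∈
      ... | _ , _ , ()
      up : ∀ {u w} → (u , w) ∈ old-edges → y u <ℤ y w
      up e∈ with ∈-map⁻ old-edge e∈
      ... | e , _ , refl = Dr.upward e
      max-not-inside : ∀ u w → ¬ Inside (y u) (y w) (y t)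
      max-not-inside u w (inj₁ (_ , t<w)) = ℤₚ.<-irrefl refl (ℤₚ.<-≤-trans t<w (≤t w))
        where
        ≤t : ∀ v → y v ≤ℤ y t
        ≤t v with v Fin.≟ t
        ... | yes refl = ℤₚ.≤-refl
        ... | no v≢t   = ℤₚ.<⇒≤ (Y.framed-max v≢t)
      max-not-inside u w (inj₂ (w<t , t<u)) with u Fin.≟ t
      ... | yes refl = ℤₚ.<-irrefl refl t<u
      ... | no u≢t   = ℤₚ.<-asym t<u (Y.framed-max u≢t)
      no-hit-root : ∀ {e} → ¬ Crosses e (s , t)
      no-hit-root {u , w} (ins , _) = max-not-inside u w ins
      no-root-hit : ∀ {f} → f ∈ old-edges → ¬ Crosses (s , t) f
      no-root-hit f∈ (_ , ins) with ∈-map⁻ old-edge f∈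
      no-root-hit f∈ (_ , inj₁ (p<s , _)) | f , _ , refl = ℤₚ.<-asym p<s (X.framed-min {fv (G.tl f)} (λ ()))
      no-root-hit f∈ (_ , inj₂ (p<s , _)) | f , _ , refl = ℤₚ.<-asym p<s (X.framed-min {fv (G.hd f)} (λ ()))
      clean : ∀ {e f} → e ∈ old-edges → f ∈ old-edges → ¬ Crosses e f
      clean e∈ f∈ with ∈-map⁻ old-edge e∈ | ∈-map⁻ old-edge f∈
      ... | e , _ , refl | f , _ , refl = Dr.noCross e f

      no-cross₀ : ∀ {e f} → e ∈ (s , t) ∷ old-edges → f ∈ (s , t) ∷ old-edges → ¬ Crosses e f
      no-cross₀ {e} _          (here refl) = no-hit-root {e}
      no-cross₀     (here refl) (there f∈) = no-root-hit f∈
      no-cross₀     (there e∈)  (there f∈) = clean e∈ f∈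

  abstract
    completed : Extension ((s , t) ∷ old-edges) (λ E → ∀ v → Complete E v)
    completed = completion framed-valid

  E : List Edge
  E = proj₁ completed

  open Valid (proj₁ (proj₂ completed))

  m : ℕ
  m = length E

  tl hd : Fin m → Fin (2 + G.n)
  tl e = proj₁ (lookup E e)
  hd e = proj₂ (lookup E e)

  simple : ∀ e e' → tl e ≡ tl e' → hd e ≡ hd e' → e ≡ e'
  simple e e' te he = lookup-injective unique (cong₂ _,_ te he)

  upwardH : ∀ e → y (tl e) <ℤ y (hd e)
  upwardH e = upward (∈-lookup e)

  e₀ : Fin m
  e₀ = index root

  tl-e₀ : tl e₀ ≡ s
  tl-e₀ = cong proj₁ (lookup-index root)

  hd-e₀ : hd e₀ ≡ t
  hd-e₀ = cong proj₂ (lookup-index root)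

  in-edge : ∀ v → v ≢ s → ∃ λ e → hd e ≡ v
  in-edge v v≢s with proj₂ (proj₂ (proj₂ (proj₂ completed)) v) v≢s
  ... | _ , e∈ = index e∈ , cong proj₂ (lookup-index e∈)

  out-edge : ∀ v → v ≢ t → ∃ λ e → tl e ≡ v
  out-edge v v≢t with proj₁ (proj₂ (proj₂ (proj₂ completed)) v) v≢t
  ... | _ , e∈ = index e∈ , cong proj₁ (lookup-index e∈)

  layout : Layout tl hd
  layout = record
    { x = x ; y = y ; x-inj = X.framed-injective ; y-inj = Y.framed-injective ; upward = upwardH ; simple = simple }

  private
    module R = RotationSystem tl hd layout (e₀ , true)

  H : EmbeddedDigraph
  H = R.graph

  stDrawing : STDrawing H
  stDrawing = record
    { layout = layout ; no-cross = λ e f → no-cross (∈-lookup e) (∈-lookup f) ; rot-Next = R.graph-Next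
    ; s = s ; t = t ; e₀ = e₀ ; tl-e₀ = tl-e₀ ; hd-e₀ = hd-e₀
    ; s-left = X.framed-min ; s-low = Y.framed-min ; t-right = X.framed-max ; t-high = Y.framed-max
    ; in-edge = in-edge ; out-edge = out-edge ; outer-e₀ = refl }

  private
    old∈ : ∀ e → old-edge e ∈ E
    old∈ e = proj₁ (proj₂ (proj₂ completed)) (there (∈-map⁺ old-edge (∈-allFin e)))

  fe : Fin G.m → Fin m
  fe e = index (old∈ e)

  tl-fe : ∀ e → tl (fe e) ≡ fv (G.tl e)
  tl-fe e = cong proj₁ (lookup-index (old∈ e))

  hd-fe : ∀ e → hd (fe e) ≡ fv (G.hd e)
  hd-fe e = cong proj₂ (lookup-index (old∈ e))

  fe-injective : Injective _≡_ _≡_ fe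
  fe-injective {e} {e'} eq = simpleG e e'
    (fv-injective (trans (sym (tl-fe e)) (trans (cong tl eq) (tl-fe e'))))
    (fv-injective (trans (sym (hd-fe e)) (trans (cong hd eq) (hd-fe e'))))

  vertex-cases : ∀ u → u ≡ s ⊎ u ≡ t ⊎ ∃ λ v → u ≡ fv v
  vertex-cases zero          = inj₁ refl
  vertex-cases (suc zero)    = inj₂ (inj₁ refl)
  vertex-cases (suc (suc v)) = inj₂ (inj₂ (v , refl))

  subDigraph : SubDigraph G H
  subDigraph = record
    { fv = fv ; fv-injective = fv-injective ; fe = fe ; fe-injective = fe-injective ; tl-fe = tl-fe ; hd-fe = hd-fe }

  open Regions H stDrawing G dag subDigraph drawing (λ v ()) (λ v ()) vertex-cases refl using (augmentation)

  augmentable : Σ EmbeddedDigraph λ H → IsPlaneSTGraph H × Augments G H × UpwardPlanarLDrawable H × HasBitonicSTOrdering H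
  augmentable = H , augmentation

bitonic⇒drawable : (H : EmbeddedDigraph) → IsPlaneSTGraph H → HasBitonicSTOrdering H → UpwardPlanarLDrawable H
bitonic⇒drawable H st ordering = Placement.drawable H st ordering

restriction : (G H : EmbeddedDigraph) → IsPlaneDAG G → IsPlaneSTGraph H → Augments G H →
  UpwardPlanarLDrawable H → UpwardPlanarLDrawable G
restriction G H dag st aug (xH , yH , drawing) = Restrict.restricted G H (proj₁ dag) st aug xH yH drawing

theorem2 : (G : EmbeddedDigraph) → IsPlaneDAG G →
    (UpwardPlanarLDrawable G ⇔
    Σ EmbeddedDigraph (λ H → IsPlaneSTGraph H × Augments G H × UpwardPlanarLDrawable H))
    × (UpwardPlanarLDrawable G ⇔
    Σ EmbeddedDigraph (λ H → IsPlaneSTGraph H × Augments G H × HasBitonicSTOrdering H))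
theorem2 G dag =
  mk⇔ (λ dr → forget₁ (augmented dr)) (λ { (H , st , aug , dr) → restriction G H dag st aug dr }) ,
  mk⇔ (λ dr → forget₂ (augmented dr)) (λ { (H , st , aug , bitonic) → restriction G H dag st aug (bitonic⇒drawable H st bitonic) })
  where
  Augmented : Set
  Augmented = Σ EmbeddedDigraph λ H → IsPlaneSTGraph H × Augments G H × UpwardPlanarLDrawable H × HasBitonicSTOrdering H
  augmented : UpwardPlanarLDrawable G → Augmented
  augmented (xG , yG , drawing) = Augment.augmentable G dag xG yG drawing
  forget₁ : Augmented → Σ EmbeddedDigraph λ H → IsPlaneSTGraph H × Augments G H × UpwardPlanarLDrawable H
  forget₁ (H , st , aug , dr , _) = H , st , aug , dr
  forget₂ : Augmented → Σ EmbeddedDigraph λ H → IsPlaneSTGraph H × Augments G H × HasBitonicSTOrdering H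
  forget₂ (H , st , aug , _ , bitonic) = H , st , aug , bitonic
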